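{- Let $n_1,\ldots,n_s$ be distinct positive integers and $r_1,\ldots,r_s$ positive integers such that $r_i\geq 3$ for some $i\in\{1,\ldots,s\}$. Then the complete $k$-partite graph $K_{r_1.n_1,\ldots,r_s.n_s}$ (with $k=\sum_i r_i$) is $S$-determined.
   Context: For a simple graph $G$ with adjacency matrix $A(G)$, the Seidel matrix is $S(G)=J-I-2A(G)$, where $I$ is the identity matrix and $J$ the all-ones matrix. For $U\subset V(G)$, Seidel switching with respect to $U$ deletes all edges between $U$ and $V(G)\setminus U$ and adds all non-edges between them; two graphs are switching equivalent if one is obtained from the other by Seidel switching. A graph $G$ is $S$-determined (Seidel determined up to switching) if every graph with the same Seidel spectrum as $G$ is switching equivalent to a graph isomorphic to $G$. $K_{r_1.n_1,\ldots,r_s.n_s}$ denotes the complete multipartite graph having exactly $r_i$ parts of size $n_i$ for each $i$; two vertices are adjacent iff they lie in different parts. -}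

module Defs where

open import Data.Bool using (Bool; true; false; not; if_then_else_; _xor_)
open import Data.Nat as ℕ using (ℕ; zero; suc)
open import Data.Fin as Fin using (Fin; zero; suc; toℕ; splitAt; punchIn)
open import Data.Fin.Properties using (_≟_)
open import Data.Integer as ℤ using (ℤ; +_; _-_; _*_; -_)
open import Data.List using (List; []; _∷_; replicate; concatMap)
open import Data.Nat.ListAction using (sum)
open import Data.Product using (_×_; _,_; ∃; ∃-syntax; Σ)
open import Data.Sum using (inj₁; inj₂)
open import Function.Bundles using (_↔_; Inverse)
open import Relation.Binary.PropositionalEquality using (_≡_; refl; cong)
open import Relation.Nullary using (yes; no; Dec)
open import Relation.Nullary.Decidable using (⌊_⌋)

record Graph (n : ℕ) : Set where
  field
    adj   : Fin n → Fin n → Bool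
    sym   : ∀ i j → adj i j ≡ adj j i
    irrefl : ∀ i → adj i i ≡ false
open Graph public

Matrix : ℕ → Set
Matrix n = Fin n → Fin n → ℤ

sumFin : ∀ {n} → (Fin n → ℤ) → ℤ
sumFin {zero}  f = + 0
sumFin {suc n} f = f zero ℤ.+ sumFin (λ j → f (suc j))

sign : ℕ → ℤ
sign zero          = + 1
sign (suc zero)    = - (+ 1)
sign (suc (suc k)) = sign k

det : ∀ {n} → Matrix n → ℤ
det {zero}  M = + 1
det {suc n} M =
  sumFin (λ j → sign (toℕ j) * M zero j * det (λ a b → M (suc a) (punchIn j b)))

δ : ∀ {n} → Fin n → Fin n → ℤ
δ i j = if ⌊ i ≟ j ⌋ then + 1 else + 0

b2z : Bool → ℤ
b2z true  = + 1
b2z false = + 0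

seidel : ∀ {n} → Graph n → Matrix n
seidel G i j = + 1 - δ i j - (+ 2) * b2z (adj G i j)

charPolyAt : ∀ {n} → Matrix n → ℤ → ℤ
charPolyAt M t = det (λ i j → t * δ i j - M i j)

-- Same Seidel spectrum: equal Seidel characteristic polynomials
-- (an integer polynomial of degree n is determined by its values on ℤ).
SeidelCospectral : ∀ {n} → Graph n → Graph n → Set
SeidelCospectral G H = ∀ (t : ℤ) → charPolyAt (seidel G) t ≡ charPolyAt (seidel H) t

switchAdj : ∀ {n} → Graph n → (Fin n → Bool) → Fin n → Fin n → Bool
switchAdj G U i j = (U i xor U j) xor adj G i j

SwitchingIso : ∀ {n} → Graph n → Graph n → Set
SwitchingIso {n} H G =
  ∃[ U ] Σ (Fin n ↔ Fin n) λ σ →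
    (∀ i j → adj G (Inverse.to σ i) (Inverse.to σ j) ≡ switchAdj H U i j)

-- S-determined: every graph with the same Seidel spectrum is switching
-- equivalent to a graph isomorphic to G.  (Cospectral graphs have the same
-- number of vertices, so H ranges over graphs on Fin n.)
SDetermined : ∀ {n} → Graph n → Set
SDetermined {n} G = ∀ (H : Graph n) → SeidelCospectral G H → SwitchingIso H G

partOf : (ps : List ℕ) → Fin (sum ps) → ℕ
partOf []       ()
partOf (p ∷ ps) v with splitAt p v
... | inj₁ _ = 0
... | inj₂ w = suc (partOf ps w)

mpAdj : (ps : List ℕ) → Fin (sum ps) → Fin (sum ps) → Bool
mpAdj ps i j = not ⌊ partOf ps i ℕ.≟ partOf ps j ⌋

private
  notDec-sym : ∀ (a b : ℕ) → not ⌊ a ℕ.≟ b ⌋ ≡ not ⌊ b ℕ.≟ a ⌋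
  notDec-sym a b with a ℕ.≟ b | b ℕ.≟ a
  ... | yes _ | yes _ = refl
  ... | no _  | no _  = refl
  ... | yes p | no q  with q (Relation.Binary.PropositionalEquality.sym p)
  ... | ()
  notDec-sym a b | no q | yes p with q (Relation.Binary.PropositionalEquality.sym p)
  ... | ()

  notDec-refl : ∀ (a : ℕ) → not ⌊ a ℕ.≟ a ⌋ ≡ false
  notDec-refl a with a ℕ.≟ a
  ... | yes _ = refl
  ... | no q with q refl
  ... | ()

completeMultipartite : (ps : List ℕ) → Graph (sum ps)
completeMultipartite ps = record
  { adj    = mpAdj ps
  ; sym    = λ i j → notDec-sym (partOf ps i) (partOf ps j)
  ; irrefl = λ i → notDec-refl (partOf ps i)
  }

partSizes : List (ℕ × ℕ) → List ℕ
partSizes = concatMap (λ { (r , m) → replicate r m })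

K : (rn : List (ℕ × ℕ)) → Graph (sum (partSizes rn))
K rn = completeMultipartite (partSizes rn)

{-# OPTIONS --safe #-}

-- Write M = S + I, so that M = 2B − J for a complete multipartite graph, with B the block matrix of its
-- parts. There det (M + x) = ∏ x^(p−1) (x + 2p) · (1 − ∑ p / (x + 2p)) is negative at x = 1/2 when there
-- are at least three parts and changes sign only once beyond, with positive speed; hence for every
-- cospectral H the form M + 1/2 has no negative definite plane. The two switching classes on five
-- vertices that are not complete multipartite do have such a plane, so H avoids them, which makes
-- "every triple through i and j is even" an equivalence relation with H switching equivalent to the
-- complete multipartite graph of its classes. Finally the part sizes: with P = ∏ (1 + 2 p z) and
-- θ = z d/dz, the spectrum determines 2 P − θ P, that is, P up to a multiple of z². At a triple root of
-- the given P, (θ P')² − P' θ² P' vanishes for the other product P' as well, which forces P' = P since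
-- this expression is a sum of squares with positive coefficients at negative z.

module Submission where

open import Defs as D hiding (sym; det; δ; sign; Matrix; sumFin)
open import Data.Nat using (ℕ; zero; suc; _≤_)
import Data.Nat as ℕ
import Data.Nat.Properties as ℕₚ
open import Data.Nat.ListAction using (sum)
open import Data.Product using (_×_; _,_; proj₁; proj₂; Σ)
open import Data.Sum using (_⊎_; inj₁; inj₂; [_,_]′)
import Data.Sum as Sum
open import Data.List using (List; []; _∷_; map; length)
import Data.List as List
open import Data.List.Relation.Unary.All using (All; []; _∷_)
open import Data.List.Relation.Unary.Any using (Any; here; there)
open import Data.List.Relation.Unary.Unique.Propositional using (Unique)
open import Data.List.Relation.Binary.Permutation.Propositional using (_↭_; ↭-refl; ↭-sym; ↭-trans; prep; swap)
open import Data.Bool using (Bool; true; false; not; if_then_else_; _xor_; T)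
import Data.Bool as Bool
open import Data.Bool.Solver using (module xor-∧-Solver)
open import Data.Fin using (Fin; zero; suc; toℕ; punchIn; splitAt; join)
open import Data.Fin.Patterns using (0F; 1F; 2F; 3F; 4F)
open import Data.Fin.Properties using (_≟_; suc-injective; all?; any?; ¬∀⟶∃¬; splitAt-join; join-splitAt)
open import Data.Integer as ℤ using (ℤ; -[1+_]) renaming (+_ to pos)
import Data.Integer.Properties as ℤₚ
import Data.Rational as ℚ
import Data.Rational.Properties as ℚₚ
import Data.Rational.Unnormalised as ℚᵘ
import Data.Rational.Unnormalised.Properties as ℚᵘₚ
open import Data.Empty using (⊥; ⊥-elim)
open import Data.Unit using (tt)
open import Function using (_∘_; id)
open import Function.Bundles using (_↔_; Inverse; mk↔ₛ′)
open import Relation.Nullary using (yes; no; Dec; ¬_; contradiction)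
open import Relation.Nullary.Decidable using (⌊_⌋; toWitness; _→-dec_; dec⇒maybe)
open import Relation.Binary.PropositionalEquality using (_≡_; _≢_; refl; sym; trans; cong; cong₂; subst; module ≡-Reasoning)
import Data.List.Properties as Listₚ
import Data.List.Relation.Unary.All.Properties as Allₚ
open import Data.Fin.Permutation using (↔⇒≡)
open import Algebra.Bundles using (CommutativeRing)
open import Algebra.Structures using (IsCommutativeRing)
open import Algebra.Solver.Ring.AlmostCommutativeRing using (AlmostCommutativeRing; fromCommutativeRing; _-Raw-AlmostCommutative⟶_)
open import Data.Maybe as Maybe using (Maybe)

-- Rational numbers

-- Bounds on the entries, a gap between the determinant and 0, and the monotonicity of y ∙ (M + x)⁻¹
-- y stand in for the continuity of eigenvalues, and the crossing is located only to within a
-- rational e. The shift 1/2 is a compromise. It is large enough to make every x + 2p and every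
-- power of x positive, and small enough for two things: each p / (x + 2p) is still at least 2/5, so
-- that three parts push the sum past 1, and the exceptional classes keep two negative eigenvalues
-- (the pentagon has 1 - √5 twice before the shift). The triple root works because θ doubles z²: if
-- P and P' differ by q z², then θ P and θ P' differ by 2 q z², and θ² P and θ² P' by 4 q z². Where
-- P, θ P and θ² P are all 0, the three values for P' form a geometric progression, so the unknown q
-- drops out of (θ P')² - P' θ² P'.

private

  [_]₁ : ℤ → ℚᵘ.ℚᵘ
  [ z ]₁ = ℚᵘ.mkℚᵘ z 0

  toℚᵘ-/1 : ∀ z → ℚ.toℚᵘ (z ℚ./ 1) ℚᵘ.≃ [ z ]₁
  toℚᵘ-/1 z = ℚₚ.toℚᵘ-fromℚᵘ [ z ]₁

  /1-homo-+ : ∀ a b → (a ℤ.+ b) ℚ./ 1 ≡ (a ℚ./ 1) ℚ.+ (b ℚ./ 1)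
  /1-homo-+ a b = ℚₚ.toℚᵘ-injective (begin
      ℚ.toℚᵘ ((a ℤ.+ b) ℚ./ 1)                      ≈⟨ toℚᵘ-/1 (a ℤ.+ b) ⟩
      [ a ℤ.+ b ]₁                                  ≈⟨ ℚᵘ.*≡* (cong (ℤ._* (pos 1)) (cong₂ ℤ._+_ (sym (ℤₚ.*-identityʳ a)) (sym (ℤₚ.*-identityʳ b)))) ⟩
      [ a ]₁ ℚᵘ.+ [ b ]₁                            ≈⟨ ℚᵘₚ.+-cong (toℚᵘ-/1 a) (toℚᵘ-/1 b) ⟨
      ℚ.toℚᵘ (a ℚ./ 1) ℚᵘ.+ ℚ.toℚᵘ (b ℚ./ 1)        ≈⟨ ℚₚ.toℚᵘ-homo-+ (a ℚ./ 1) (b ℚ./ 1) ⟨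
      ℚ.toℚᵘ ((a ℚ./ 1) ℚ.+ (b ℚ./ 1))              ∎)
    where open ℚᵘₚ.≃-Reasoning

  /1-homo-neg : ∀ z → (ℤ.- z) ℚ./ 1 ≡ ℚ.- (z ℚ./ 1)
  /1-homo-neg z = ℚₚ.toℚᵘ-injective (begin
      ℚ.toℚᵘ ((ℤ.- z) ℚ./ 1)  ≈⟨ toℚᵘ-/1 (ℤ.- z) ⟩
      ℚᵘ.- [ z ]₁             ≈⟨ ℚᵘₚ.-‿cong (toℚᵘ-/1 z) ⟨
      ℚᵘ.- ℚ.toℚᵘ (z ℚ./ 1)   ≈⟨ ℚₚ.toℚᵘ-homo‿- (z ℚ./ 1) ⟨
      ℚ.toℚᵘ (ℚ.- (z ℚ./ 1))  ∎)
    where open ℚᵘₚ.≃-Reasoning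

  /1-homo-* : ∀ a b → (a ℤ.* b) ℚ./ 1 ≡ (a ℚ./ 1) ℚ.* (b ℚ./ 1)
  /1-homo-* a b = ℚₚ.toℚᵘ-injective (begin
      ℚ.toℚᵘ ((a ℤ.* b) ℚ./ 1)                      ≈⟨ toℚᵘ-/1 (a ℤ.* b) ⟩
      [ a ]₁ ℚᵘ.* [ b ]₁                            ≈⟨ ℚᵘₚ.*-cong (toℚᵘ-/1 a) (toℚᵘ-/1 b) ⟨
      ℚ.toℚᵘ (a ℚ./ 1) ℚᵘ.* ℚ.toℚᵘ (b ℚ./ 1)        ≈⟨ ℚₚ.toℚᵘ-homo-* (a ℚ./ 1) (b ℚ./ 1) ⟨
      ℚ.toℚᵘ ((a ℚ./ 1) ℚ.* (b ℚ./ 1))              ∎)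
    where open ℚᵘₚ.≃-Reasoning

  -- The denominator is at least 1. This is the source of `archimedean`.
  ≤-∣numerator∣ : ∀ a → a ℚ.≤ (pos ℤ.∣ ℚ.↥ a ∣) ℚ./ 1
  ≤-∣numerator∣ (ℚ.mkℚ n d-1 c) = ℚₚ.toℚᵘ-cancel-≤
    (ℚᵘₚ.≤-trans {j = [ pos ℤ.∣ n ∣ ]₁} (ℚᵘ.*≤* (num n d-1)) (ℚᵘₚ.≤-reflexive (ℚᵘₚ.≃-sym (toℚᵘ-/1 (pos ℤ.∣ n ∣)))))
    where
    num : ∀ z d → z ℤ.* (pos 1) ℤ.≤ (pos ℤ.∣ z ∣) ℤ.* (pos (suc d))
    num (pos k) d = subst (ℤ._≤ (pos k) ℤ.* (pos (suc d))) (sym (ℤₚ.*-identityʳ (pos k)))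
                    (subst ((pos k) ℤ.≤_) (ℤₚ.pos-* k (suc d)) (ℤ.+≤+ (ℕₚ.m≤m*n k (suc d))))
    num -[1+ k ] d = subst (ℤ._≤ (pos (suc k)) ℤ.* (pos (suc d))) (sym (ℤₚ.*-identityʳ -[1+ k ])) ℤ.-≤+

infix  4 _≼_ _≺_
infixl 6 _+_ _-_
infixl 7 _*_
infix  8 -_

-- The rationals, sealed so that the type checker never unfolds their normalising arithmetic.
abstract
  Q : Set
  Q = ℚ.ℚ

  fromℤ : ℤ → Q
  fromℤ z = z ℚ./ 1

  _+_ _*_ : Q → Q → Q
  _+_ = ℚ._+_
  _*_ = ℚ._*_

  -_ : Q → Q
  -_ = ℚ.-_

  _≼_ : Q → Q → Set
  _≼_ = ℚ._≤_

ι : ℕ → Q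
ι n = fromℤ (pos n)

0q 1q : Q
0q = ι 0
1q = ι 1

_-_ : Q → Q → Q
a - b = a + (- b)

abstract
  isCommutativeRing : IsCommutativeRing _≡_ _+_ _*_ -_ 0q 1q
  isCommutativeRing = ℚₚ.+-*-isCommutativeRing

  fromℤ-neg : ∀ z → fromℤ (ℤ.- z) ≡ - fromℤ z
  fromℤ-neg = /1-homo-neg

  fromℤ-+ : ∀ a b → fromℤ (a ℤ.+ b) ≡ fromℤ a + fromℤ b
  fromℤ-+ = /1-homo-+

  fromℤ-* : ∀ a b → fromℤ (a ℤ.* b) ≡ fromℤ a * fromℤ b
  fromℤ-* = /1-homo-*

  ≼-reflexive : ∀ {a b} → a ≡ b → a ≼ b
  ≼-reflexive = ℚₚ.≤-reflexive

  ≼-trans : ∀ {a b c} → a ≼ b → b ≼ c → a ≼ c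
  ≼-trans = ℚₚ.≤-trans

  ≼-antisym : ∀ {a b} → a ≼ b → b ≼ a → a ≡ b
  ≼-antisym = ℚₚ.≤-antisym

  ≼-total : ∀ a b → a ≼ b ⊎ b ≼ a
  ≼-total = ℚₚ.≤-total

  _≟q_ : (a b : Q) → Dec (a ≡ b)
  _≟q_ = ℚₚ._≟_

  +-mono-≼ : ∀ {a b c d} → a ≼ b → c ≼ d → a + c ≼ b + d
  +-mono-≼ = ℚₚ.+-mono-≤

  0≼* : ∀ {a b} → 0q ≼ a → 0q ≼ b → 0q ≼ a * b
  0≼* {a} {b} p q = ℚₚ.nonNegative⁻¹ (a ℚ.* b)
    {{ℚₚ.nonNeg*nonNeg⇒nonNeg a {{ℚ.nonNegative p}} b {{ℚ.nonNegative q}}}}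

  0≼ι : ∀ n → 0q ≼ ι n
  0≼ι n = ℚₚ.nonNegative⁻¹ (ι n) {{ℚₚ.normalize-nonNeg n 1}}

  1≢0 : 1q ≢ 0q
  1≢0 ()

  inverse : ∀ a → a ≢ 0q → Σ Q λ b → a * b ≡ 1q
  inverse a a≢0 = ℚ.1/_ a {{ℚ.≢-nonZero a≢0}} , ℚₚ.*-inverseʳ a {{ℚ.≢-nonZero a≢0}}

  archimedean : ∀ a → Σ ℕ λ n → a ≼ ι n
  archimedean a = ℤ.∣ ℚ.↥ a ∣ , ≤-∣numerator∣ a

open IsCommutativeRing isCommutativeRing using (+-comm; *-assoc; *-comm; +-identityˡ; *-identityˡ)
  renaming (distribˡ to *-distribˡ; zeroˡ to *-zeroˡ)

_≺_ : Q → Q → Set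
a ≺ b = a ≼ b × a ≢ b

private
  Q-commutativeRing : CommutativeRing _ _
  Q-commutativeRing = record { isCommutativeRing = isCommutativeRing }

  Q-ring : AlmostCommutativeRing _ _
  Q-ring = fromCommutativeRing Q-commutativeRing

  fromℤ-homomorphism : ℤ.+-*-rawRing -Raw-AlmostCommutative⟶ Q-ring
  fromℤ-homomorphism = record
    { ⟦_⟧ = fromℤ ; +-homo = fromℤ-+ ; *-homo = fromℤ-* ; -‿homo = fromℤ-neg ; 0-homo = refl ; 1-homo = refl }

  fromℤ-≟ : ∀ a b → Maybe (fromℤ a ≡ fromℤ b)
  fromℤ-≟ a b = Maybe.map (cong fromℤ) (dec⇒maybe (a ℤ.≟ b))

-- Integer coefficients, on which the solver can compute although Q is sealed.
open import Algebra.Solver.Ring ℤ.+-*-rawRing Q-ring fromℤ-homomorphism fromℤ-≟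
  using (con; _:+_; _:*_; :-_; _:-_; _:=_; solve) renaming (Polynomial to Expr)

κ : ∀ {n} → ℕ → Expr n
κ k = con (pos k)

≼-refl : ∀ {a} → a ≼ a
≼-refl = ≼-reflexive refl

-- Most inequalities below are certificates of this shape: the ring solver rewrites b - a into an
-- expression c that is visibly nonnegative.
≼-by : ∀ {a b c} → 0q ≼ c → b - a ≡ c → a ≼ b
≼-by {a} {b} {c} 0≼c eq = subst (a ≼_) (trans (cong (a +_) (sym eq)) (solve 2 (λ a b → a :+ (b :- a) := b) refl a b))
    (subst (_≼ a + c) (solve 1 (λ a → a :+ κ 0 := a) refl a) (+-mono-≼ (≼-refl {a}) 0≼c))

≼⇒0≼- : ∀ {a b} → a ≼ b → 0q ≼ b - a
≼⇒0≼- {a} {b} a≼b = subst (_≼ b - a) (solve 1 (λ a → a :- a := κ 0) refl a) (+-mono-≼ a≼b (≼-refl { - a}))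

≡⇒-≡0 : ∀ {a b} → a ≡ b → a - b ≡ 0q
≡⇒-≡0 {a} {b} refl = solve 1 (λ a → a :- a := κ 0) refl a

-≡0⇒≡ : ∀ {a b} → a - b ≡ 0q → a ≡ b
-≡0⇒≡ {a} {b} eq = trans (solve 2 (λ a b → a := a :- b :+ b) refl a b) (trans (cong (_+ b) eq) (solve 1 (λ b → κ 0 :+ b := b) refl b))

0≼-resp : ∀ {a b} → 0q ≼ a → a ≡ b → 0q ≼ b
0≼-resp 0≼a refl = 0≼a

0≼+ : ∀ {a b} → 0q ≼ a → 0q ≼ b → 0q ≼ a + b
0≼+ {a} {b} 0≼a 0≼b = subst (_≼ a + b) (solve 0 (κ 0 :+ κ 0 := κ 0) refl) (+-mono-≼ 0≼a 0≼b)

≼0⇒0≼- : ∀ {a} → a ≼ 0q → 0q ≼ - a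
≼0⇒0≼- {a} a≼0 = 0≼-resp (≼⇒0≼- a≼0) (solve 1 (λ a → κ 0 :- a := :- a) refl a)

0≼sq : ∀ a → 0q ≼ a * a
0≼sq a with ≼-total 0q a
... | inj₁ 0≼a = 0≼* 0≼a 0≼a
... | inj₂ a≼0 = 0≼-resp (0≼* (≼0⇒0≼- a≼0) (≼0⇒0≼- a≼0)) (ring-sq a)
  where
  ring-sq = solve 1 (λ a → :- a :* :- a := a :* a) refl

≺⇒≼ : ∀ {a b} → a ≺ b → a ≼ b
≺⇒≼ = proj₁

≺⇒⋡ : ∀ {a b} → a ≺ b → ¬ (b ≼ a)
≺⇒⋡ (a≼b , a≢b) b≼a = a≢b (≼-antisym a≼b b≼a)

≼⊎≻ : ∀ a b → a ≼ b ⊎ b ≺ a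
≼⊎≻ a b with ≼-total a b
... | inj₁ a≼b = inj₁ a≼b
... | inj₂ b≼a with a ≟q b
...   | yes a≡b = inj₁ (≼-reflexive a≡b)
...   | no a≢b  = inj₂ (b≼a , λ b≡a → a≢b (sym b≡a))

⋠⇒≻ : ∀ {a b} → ¬ (a ≼ b) → b ≺ a
⋠⇒≻ {a} {b} a⋠b = [ (λ a≼b → contradiction a≼b a⋠b) , id ]′ (≼⊎≻ a b)

≺-≼-trans : ∀ {a b c} → a ≺ b → b ≼ c → a ≺ c
≺-≼-trans (a≼b , a≢b) b≼c = ≼-trans a≼b b≼c , λ { refl → a≢b (≼-antisym a≼b b≼c) }

≼-≺-trans : ∀ {a b c} → a ≼ b → b ≺ c → a ≺ c
≼-≺-trans a≼b (b≼c , b≢c) = ≼-trans a≼b b≼c , λ { refl → b≢c (≼-antisym b≼c a≼b) }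

0≺-resp : ∀ {a b} → 0q ≺ a → a ≡ b → 0q ≺ b
0≺-resp 0≺a refl = 0≺a

≺⇒0≺- : ∀ {a b} → a ≺ b → 0q ≺ b - a
≺⇒0≺- (a≼b , a≢b) = ≼⇒0≼- a≼b , λ eq → a≢b (sym (-≡0⇒≡ (sym eq)))

≺-by : ∀ {a b c} → 0q ≺ c → b - a ≡ c → a ≺ b
≺-by {a} {b} 0≺c eq = ≼-by (≺⇒≼ 0≺c) eq , λ a≡b → proj₂ 0≺c (trans (sym (≡⇒-≡0 (sym a≡b))) eq)

inverse-0 : ∀ {a b} → a ≢ 0q → a * b ≡ 0q → b ≡ 0q
inverse-0 {a} {b} a≢0 ab≡0 with inverse a a≢0
... | c , ac≡1 = begin
  b ≡⟨ *-identityˡ b ⟨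
  1q * b ≡⟨ cong (_* b) ac≡1 ⟨
  a * c * b ≡⟨ rearrange a b c ⟩
  a * b * c ≡⟨ cong (_* c) ab≡0 ⟩
  0q * c ≡⟨ *-zeroˡ c ⟩
  0q             ∎
  where
  open ≡-Reasoning
  rearrange = solve 3 (λ a b c → a :* c :* b := a :* b :* c) refl

*≡0⇒ : ∀ a b → a * b ≡ 0q → a ≡ 0q ⊎ b ≡ 0q
*≡0⇒ a b ab≡0 with a ≟q 0q
... | yes a≡0 = inj₁ a≡0
... | no a≢0  = inj₂ (inverse-0 a≢0 ab≡0)

*-cancelˡ : ∀ {a b c} → a ≢ 0q → a * b ≡ a * c → b ≡ c
*-cancelˡ {a} {b} {c} a≢0 eq = -≡0⇒≡ (inverse-0 a≢0 (trans (solve 3 (λ a b c → a :* (b :- c) := a :* b :- a :* c) refl a b c) (≡⇒-≡0 eq)))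

0≺⇒≢0 : ∀ {a} → 0q ≺ a → a ≢ 0q
0≺⇒≢0 (_ , 0≢a) a≡0 = 0≢a (sym a≡0)

0≺* : ∀ {a b} → 0q ≺ a → 0q ≺ b → 0q ≺ a * b
0≺* {a} {b} 0≺a 0≺b = 0≼* (≺⇒≼ 0≺a) (≺⇒≼ 0≺b) , λ 0≡ab → 0≺⇒≢0 0≺b (inverse-0 (0≺⇒≢0 0≺a) (sym 0≡ab))

0≺+≽0 : ∀ {a b} → 0q ≺ a → 0q ≼ b → 0q ≺ a + b
0≺+≽0 {a} {b} 0≺a 0≼b = ≺-≼-trans 0≺a (≼-by 0≼b (solve 2 (λ a b → a :+ b :- a := b) refl a b))

0≼+≻0 : ∀ {a b} → 0q ≼ a → 0q ≺ b → 0q ≺ a + b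
0≼+≻0 {a} {b} 0≼a 0≺b = ≺-≼-trans 0≺b (≼-by 0≼a (solve 2 (λ a b → a :+ b :- b := a) refl a b))

0≺1 : 0q ≺ 1q
0≺1 = 0≼ι 1 , λ 0≡1 → 1≢0 (sym 0≡1)

ι-+ : ∀ m n → ι (m ℕ.+ n) ≡ ι m + ι n
ι-+ m n = fromℤ-+ (pos m) (pos n)

ι-suc : ∀ n → ι (suc n) ≡ 1q + ι n
ι-suc n = ι-+ 1 n

0≺ι-suc : ∀ n → 0q ≺ ι (suc n)
0≺ι-suc n = 0≺-resp (0≺+≽0 0≺1 (0≼ι n)) (sym (ι-suc n))

0≺sq : ∀ {a} → a ≢ 0q → 0q ≺ a * a
0≺sq {a} a≢0 = 0≼sq a , λ eq → a≢0 (inverse-0 a≢0 (sym eq))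

0≼-cancel : ∀ {a b} → 0q ≺ a → 0q ≼ a * b → 0q ≼ b
0≼-cancel {a} {b} 0≺a 0≼ab with ≼⊎≻ 0q b
... | inj₁ 0≼b = 0≼b
... | inj₂ b≺0 = contradiction 0≼ab (≺⇒⋡ (≺-by (0≺* 0≺a (≺⇒0≺- b≺0)) (solve 2 (λ a b → κ 0 :- a :* b := a :* (κ 0 :- b)) refl a b)))

≼-cancel : ∀ {a b c} → 0q ≺ a → a * b ≼ a * c → b ≼ c
≼-cancel {a} {b} {c} 0≺a le = ≼-by (0≼-cancel 0≺a (0≼-resp (≼⇒0≼- le) (distrib a b c))) refl
  where
  distrib = solve 3 (λ a b c → a :* c :- a :* b := a :* (c :- b)) refl

inverse-pos : ∀ {a} → 0q ≺ a → Σ Q λ b → 0q ≺ b × a * b ≡ 1q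
inverse-pos {a} 0≺a with inverse a (0≺⇒≢0 0≺a)
... | b , ab≡1 = b , (0≼-cancel 0≺a (0≼-resp (≺⇒≼ 0≺1) (sym ab≡1)) , λ { refl → 1≢0 (trans (sym ab≡1) (solve 1 (λ a → a :* κ 0 := κ 0) refl a)) }) , ab≡1

*-mono-≼ : ∀ {a b c d} → 0q ≼ c → 0q ≼ b → a ≼ b → c ≼ d → a * c ≼ b * d
*-mono-≼ {a} {b} {c} {d} 0≼c 0≼b a≼b c≼d =
  ≼-by (0≼+ (0≼* (≼⇒0≼- a≼b) 0≼c) (0≼* 0≼b (≼⇒0≼- c≼d))) (solve 4 (λ b d a c → b :* d :- a :* c := (b :- a) :* c :+ b :* (d :- c)) refl b d a c)

-- Two nonnegativity statements in place of an absolute value, so that estimates of sums and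
-- products reduce to ring identities without case distinctions on signs.
record ∣_∣≼_ (a C : Q) : Set where
  constructor bounds
  field
    lower : 0q ≼ C + a
    upper : 0q ≼ C - a

-- Twice C D + a b is (C + a)(D + b) + (C - a)(D - b), and twice C D - a b is the same with b
-- negated; the factor 2 is cancelled afterwards.
∣*∣≼ : ∀ {a b C D} → ∣ a ∣≼ C → ∣ b ∣≼ D → ∣ a * b ∣≼ (C * D)
∣*∣≼ {a} {b} {C} {D} (bounds la ua) (bounds lb ub) = bounds
  (0≼-cancel (0≺ι-suc 1) (0≼-resp (0≼+ (0≼* la lb) (0≼* ua ub)) (solve 4 (λ C a D b → (C :+ a) :* (D :+ b) :+ (C :- a) :* (D :- b) := κ 2 :* (C :* D :+ a :* b)) refl C a D b)))
  (0≼-cancel (0≺ι-suc 1) (0≼-resp (0≼+ (0≼* ua lb) (0≼* la ub)) (solve 4 (λ C a D b → (C :- a) :* (D :+ b) :+ (C :+ a) :* (D :- b) := κ 2 :* (C :* D :- a :* b)) refl C a D b)))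

∣+∣≼ : ∀ {a b C D} → ∣ a ∣≼ C → ∣ b ∣≼ D → ∣ a + b ∣≼ (C + D)
∣+∣≼ {a} {b} {C} {D} (bounds la ua) (bounds lb ub) = bounds (0≼-resp (0≼+ la lb) (solve 4 (λ C a D b → C :+ a :+ (D :+ b) := C :+ D :+ (a :+ b)) refl C a D b)) (0≼-resp (0≼+ ua ub) (solve 4 (λ C a D b → C :- a :+ (D :- b) := C :+ D :- (a :+ b)) refl C a D b))

∣∣≼-mono : ∀ {a C D} → C ≼ D → ∣ a ∣≼ C → ∣ a ∣≼ D
∣∣≼-mono {a} {C} {D} C≼D (bounds l u) =
  bounds (0≼-resp (0≼+ (≼⇒0≼- C≼D) l) (solve 3 (λ D C a → D :- C :+ (C :+ a) := D :+ a) refl D C a)) (0≼-resp (0≼+ (≼⇒0≼- C≼D) u) (solve 3 (λ D C a → D :- C :+ (C :- a) := D :- a) refl D C a))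

-- Sums and determinants

∑ : ∀ {n} → (Fin n → Q) → Q
∑ {zero}  f = 0q
∑ {suc n} f = f zero + ∑ (f ∘ suc)

∑-cong : ∀ {n} {f g : Fin n → Q} → (∀ i → f i ≡ g i) → ∑ f ≡ ∑ g
∑-cong {zero}  eq = refl
∑-cong {suc n} eq = cong₂ _+_ (eq zero) (∑-cong (eq ∘ suc))

∑-0 : ∀ {n} {f : Fin n → Q} → (∀ i → f i ≡ 0q) → ∑ f ≡ 0q
∑-0 {zero}  eq = refl
∑-0 {suc n} eq = trans (cong₂ _+_ (eq zero) (∑-0 (eq ∘ suc))) (+-identityˡ 0q)

interchange : ∀ a b c d → (a + b) + (c + d) ≡ (a + c) + (b + d)
interchange a b c d = solve 4 (λ a b c d → a :+ b :+ (c :+ d) := a :+ c :+ (b :+ d)) refl a b c d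

∑-+ : ∀ {n} (f g : Fin n → Q) → ∑ (λ i → f i + g i) ≡ ∑ f + ∑ g
∑-+ {zero}  f g = sym (+-identityˡ 0q)
∑-+ {suc n} f g = trans (cong (f zero + g zero +_) (∑-+ (f ∘ suc) (g ∘ suc))) (interchange _ _ _ _)

∑-*ˡ : ∀ {n} c (f : Fin n → Q) → ∑ (λ i → c * f i) ≡ c * ∑ f
∑-*ˡ {zero}  c f = trans (sym (*-zeroˡ c)) (*-comm 0q c)
∑-*ˡ {suc n} c f = trans (cong (c * f zero +_) (∑-*ˡ c (f ∘ suc))) (sym (*-distribˡ _ _ _))

∑-lin : ∀ {n} a b (f g : Fin n → Q) → ∑ (λ i → a * f i + b * g i) ≡ a * ∑ f + b * ∑ g
∑-lin a b f g = trans (∑-+ (λ i → a * f i) (λ i → b * g i)) (cong₂ _+_ (∑-*ˡ a f) (∑-*ˡ b g))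

∑-swap : ∀ {m n} (f : Fin m → Fin n → Q) → ∑ (λ i → ∑ (λ j → f i j)) ≡ ∑ (λ j → ∑ (λ i → f i j))
∑-swap {zero} {n} f = sym (∑-0 {n} (λ _ → refl))
∑-swap {suc m} f = trans (cong (∑ (f zero) +_) (∑-swap (f ∘ suc))) (sym (∑-+ (f zero) (λ j → ∑ (λ i → f (suc i) j))))

∑-≽0 : ∀ {n} {f : Fin n → Q} → (∀ i → 0q ≼ f i) → 0q ≼ ∑ f
∑-≽0 {zero}  nn = ≼-refl
∑-≽0 {suc n} nn = 0≼+ (nn zero) (∑-≽0 (nn ∘ suc))

δ : ∀ {n} → Fin n → Fin n → Q
δ zero    zero    = 1q
δ zero    (suc _) = 0q
δ (suc _) zero    = 0q
δ (suc i) (suc j) = δ i j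

δ-refl : ∀ {n} (i : Fin n) → δ i i ≡ 1q
δ-refl zero    = refl
δ-refl (suc i) = δ-refl i

δ-≢ : ∀ {n} {i j : Fin n} → i ≢ j → δ i j ≡ 0q
δ-≢ {i = zero}  {zero}  i≢j = contradiction refl i≢j
δ-≢ {i = zero}  {suc j} i≢j = refl
δ-≢ {i = suc i} {zero}  i≢j = refl
δ-≢ {i = suc i} {suc j} i≢j = δ-≢ (i≢j ∘ cong suc)

δ-sym : ∀ {n} (i j : Fin n) → δ i j ≡ δ j i
δ-sym zero    zero    = refl
δ-sym zero    (suc j) = refl
δ-sym (suc i) zero    = refl
δ-sym (suc i) (suc j) = δ-sym i j

∑-δ : ∀ {n} (i : Fin n) (f : Fin n → Q) → ∑ (λ j → δ i j * f j) ≡ f i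
∑-δ zero    f = trans {j = 1q * f zero + 0q} (cong (1q * f zero +_) (∑-0 {f = λ j → 0q * f (suc j)} (λ j → *-zeroˡ _))) (solve 1 (λ s → κ 1 :* s :+ κ 0 := s) refl (f zero))
∑-δ (suc i) f = trans {j = 0q * f zero + f (suc i)} (cong (0q * f zero +_) (∑-δ i (f ∘ suc))) (solve 2 (λ s t → κ 0 :* s :+ t := t) refl (f zero) (f (suc i)))

sgn : ∀ {n} → Fin n → Q
sgn zero    = 1q
sgn (suc j) = - sgn j

Matrix : ℕ → Set
Matrix n = Fin n → Fin n → Q

minor : ∀ {n} → Matrix (suc n) → Fin (suc n) → Matrix n
minor M j a b = M (suc a) (punchIn j b)

det : ∀ {n} → Matrix n → Q
det {zero}  M = 1q
det {suc n} M = ∑ (λ j → sgn j * (M zero j * det (minor M j)))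

-- Alternating functions of the rows

record Alternating {n} (φ : Matrix n → Q) : Set where
  field
    ext    : ∀ {M N} → (∀ i j → M i j ≡ N i j) → φ M ≡ φ N
    -- Stated for any three matrices that agree off row l, so that matrices which are not literally
    -- row updates, such as minors and bordered matrices, qualify.
    linear : ∀ l a b {M N P} → (∀ i → i ≢ l → ∀ j → M i j ≡ P i j) → (∀ i → i ≢ l → ∀ j → N i j ≡ P i j) →
             (∀ j → P l j ≡ a * M l j + b * N l j) → φ P ≡ a * φ M + b * φ N
    alt    : ∀ {M i k} → i ≢ k → (∀ j → M i j ≡ M k j) → φ M ≡ 0q

infixl 20 _[_≔_]
_[_≔_] : ∀ {n} → Matrix n → Fin n → (Fin n → Q) → Matrix n
(M [ l ≔ r ]) i with i ≟ l
... | yes _ = r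
... | no _  = M i

[≔]-same : ∀ {n} (M : Matrix n) l r j → (M [ l ≔ r ]) l j ≡ r j
[≔]-same M l r j with l ≟ l
... | yes _  = refl
... | no l≢l = contradiction refl l≢l

[≔]-other : ∀ {n} (M : Matrix n) {l i} r j → i ≢ l → (M [ l ≔ r ]) i j ≡ M i j
[≔]-other M {l} {i} r j i≢l with i ≟ l
... | yes i≡l = contradiction i≡l i≢l
... | no _    = refl

module AlternatingProperties {n} {φ : Matrix n → Q} (A : Alternating φ) where
  open Alternating A
  open ≡-Reasoning

  linear-≔ : ∀ M l a b r s → φ (M [ l ≔ (λ j → a * r j + b * s j) ]) ≡ a * φ (M [ l ≔ r ]) + b * φ (M [ l ≔ s ])
  linear-≔ M l a b r s = linear l a b
    (λ i i≢l j → trans ([≔]-other M r j i≢l) (sym ([≔]-other M _ j i≢l)))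
    (λ i i≢l j → trans ([≔]-other M s j i≢l) (sym ([≔]-other M _ j i≢l)))
    (λ j → trans ([≔]-same M l _ j) (cong₂ (λ x y → a * x + b * y) (sym ([≔]-same M l r j)) (sym ([≔]-same M l s j))))

  ext-≔ : ∀ M l {r s} → (∀ j → r j ≡ s j) → φ (M [ l ≔ r ]) ≡ φ (M [ l ≔ s ])
  ext-≔ M l {r} {s} eq = ext λ i j → pointwise i j
    where
    pointwise : ∀ i j → (M [ l ≔ r ]) i j ≡ (M [ l ≔ s ]) i j
    pointwise i j with i ≟ l
    ... | yes _ = eq j
    ... | no _  = refl

  alt-≔ : ∀ M {l k} → l ≢ k → φ (M [ l ≔ M k ]) ≡ 0q
  alt-≔ M {l} {k} l≢k = alt l≢k λ j → trans ([≔]-same M l _ j) (sym ([≔]-other M _ j (l≢k ∘ sym)))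

  ≔-self : ∀ M l → φ (M [ l ≔ M l ]) ≡ φ M
  ≔-self M l = ext λ i j → pointwise i j
    where
    pointwise : ∀ i j → (M [ l ≔ M l ]) i j ≡ M i j
    pointwise i j with i ≟ l
    ... | yes refl = refl
    ... | no _     = refl

  -- Polarisation: with both rows replaced by their sum the value is 0; expanding it bilinearly and
  -- dropping the two terms with a repeated row leaves the two orders adding up to 0.
  swap-neg : ∀ {M N i k} → i ≢ k → (∀ j → N i j ≡ M k j) → (∀ j → N k j ≡ M i j) →
             (∀ l → l ≢ i → l ≢ k → ∀ j → N l j ≡ M l j) → φ N ≡ - φ M
  swap-neg {M} {N} {i} {k} i≢k Ni Nk Nl = begin
    φ N ≡⟨ ext N≡ ⟩
    F (M k) (M i) ≡⟨ isolate _ _ _ _ expand ⟩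
    - F (M i) (M k) ≡⟨ cong -_ (ext M≡) ⟨
    - φ M                                            ∎
    where
    F : (Fin n → Q) → (Fin n → Q) → Q
    F r s = φ (M [ i ≔ r ] [ k ≔ s ])

    u : Fin n → Q
    u j = 1q * M i j + 1q * M k j

    equal-rows : ∀ r → F r r ≡ 0q
    equal-rows r = alt i≢k λ j → trans ([≔]-other (M [ i ≔ r ]) r j i≢k)
      (trans ([≔]-same M i r j) (sym ([≔]-same (M [ i ≔ r ]) k r j)))

    linearʳ : ∀ r s t → F r (λ j → 1q * s j + 1q * t j) ≡ 1q * F r s + 1q * F r t
    linearʳ r s t = linear-≔ (M [ i ≔ r ]) k 1q 1q s t

    rows : ∀ r s l j → l ≢ i → (M [ i ≔ r ] [ k ≔ s ]) l j ≡ (M [ k ≔ s ]) l j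
    rows r s l j l≢i with l ≟ k
    ... | yes _ = refl
    ... | no _  = [≔]-other M r j l≢i

    row-i : ∀ r s j → (M [ i ≔ r ] [ k ≔ s ]) i j ≡ r j
    row-i r s j = trans ([≔]-other (M [ i ≔ r ]) s j i≢k) ([≔]-same M i r j)

    linearˡ : ∀ r s t → F (λ j → 1q * r j + 1q * s j) t ≡ 1q * F r t + 1q * F s t
    linearˡ r s t = linear i 1q 1q
      (λ l l≢i j → trans (rows r t l j l≢i) (sym (rows _ t l j l≢i)))
      (λ l l≢i j → trans (rows s t l j l≢i) (sym (rows _ t l j l≢i)))
      (λ j → trans (row-i _ t j) (cong₂ (λ x y → 1q * x + 1q * y) (sym (row-i r t j)) (sym (row-i s t j))))

    expand : 1q * (1q * F (M i) (M i) + 1q * F (M i) (M k)) + 1q * (1q * F (M k) (M i) + 1q * F (M k) (M k)) ≡ 0q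
                × F (M i) (M i) ≡ 0q × F (M k) (M k) ≡ 0q
    expand = trans (sym (trans (linearˡ (M i) (M k) u)
               (cong₂ (λ x y → 1q * x + 1q * y) (linearʳ (M i) (M i) (M k)) (linearʳ (M k) (M i) (M k))))) (equal-rows u)
           , equal-rows (M i) , equal-rows (M k)

    isolate : ∀ a b c d → 1q * (1q * a + 1q * b) + 1q * (1q * c + 1q * d) ≡ 0q × a ≡ 0q × d ≡ 0q → c ≡ - b
    isolate a b c d (eq , refl , refl) = -≡0⇒≡ (trans (solve 2 (λ c b → c :- :- b := κ 1 :* (κ 1 :* κ 0 :+ κ 1 :* b) :+ κ 1 :* (κ 1 :* c :+ κ 1 :* κ 0)) refl c b) eq)

    N≡ : ∀ l j → N l j ≡ (M [ i ≔ M k ] [ k ≔ M i ]) l j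
    N≡ l j with l ≟ k
    ... | yes refl = Nk j
    ... | no l≢k with l ≟ i
    ...   | yes refl = Ni j
    ...   | no l≢i   = Nl l l≢i l≢k j

    M≡ : ∀ l j → M l j ≡ (M [ i ≔ M i ] [ k ≔ M k ]) l j
    M≡ l j with l ≟ k
    ... | yes refl = refl
    ... | no l≢k with l ≟ i
    ...   | yes refl = refl
    ...   | no l≢i   = refl

open ≡-Reasoning

det-cong : ∀ {n} {M N : Matrix n} → (∀ i j → M i j ≡ N i j) → det M ≡ det N
det-cong {zero}  eq = refl
det-cong {suc n} eq = ∑-cong λ j → cong (sgn j *_) (cong₂ _*_ (eq zero j) (det-cong λ a b → eq (suc a) (punchIn j b)))

det-linear : ∀ {n} (l : Fin n) a b {M N P} → (∀ i → i ≢ l → ∀ j → M i j ≡ P i j) → (∀ i → i ≢ l → ∀ j → N i j ≡ P i j) →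
             (∀ j → P l j ≡ a * M l j + b * N l j) → det P ≡ a * det M + b * det N
det-linear {suc n} zero a b {M} {N} {P} M≡ N≡ P≡ = trans (∑-cong step) (∑-lin a b (λ j → sgn j * (M zero j * det (minor M j))) (λ j → sgn j * (N zero j * det (minor N j))))
  where
  step : ∀ j → sgn j * (P zero j * det (minor P j)) ≡
               a * (sgn j * (M zero j * det (minor M j))) + b * (sgn j * (N zero j * det (minor N j)))
  step j rewrite P≡ j | det-cong {M = minor M j} {minor P j} (λ i k → M≡ (suc i) (λ ()) (punchIn j k))
      | det-cong {M = minor N j} {minor P j} (λ i k → N≡ (suc i) (λ ()) (punchIn j k)) = solve 6 (λ s a t b u v → s :* ((a :* t :+ b :* u) :* v) := a :* (s :* (t :* v)) :+ b :* (s :* (u :* v))) refl (sgn j) a (M zero j) b (N zero j) (det (minor P j))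
det-linear {suc n} (suc l) a b {M} {N} {P} M≡ N≡ P≡ = trans (∑-cong step) (∑-lin a b (λ j → sgn j * (M zero j * det (minor M j))) (λ j → sgn j * (N zero j * det (minor N j))))
  where
  step : ∀ j → sgn j * (P zero j * det (minor P j)) ≡
               a * (sgn j * (M zero j * det (minor M j))) + b * (sgn j * (N zero j * det (minor N j)))
  step j rewrite M≡ zero (λ ()) j | N≡ zero (λ ()) j
               | det-linear l a b {minor M j} {minor N j} {minor P j}
                   (λ i i≢l k → M≡ (suc i) (i≢l ∘ suc-injective) (punchIn j k))
                   (λ i i≢l k → N≡ (suc i) (i≢l ∘ suc-injective) (punchIn j k)) (λ k → P≡ (punchIn j k)) = solve 6 (λ s t a u b v → s :* (t :* (a :* u :+ b :* v)) := a :* (s :* (t :* u)) :+ b :* (s :* (t :* v))) refl (sgn j) (P zero j) a (det (minor M j)) b (det (minor N j))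

-- The terms of the two-row Laplace expansion cancel in pairs (j , k) ↔ (suc k , 0); what is left
-- after removing the pairs that involve column 0 is an expansion of the same shape.
two-equal-rows : ∀ n (a : Fin (2 ℕ.+ n) → Q) (H : (Fin n → Fin (2 ℕ.+ n)) → Q) →
  (∀ {c d} → (∀ b → c b ≡ d b) → H c ≡ H d) →
  ∑ (λ j → ∑ (λ k → sgn j * sgn k * (a j * a (punchIn j k) * H (λ b → punchIn j (punchIn k b))))) ≡ 0q
two-equal-rows n a H H-ext = begin
  ∑ (λ k → F zero k) + ∑ (λ j → F (suc j) zero + ∑ (λ k → F (suc j) (suc k))) ≡⟨ cong (∑ (F zero) +_) (∑-+ {suc n} (λ j → F (suc j) zero) (λ j → ∑ {n} (λ k → F (suc j) (suc k)))) ⟩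
  ∑ (F zero) + (∑ (λ j → F (suc j) zero) + ∑ (λ j → ∑ (λ k → F (suc j) (suc k)))) ≡⟨ cong₂ (λ x y → ∑ (F zero) + (x + y)) (trans (∑-cong cancel) (∑-*ˡ (- 1q) (F zero))) (rest n a H H-ext) ⟩
  ∑ (F zero) + (- 1q * ∑ (F zero) + 0q) ≡⟨ (solve 1 (λ s → s :+ (:- κ 1 :* s :+ κ 0) := κ 0) refl (∑ (F zero))) ⟩
  0q                                                                                    ∎
  where
  F : Fin (2 ℕ.+ n) → Fin (1 ℕ.+ n) → Q
  F j k = sgn j * sgn k * (a j * a (punchIn j k) * H (λ b → punchIn j (punchIn k b)))

  cancel : ∀ k → F (suc k) zero ≡ - 1q * F zero k
  cancel k = antisymmetric (sgn k) (a zero) (a (suc k)) (H (λ b → suc (punchIn k b)))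
    where
    antisymmetric = solve 4 (λ s x y h → :- s :* κ 1 :* (y :* x :* h) := :- κ 1 :* (κ 1 :* s :* (x :* y :* h))) refl

  rest : ∀ n (a : Fin (2 ℕ.+ n) → Q) (H : (Fin n → Fin (2 ℕ.+ n)) → Q) → (∀ {c d} → (∀ b → c b ≡ d b) → H c ≡ H d) →
    ∑ (λ (j : Fin (suc n)) → ∑ (λ (k : Fin n) →
      sgn (suc j) * sgn (suc k) * (a (suc j) * a (suc (punchIn j k)) * H (λ b → punchIn (suc j) (punchIn (suc k) b))))) ≡ 0q
  rest zero    a H H-ext = ∑-0 {1} λ _ → refl
  rest (suc n) a H H-ext = trans (∑-cong λ j → ∑-cong λ k → step j k)
    (two-equal-rows n (a ∘ suc) (H ∘ lift) λ {c} {d} c≡d → H-ext (lift-ext c≡d))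
    where
    lift : (Fin n → Fin (2 ℕ.+ n)) → Fin (suc n) → Fin (3 ℕ.+ n)
    lift c zero    = zero
    lift c (suc b) = suc (c b)

    lift-ext : ∀ {c d} → (∀ b → c b ≡ d b) → ∀ b → lift c b ≡ lift d b
    lift-ext c≡d zero    = refl
    lift-ext c≡d (suc b) = cong suc (c≡d b)

    columns : ∀ j k b → punchIn (suc j) (punchIn (suc k) b) ≡ lift (λ b → punchIn j (punchIn k b)) b
    columns j k zero    = refl
    columns j k (suc b) = refl

    step : ∀ j k →
      sgn (suc j) * sgn (suc k) * (a (suc j) * a (suc (punchIn j k)) * H (λ b → punchIn (suc j) (punchIn (suc k) b))) ≡
      sgn j * sgn k * (a (suc j) * a (suc (punchIn j k)) * H (lift (λ b → punchIn j (punchIn k b))))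
    step j k = trans (cong (λ h → - sgn j * - sgn k * (a (suc j) * a (suc (punchIn j k)) * h)) (H-ext (columns j k))) (solve 5 (λ s t u v w → :- s :* :- t :* (u :* v :* w) := s :* t :* (u :* v :* w)) refl (sgn j) (sgn k) (a (suc j)) (a (suc (punchIn j k))) (H (lift (λ b → punchIn j (punchIn k b)))))

det-alternating : ∀ n → Alternating (det {n})
det-alternating n = record { ext = det-cong ; linear = det-linear ; alt = det-alt n }
  where
  adjacent : ∀ n {M : Matrix (2 ℕ.+ n)} → (∀ j → M zero j ≡ M (suc zero) j) → det M ≡ 0q
  adjacent n {M} eq = trans (∑-cong expand) (two-equal-rows n (M zero) (λ c → det (λ x b → M (suc (suc x)) (c b)))
      (λ c≡d → det-cong (λ x b → cong (M (suc (suc x))) (c≡d b))))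
    where
    D : Fin (2 ℕ.+ n) → Fin (1 ℕ.+ n) → Q
    D j k = det (minor (minor M j) k)

    regroup = solve 5 (λ s t a b d → s :* a :* (t :* (b :* d)) := s :* t :* (a :* b :* d)) refl

    expand : ∀ j → sgn j * (M zero j * det (minor M j)) ≡ ∑ (λ k → sgn j * sgn k * (M zero j * M zero (punchIn j k) * D j k))
    expand j = begin
      sgn j * (M zero j * det (minor M j)) ≡⟨ *-assoc _ _ _ ⟨
      sgn j * M zero j * det (minor M j) ≡⟨ ∑-*ˡ (sgn j * M zero j) (λ k → sgn k * (M (suc zero) (punchIn j k) * D j k)) ⟨
      ∑ (λ k → sgn j * M zero j * (sgn k * (M (suc zero) (punchIn j k) * D j k))) ≡⟨ ∑-cong step ⟩
      ∑ (λ k → sgn j * sgn k * (M zero j * M zero (punchIn j k) * D j k))              ∎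
      where
      step : ∀ k → sgn j * M zero j * (sgn k * (M (suc zero) (punchIn j k) * D j k)) ≡ sgn j * sgn k * (M zero j * M zero (punchIn j k) * D j k)
      step k = trans (cong (λ m → sgn j * M zero j * (sgn k * (m * D j k))) (sym (eq (punchIn j k)))) (regroup _ _ _ _ _)

  -- Equal rows are brought next to each other by exchanging row 1 with row `suc (suc k)`. Both lie
  -- below row 0, so the exchange happens inside every minor of the expansion and negates it by the
  -- smaller case.
  first : ∀ n → Alternating (det {n}) → {M : Matrix (suc n)} → ∀ k → (∀ j → M zero j ≡ M (suc k) j) → det M ≡ 0q
  first (suc n) _ {M} zero eq = adjacent n {M} eq
  first (suc n) A {M} (suc k) eq = begin
    det M ≡⟨ ∑-cong (λ j → trans (cong (λ d → sgn j * (M zero j * d)) (minor-swap j)) (negate (sgn j) (M zero j) (det (minor M′ j)))) ⟩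
    ∑ (λ j → - 1q * (sgn j * (M′ zero j * det (minor M′ j)))) ≡⟨ ∑-*ˡ (- 1q) (λ j → sgn j * (M′ zero j * det (minor M′ j))) ⟩
    - 1q * det M′ ≡⟨ cong (- 1q *_) (adjacent n {M′} eq) ⟩
    - 1q * 0q ≡⟨ (solve 0 (:- κ 1 :* κ 0 := κ 0) refl) ⟩
    0q              ∎
    where
    negate = solve 3 (λ s a d → s :* (a :* :- d) := :- κ 1 :* (s :* (a :* d))) refl

    M′ : Matrix (2 ℕ.+ n)
    M′ zero    = M zero
    M′ (suc i) with i ≟ zero | i ≟ suc k
    ... | yes _ | _     = M (suc (suc k))
    ... | no _  | yes _ = M (suc zero)
    ... | no _  | no _  = M (suc i)

    k-row : ∀ j → M′ (suc (suc k)) j ≡ M (suc zero) j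
    k-row j with k ≟ k
    ... | yes _  = refl
    ... | no k≢k = contradiction refl k≢k

    other-rows : ∀ l → l ≢ zero → l ≢ suc k → ∀ j → M′ (suc l) j ≡ M (suc l) j
    other-rows l l≢0 l≢k j with l ≟ zero | l ≟ suc k
    ... | yes l≡0 | _       = contradiction l≡0 l≢0
    ... | no _    | yes l≡k = contradiction l≡k l≢k
    ... | no _    | no _    = refl

    minor-swap : ∀ j → det (minor M j) ≡ - det (minor M′ j)
    minor-swap j = AlternatingProperties.swap-neg A {i = zero} {suc k} (λ ())
      (λ b → sym (k-row (punchIn j b))) (λ b → refl) (λ l l≢0 l≢k b → sym (other-rows l l≢0 l≢k (punchIn j b)))

  det-alt : ∀ n {M : Matrix n} {i k} → i ≢ k → (∀ j → M i j ≡ M k j) → det M ≡ 0q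
  det-alt (suc n) {M} {zero}  {zero}  i≢k eq = contradiction refl i≢k
  det-alt (suc n) {M} {zero}  {suc k} i≢k eq = first n (record { ext = det-cong ; linear = det-linear ; alt = det-alt n }) {M} k eq
  det-alt (suc n) {M} {suc i} {zero}  i≢k eq = first n (record { ext = det-cong ; linear = det-linear ; alt = det-alt n }) {M} i (sym ∘ eq)
  det-alt (suc n) {M} {suc i} {suc k} i≢k eq = ∑-0 λ j →
    trans {j = sgn j * (M zero j * 0q)} (cong (λ d → sgn j * (M zero j * d)) (det-alt n {minor M j} (i≢k ∘ cong suc) (λ b → eq (punchIn j b)))) (solve 2 (λ s t → s :* (t :* κ 0) := κ 0) refl (sgn j) (M zero j))

-- Rows are functions compared pointwise, hence the explicit assumption that `L` respects pointwise
-- equality.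
linear-expansion : ∀ {n} (L : (Fin n → Q) → Q) → (∀ {r s} → (∀ j → r j ≡ s j) → L r ≡ L s) →
  (∀ a b r s → L (λ j → a * r j + b * s j) ≡ a * L r + b * L s) → ∀ r → L r ≡ ∑ (λ j → r j * L (δ j))
linear-expansion {zero} L ext lin r =
  -- In dimension 0 all rows agree, so linearity with both coefficients 0 gives `L r ≡ 0q`.
  trans (ext {s = λ j → 0q * r j + 0q * r j} (λ ())) (trans (lin 0q 0q r r) (zeros (L r)))
  where
  zeros = solve 1 (λ a → κ 0 :* a :+ κ 0 :* a := κ 0) refl
linear-expansion {suc n} L ext lin r = begin
  L r ≡⟨ ext split ⟩
  L (λ j → r zero * δ zero j + 1q * (0∷ (r ∘ suc)) j) ≡⟨ lin (r zero) 1q (δ zero) (0∷ (r ∘ suc)) ⟩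
  r zero * L (δ zero) + 1q * L (0∷ (r ∘ suc)) ≡⟨ cong (r zero * L (δ zero) +_) (*-identityˡ _) ⟩
  r zero * L (δ zero) + L (0∷ (r ∘ suc)) ≡⟨ cong (r zero * L (δ zero) +_) (linear-expansion (L ∘ 0∷_) (λ eq → ext (0∷-cong eq)) lin′ (r ∘ suc)) ⟩
  r zero * L (δ zero) + ∑ (λ j → r (suc j) * L (0∷ δ j)) ≡⟨ cong (r zero * L (δ zero) +_) (∑-cong (λ j → cong (r (suc j) *_) (ext (0∷δ j)))) ⟩
  r zero * L (δ zero) + ∑ (λ j → r (suc j) * L (δ (suc j)))      ∎
  where
  0∷_ : (Fin n → Q) → Fin (suc n) → Q
  (0∷ s) zero    = 0q
  (0∷ s) (suc j) = s j

  0∷-cong : ∀ {s t} → (∀ j → s j ≡ t j) → ∀ j → (0∷ s) j ≡ (0∷ t) j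
  0∷-cong eq zero    = refl
  0∷-cong eq (suc j) = eq j

  0∷δ : ∀ i j → (0∷ δ i) j ≡ δ (suc i) j
  0∷δ i zero    = refl
  0∷δ i (suc j) = refl

  split : ∀ j → r j ≡ r zero * δ zero j + 1q * (0∷ (r ∘ suc)) j
  split zero    = head (r zero)
    where
    head = solve 1 (λ a → a := a :* κ 1 :+ κ 1 :* κ 0) refl
  split (suc j) = tail (r zero) (r (suc j))
    where
    tail = solve 2 (λ a b → b := a :* κ 0 :+ κ 1 :* b) refl

  lin′ : ∀ a b s t → L (0∷ (λ j → a * s j + b * t j)) ≡ a * L (0∷ s) + b * L (0∷ t)
  lin′ a b s t = trans (ext pointwise) (lin a b (0∷ s) (0∷ t))
    where
    zeros = solve 2 (λ a b → κ 0 := a :* κ 0 :+ b :* κ 0) refl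
    pointwise : ∀ j → (0∷ (λ j → a * s j + b * t j)) j ≡ a * (0∷ s) j + b * (0∷ t) j
    pointwise zero    = zeros a b
    pointwise (suc j) = refl

-- The rows are restored one at a time. Keeping `ψ` abstract lets the row just restored be absorbed
-- into it, so the induction runs over the remaining rows only.
add-to-rows : ∀ {m n} (r : Fin n → Q) (ψ : (Fin m → Fin n → Q) → Q) → (∀ {R S} → (∀ i j → R i j ≡ S i j) → ψ R ≡ ψ S) →
  (∀ i c {R S} → (∀ l → l ≢ i → ∀ j → S l j ≡ R l j) → (∀ j → S i j ≡ R i j + c * r j) → ψ S ≡ ψ R) →
  ∀ R (t : Fin m → Q) → ψ (λ i j → R i j + t i * r j) ≡ ψ R
add-to-rows {zero}  r ψ ext inv R t = ext λ ()
add-to-rows {suc m} {n} r ψ ext inv R t = begin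
  ψ (λ i j → R i j + t i * r j) ≡⟨ inv zero (t zero) (λ { zero l≢0 j → contradiction refl l≢0 ; (suc l) _ j → refl }) (λ j → refl) ⟩
  ψ (R zero ∷′ (λ i j → R (suc i) j + t (suc i) * r j)) ≡⟨ add-to-rows r (λ S → ψ (R zero ∷′ S)) (λ eq → ext (∷′-cong eq)) inv′ (R ∘ suc) (t ∘ suc) ⟩
  ψ (R zero ∷′ (R ∘ suc)) ≡⟨ ext (λ { zero j → refl ; (suc i) j → refl }) ⟩
  ψ R                                                    ∎
  where
  _∷′_ : (Fin n → Q) → (Fin m → Fin n → Q) → Fin (suc m) → Fin n → Q
  (s ∷′ S) zero    = s
  (s ∷′ S) (suc i) = S i

  ∷′-cong : ∀ {s R S} → (∀ i j → R i j ≡ S i j) → ∀ i j → (s ∷′ R) i j ≡ (s ∷′ S) i j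
  ∷′-cong eq zero    j = refl
  ∷′-cong eq (suc i) j = eq i j

  inv′ : ∀ i c {T S} → (∀ l → l ≢ i → ∀ j → S l j ≡ T l j) → (∀ j → S i j ≡ T i j + c * r j) → ψ (R zero ∷′ S) ≡ ψ (R zero ∷′ T)
  inv′ i c other at-i = inv (suc i) c (λ { zero _ j → refl ; (suc l) l≢i j → other l (l≢i ∘ cong suc) j }) at-i

module _ {n} {φ : Matrix n → Q} (A : Alternating φ) where
  open Alternating A
  open AlternatingProperties A

  add-multiple : ∀ {i k} c {M N} → i ≢ k → (∀ l → l ≢ i → ∀ j → N l j ≡ M l j) → (∀ j → N i j ≡ M i j + c * M k j) → φ N ≡ φ M
  add-multiple {i} {k} c {M} {N} i≢k other at-i = begin
    φ N ≡⟨ linear i 1q c {M} {M [ i ≔ M k ]} (λ l l≢i j → sym (other l l≢i j))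
        (λ l l≢i j → trans ([≔]-other M (M k) j l≢i) (sym (other l l≢i j)))
        (λ j → trans (at-i j) (cong₂ (λ x y → x + c * y) (sym (*-identityˡ _)) (sym ([≔]-same M i (M k) j)))) ⟩
    1q * φ M + c * φ (M [ i ≔ M k ]) ≡⟨ cong (λ z → 1q * φ M + c * z) (alt-≔ M i≢k) ⟩
    1q * φ M + c * 0q ≡⟨ (solve 2 (λ s c → κ 1 :* s :+ c :* κ 0 := s) refl (φ M) c) ⟩
    φ M                                  ∎

  row-expansion : ∀ M l r → φ (M [ l ≔ r ]) ≡ ∑ (λ j → r j * φ (M [ l ≔ δ j ]))
  row-expansion M l = linear-expansion (λ r → φ (M [ l ≔ r ])) (ext-≔ M l) (linear-≔ M l)

module _ {n} {φ : Matrix (suc n) → Q} (A : Alternating φ) where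
  open Alternating A

  add-first-row : ∀ {M N} (t : Fin n → Q) → (∀ j → N zero j ≡ M zero j) → (∀ i j → N (suc i) j ≡ M (suc i) j + t i * M zero j) → φ N ≡ φ M
  add-first-row {M} {N} t at-0 at-suc = begin
    φ N ≡⟨ ext (λ { zero j → at-0 j ; (suc i) j → at-suc i j }) ⟩
    φ (M₀ (λ i j → M (suc i) j + t i * M zero j)) ≡⟨ add-to-rows (M zero) (φ ∘ M₀) (λ eq → ext (λ { zero j → refl ; (suc i) j → eq i j }))
        (λ i c other at-i → add-multiple A {suc i} {zero} c (λ ())
        (λ { zero _ j → refl ; (suc l) l≢i j → other l (l≢i ∘ cong suc) j }) at-i)
        (M ∘ suc) t ⟩
    φ (M₀ (M ∘ suc)) ≡⟨ ext (λ { zero j → refl ; (suc i) j → refl }) ⟩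
    φ M                                               ∎
    where
    M₀ : (Fin n → Fin (suc n) → Q) → Matrix (suc n)
    M₀ R zero    = M zero
    M₀ R (suc i) = R i

-- insert j r is the row r with an extra 0 in column j, bordered j N the matrix N
-- with an extra column 0 at j and an extra first row δ j.
insert : ∀ {n} → Fin (suc n) → (Fin n → Q) → Fin (suc n) → Q
insert zero            r zero    = 0q
insert zero            r (suc c) = r c
insert {suc n} (suc j) r zero    = r zero
insert {suc n} (suc j) r (suc c) = insert j (r ∘ suc) c

insert-cong : ∀ {n} (j : Fin (suc n)) {r s} → (∀ c → r c ≡ s c) → ∀ c → insert j r c ≡ insert j s c
insert-cong zero            eq zero    = refl
insert-cong zero            eq (suc c) = eq c
insert-cong {suc n} (suc j) eq zero    = eq zero
insert-cong {suc n} (suc j) eq (suc c) = insert-cong j (eq ∘ suc) c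

insert-linear : ∀ {n} (j : Fin (suc n)) a b {r s t} → (∀ c → t c ≡ a * r c + b * s c) →
                ∀ c → insert j t c ≡ a * insert j r c + b * insert j s c
insert-linear zero            a b eq zero    = zeros a b
  where
  zeros = solve 2 (λ a b → κ 0 := a :* κ 0 :+ b :* κ 0) refl
insert-linear zero            a b eq (suc c) = eq c
insert-linear {suc n} (suc j) a b eq zero    = eq zero
insert-linear {suc n} (suc j) a b eq (suc c) = insert-linear j a b (eq ∘ suc) c

insert-punchIn : ∀ {n} (j : Fin (suc n)) (r : Fin (suc n) → Q) c → insert j (r ∘ punchIn j) c ≡ r c + (- r j) * δ j c
insert-punchIn zero            r zero    = solve 1 (λ s → κ 0 := s :+ :- s :* κ 1) refl (r zero)
insert-punchIn zero            r (suc c) = zero-multiple (r (suc c)) (- r zero)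
  where
  zero-multiple = solve 2 (λ a b → a := a :+ b :* κ 0) refl
insert-punchIn {suc n} (suc j) r zero    = zero-multiple (r zero) (- r (suc j))
  where
  zero-multiple = solve 2 (λ a b → a := a :+ b :* κ 0) refl
insert-punchIn {suc n} (suc j) r (suc c) = insert-punchIn j (r ∘ suc) c

bordered : ∀ {n} → Fin (suc n) → Matrix n → Matrix (suc n)
bordered j N zero    = δ j
bordered j N (suc i) = insert j (N i)

bordered-alternating : ∀ {n} {φ : Matrix (suc n) → Q} → Alternating φ → ∀ j → Alternating (φ ∘ bordered j)
bordered-alternating A j = record
  { ext    = λ eq → ext (λ { zero c → refl ; (suc i) c → insert-cong j (eq i) c })
  ; linear = λ l a b M≡ N≡ P≡ → linear (suc l) a b
      (λ { zero _ c → refl ; (suc i) i≢l c → insert-cong j (M≡ i (i≢l ∘ cong suc)) c })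
      (λ { zero _ c → refl ; (suc i) i≢l c → insert-cong j (N≡ i (i≢l ∘ cong suc)) c })
      (insert-linear j a b P≡)
  ; alt    = λ i≢k eq → alt (i≢k ∘ suc-injective) (insert-cong j eq)
  }
  where open Alternating A

-- Exchanging the first two rows turns `bordered (suc j) δ` into `bordered zero (bordered j δ)`, so
-- every step of j costs one sign.
bordered-identity : ∀ {n} {φ : Matrix (suc n) → Q} → Alternating φ → ∀ j → φ (bordered j δ) ≡ sgn j * φ δ
bordered-identity {n} {φ} A zero = trans (Alternating.ext A pointwise) (sym (*-identityˡ _))
  where
  pointwise : ∀ i c → bordered zero δ i c ≡ δ i c
  pointwise zero    c       = refl
  pointwise (suc i) zero    = refl
  pointwise (suc i) (suc c) = refl
bordered-identity {suc n} {φ} A (suc j) = begin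
  φ (bordered (suc j) δ) ≡⟨ AlternatingProperties.swap-neg A {bordered zero (bordered j δ)} {bordered (suc j) δ} {zero} {suc zero} (λ ()) row₀ row₁ rows ⟩
  - φ (bordered zero (bordered j δ)) ≡⟨ cong -_ (bordered-identity (bordered-alternating A zero) j) ⟩
  - (sgn j * φ (bordered zero δ)) ≡⟨ cong (λ z → - (sgn j * z)) (bordered-identity A zero) ⟩
  - (sgn j * (1q * φ δ)) ≡⟨ signs (sgn j) (φ δ) ⟩
  - sgn j * φ δ                          ∎
  where
  signs = solve 2 (λ s a → :- (s :* (κ 1 :* a)) := :- s :* a) refl
  row₀ : ∀ c → δ (suc j) c ≡ insert zero (δ j) c
  row₀ zero    = refl
  row₀ (suc c) = refl
  insert-0 : ∀ {n} (j : Fin (suc n)) c → insert j (λ _ → 0q) c ≡ 0q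
  insert-0 zero zero = refl
  insert-0 zero (suc c) = refl
  insert-0 {suc n} (suc j) zero = refl
  insert-0 {suc n} (suc j) (suc c) = insert-0 j c
  row₁ : ∀ c → insert (suc j) (δ zero) c ≡ δ zero c
  row₁ zero    = refl
  row₁ (suc c) = insert-0 j c
  rows : ∀ l → l ≢ zero → l ≢ suc zero → ∀ c → bordered (suc j) δ l c ≡ bordered zero (bordered j δ) l c
  rows zero          l≢0 l≢1 c       = contradiction refl l≢0
  rows (suc zero)    l≢0 l≢1 c       = contradiction refl l≢1
  rows (suc (suc l)) l≢0 l≢1 zero    = refl
  rows (suc (suc l)) l≢0 l≢1 (suc c) = refl

-- Expanding row 0 leaves matrices whose first row is a unit vector. That row clears its column from
-- the rows below, and what remains is an alternating function of the minor, to which induction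
-- applies.
det-unique : ∀ {n} {φ : Matrix n → Q} → Alternating φ → ∀ M → φ M ≡ φ δ * det M
det-unique {zero}  {φ} A M = trans (Alternating.ext A (λ ())) (trans (sym (*-identityˡ _)) (*-comm _ _))
det-unique {suc n} {φ} A M = begin
  φ M ≡⟨ ≔-self M zero ⟨
  φ (M [ zero ≔ M zero ]) ≡⟨ row-expansion A M zero (M zero) ⟩
  ∑ (λ j → M zero j * φ (M [ zero ≔ δ j ])) ≡⟨ ∑-cong (λ j → cong (M zero j *_) (column-cleared j)) ⟩
  ∑ (λ j → M zero j * (sgn j * φ δ * det (minor M j))) ≡⟨ ∑-cong (λ j → regroup (M zero j) (sgn j) (φ δ) (det (minor M j))) ⟩
  ∑ (λ j → φ δ * (sgn j * (M zero j * det (minor M j)))) ≡⟨ ∑-*ˡ (φ δ) (λ j → sgn j * (M zero j * det (minor M j))) ⟩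
  φ δ * det M                                                ∎
  where
  open AlternatingProperties A

  regroup = solve 4 (λ m s p d → m :* (s :* p :* d) := p :* (s :* (m :* d))) refl

  column-cleared : ∀ j → φ (M [ zero ≔ δ j ]) ≡ sgn j * φ δ * det (minor M j)
  column-cleared j = begin
    φ (M [ zero ≔ δ j ]) ≡⟨ add-first-row A (λ i → - M (suc i) j) (λ c → refl) (λ i → insert-punchIn j (M (suc i))) ⟨
    φ (bordered j (minor M j)) ≡⟨ det-unique (bordered-alternating A j) (minor M j) ⟩
    φ (bordered j δ) * det (minor M j) ≡⟨ cong (_* det (minor M j)) (bordered-identity A j) ⟩
    sgn j * φ δ * det (minor M j)             ∎

det-first-δ : ∀ {n} (M : Matrix (suc n)) k → (∀ j → M zero j ≡ δ k j) → det M ≡ sgn k * det (minor M k)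
det-first-δ M k eq = begin
  ∑ (λ j → sgn j * (M zero j * det (minor M j))) ≡⟨ ∑-cong (λ j → trans (cong (λ m → sgn j * (m * det (minor M j))) (eq j)) (rotate (sgn j) (δ k j) _)) ⟩
  ∑ (λ j → δ k j * (sgn j * det (minor M j))) ≡⟨ ∑-δ k (λ j → sgn j * det (minor M j)) ⟩
  sgn k * det (minor M k)                            ∎
  where
  rotate = solve 3 (λ s m d → s :* (m :* d) := m :* (s :* d)) refl

det-δ : ∀ n → det (δ {n}) ≡ 1q
det-δ zero    = refl
det-δ (suc n) = trans (det-first-δ {n} δ zero (λ j → refl)) (trans (*-identityˡ _) (trans (det-cong {n} {M = minor δ zero} {δ} (λ i j → refl)) (det-δ n)))

-- As a function of M the left side is itself alternating, so only its value at the identity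
-- matters. The sign of the permutation would occur twice and never has to be defined. Keeping m and
-- n apart spares a transport when the two index sets are only propositionally of the same size.
det-congruent : ∀ {m n} (σ : Fin m ↔ Fin n) (u : Fin m → Q) → (∀ i → u i * u i ≡ 1q) → (M : Matrix n) →
  m ≡ n → det (λ i j → u i * u j * M (Inverse.to σ i) (Inverse.to σ j)) ≡ det M
det-congruent {n} σ u u² M refl = begin
  φ M ≡⟨ det-unique alternating M ⟩
  φ δ * det M ≡⟨ cong (_* det M) φδ ⟩
  1q * det M ≡⟨ *-identityˡ _ ⟩
  det M          ∎
  where
  open Inverse σ using (to; from; strictlyInverseˡ; strictlyInverseʳ)

  φ : Matrix n → Q
  φ M = det (λ i j → u i * u j * M (to i) (to j))

  to-injective : ∀ {i k} → to i ≡ to k → i ≡ k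
  to-injective {i} {k} eq = trans (sym (strictlyInverseʳ i)) (trans (cong from eq) (strictlyInverseʳ k))

  distribute = solve 6 (λ v w a b x y → v :* w :* (a :* x :+ b :* y) := a :* (v :* w :* x) :+ b :* (v :* w :* y)) refl

  scale-row : ∀ v w u x → w * w ≡ 1q → v * u * x ≡ v * w * (w * u * x)
  scale-row v w u x ww≡1 = trans (solve 3 (λ v u x → v :* u :* x := v :* κ 1 :* u :* x) refl v u x) (trans (cong (λ z → v * z * u * x) (sym ww≡1)) (solve 4 (λ v w u x → v :* (w :* w) :* u :* x := v :* w :* (w :* u :* x)) refl v w u x))

  alternating : Alternating φ
  alternating = record
    { ext    = λ eq → det-cong (λ i j → cong (u i * u j *_) (eq (to i) (to j)))
    ; linear = λ l a b {M} {N} {P} M≡ N≡ P≡ → det-linear (from l) a b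
        (λ i i≢l j → cong (u i * u j *_) (M≡ (to i) (λ eq → i≢l (trans (sym (strictlyInverseʳ i)) (cong from eq))) (to j)))
        (λ i i≢l j → cong (u i * u j *_) (N≡ (to i) (λ eq → i≢l (trans (sym (strictlyInverseʳ i)) (cong from eq))) (to j)))
        (λ j → trans (cong (u (from l) * u j *_) (at-l l {a} {b} {M} {N} {P} P≡ (to j))) (distribute _ _ a b _ _))
    ; alt    = λ {M} {i} {k} i≢k eq → equal-rows M i k i≢k eq
    }
    where
    at-l : ∀ l {a b} {M N P : Matrix n} → (∀ j → P l j ≡ a * M l j + b * N l j) →
           ∀ j → P (to (from l)) j ≡ a * M (to (from l)) j + b * N (to (from l)) j
    at-l l {a} {b} {M} {N} {P} eq j rewrite strictlyInverseˡ l = eq j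

    -- row from i of the transformed matrix is u (from i) · u (from k) times row from k
    equal-rows : ∀ M i k → i ≢ k → (∀ j → M i j ≡ M k j) → φ M ≡ 0q
    equal-rows M i k i≢k eq = begin
      det N ≡⟨ det-linear i′ c 0q {N [ i′ ≔ N k′ ]} {N} {N}
          (λ l l≢i j → [≔]-other N (N k′) j l≢i) (λ l l≢i j → refl) proportional ⟩
      c * det (N [ i′ ≔ N k′ ]) + 0q * det N ≡⟨ cong (λ z → c * z + 0q * det N) (AlternatingProperties.alt-≔ (det-alternating n) N i′≢k′) ⟩
      c * 0q + 0q * det N ≡⟨ (solve 2 (λ c s → c :* κ 0 :+ κ 0 :* s := κ 0) refl c (det N)) ⟩
      0q                                 ∎
      where
      N : Matrix n
      N i j = u i * u j * M (to i) (to j)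
      i′ = from i
      k′ = from k
      c = u i′ * u k′
      i′≢k′ : i′ ≢ k′
      i′≢k′ i′≡k′ = i≢k (trans (sym (strictlyInverseˡ i)) (trans (cong to i′≡k′) (strictlyInverseˡ k)))
      add-zero = solve 3 (λ a b c → a :* b := a :* b :+ κ 0 :* c) refl
      proportional : ∀ j → N i′ j ≡ c * (N [ i′ ≔ N k′ ]) i′ j + 0q * N i′ j
      proportional j = begin
        u i′ * u j * M (to i′) (to j) ≡⟨ cong (λ z → u i′ * u j * M z (to j)) (strictlyInverseˡ i) ⟩
        u i′ * u j * M i (to j) ≡⟨ cong (u i′ * u j *_) (eq (to j)) ⟩
        u i′ * u j * M k (to j) ≡⟨ cong (λ z → u i′ * u j * M z (to j)) (strictlyInverseˡ k) ⟨
        u i′ * u j * M (to k′) (to j) ≡⟨ scale-row (u i′) (u k′) (u j) _ (u² k′) ⟩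
        c * N k′ j ≡⟨ cong (c *_) ([≔]-same N i′ (N k′) j) ⟨
        c * (N [ i′ ≔ N k′ ]) i′ j ≡⟨ add-zero c _ (N i′ j) ⟩
        c * (N [ i′ ≔ N k′ ]) i′ j + 0q * N i′ j ∎

  δ-to : ∀ i j → u i * u j * δ (to i) (to j) ≡ δ i j
  δ-to i j with i ≟ j
  ... | yes refl = trans (cong₂ _*_ (u² i) (δ-refl (to i))) (trans (*-identityˡ 1q) (sym (δ-refl i)))
  ... | no i≢j   = trans (cong (u i * u j *_) (δ-≢ (i≢j ∘ to-injective))) (trans (*-comm _ 0q) (trans (*-zeroˡ _) (sym (δ-≢ i≢j))))

  φδ : φ δ ≡ 1q
  φδ = trans (det-cong δ-to) (det-δ n)

-- Entry (j , l) is the cofactor of position (l , j), expressed as a determinant of full size so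
-- that no sign and no smaller matrix occurs.
adjugate : ∀ {n} → Matrix n → Matrix n
adjugate M j l = det (M [ l ≔ δ j ])

mul-adjugate : ∀ {n} (M : Matrix n) k l → ∑ (λ j → M k j * adjugate M j l) ≡ det M * δ k l
mul-adjugate {n} M k l = trans (sym (row-expansion (det-alternating n) M l (M k))) diagonal
  where
  diagonal : det (M [ l ≔ M k ]) ≡ det M * δ k l
  diagonal with k ≟ l
  ... | yes refl = trans (AlternatingProperties.≔-self (det-alternating n) M k)
                     (trans (sym (*-identityˡ _)) (trans (*-comm 1q _) (cong (det M *_) (sym (δ-refl k)))))
  ... | no k≢l   = trans (AlternatingProperties.alt-≔ (det-alternating n) M (k≢l ∘ sym))
                     (trans (sym (*-zeroˡ _)) (trans (*-comm 0q _) (cong (det M *_) (sym (δ-≢ k≢l)))))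

-- Quadratic forms and the inertia of M + x

Vector : ℕ → Set
Vector n = Fin n → Q

infixl 7 _∙_
infixr 8 _⊛_

_∙_ : ∀ {n} → Vector n → Vector n → Q
u ∙ v = ∑ (λ i → u i * v i)

_⊛_ : ∀ {n} → Matrix n → Vector n → Vector n
(A ⊛ v) i = A i ∙ v

∙-cong : ∀ {n} {u u′ v v′ : Vector n} → (∀ i → u i ≡ u′ i) → (∀ i → v i ≡ v′ i) → u ∙ v ≡ u′ ∙ v′
∙-cong p q = ∑-cong (λ i → cong₂ _*_ (p i) (q i))

∙-comm : ∀ {n} (u v : Vector n) → u ∙ v ≡ v ∙ u
∙-comm u v = ∑-cong (λ i → *-comm (u i) (v i))

∙-linearʳ : ∀ {n} a b (u v w : Vector n) → u ∙ (λ i → a * v i + b * w i) ≡ a * (u ∙ v) + b * (u ∙ w)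
∙-linearʳ a b u v w = trans (∑-cong (λ i → distribute (u i) (v i) (w i))) (∑-lin a b (λ i → u i * v i) (λ i → u i * w i))
  where
  distribute = λ u v w → solve 5 (λ u a v b w → u :* (a :* v :+ b :* w) := a :* (u :* v) :+ b :* (u :* w)) refl u a v b w

∙-linearˡ : ∀ {n} a b (u v w : Vector n) → (λ i → a * v i + b * w i) ∙ u ≡ a * (v ∙ u) + b * (w ∙ u)
∙-linearˡ a b u v w = trans (∙-comm _ u) (trans (∙-linearʳ a b u v w) (cong₂ (λ x y → a * x + b * y) (∙-comm u v) (∙-comm u w)))

∙-self-≽0 : ∀ {n} (u : Vector n) → 0q ≼ u ∙ u
∙-self-≽0 u = ∑-≽0 (λ i → 0≼sq (u i))

Symmetric : ∀ {n} → Matrix n → Set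
Symmetric A = ∀ i j → A i j ≡ A j i

self-adjoint : ∀ {n} {A : Matrix n} → Symmetric A → ∀ u v → u ∙ A ⊛ v ≡ A ⊛ u ∙ v
self-adjoint {n} {A} A-sym u v = begin
  ∑ (λ i → u i * ∑ (λ j → A i j * v j)) ≡⟨ ∑-cong (λ i → ∑-*ˡ (u i) (λ j → A i j * v j)) ⟨
  ∑ (λ i → ∑ (λ j → u i * (A i j * v j))) ≡⟨ ∑-swap (λ i j → u i * (A i j * v j)) ⟩
  ∑ (λ j → ∑ (λ i → u i * (A i j * v j))) ≡⟨ ∑-cong (λ j → ∑-cong (λ i → trans (cong (λ a → u i * (a * v j)) (A-sym i j)) (regroup (u i) (A j i) (v j)))) ⟩
  ∑ (λ j → ∑ (λ i → v j * (A j i * u i))) ≡⟨ ∑-cong (λ j → trans (∑-*ˡ (v j) (λ i → A j i * u i)) (*-comm _ _)) ⟩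
  ∑ (λ j → ∑ (λ i → A j i * u i) * v j)      ∎
  where
  regroup = solve 3 (λ u a v → u :* (a :* v) := v :* (a :* u)) refl

∙-δ : ∀ {n} c (u : Vector n) l → u ∙ (λ k → c * δ k l) ≡ c * u l
∙-δ c u l = trans (∑-cong (λ k → trans (regroup (u k) (δ k l)) (cong (_* (c * u k)) (δ-sym k l)))) (∑-δ l (λ k → c * u k))
  where
  regroup = λ u d → solve 3 (λ u c d → u :* (c :* d) := d :* (c :* u)) refl u c d

solution : ∀ {n} (A : Matrix n) → det A ≢ 0q → ∀ y → Σ (Vector n) λ a → ∀ i → (A ⊛ a) i ≡ y i
solution {n} A det≢0 y with inverse (det A) det≢0
... | d⁻¹ , dd⁻¹≡1 = a , solves
  where
  a : Vector n
  a j = d⁻¹ * ∑ (λ l → adjugate A j l * y l)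

  pull = solve 3 (λ x d s → x :* (d :* s) := d :* (x :* s)) refl

  push = solve 4 (λ d e k y → d :* (e :* k :* y) := e :* d :* (k :* y)) refl

  solves : ∀ i → (A ⊛ a) i ≡ y i
  solves i = begin
    ∑ (λ j → A i j * (d⁻¹ * ∑ (λ l → adjugate A j l * y l))) ≡⟨ ∑-cong (λ j → pull (A i j) d⁻¹ _) ⟩
    ∑ (λ j → d⁻¹ * (A i j * ∑ (λ l → adjugate A j l * y l))) ≡⟨ ∑-*ˡ d⁻¹ (λ j → A i j * ∑ (λ l → adjugate A j l * y l)) ⟩
    d⁻¹ * ∑ (λ j → A i j * ∑ (λ l → adjugate A j l * y l)) ≡⟨ cong (d⁻¹ *_) (∑-cong (λ j → ∑-*ˡ (A i j) (λ l → adjugate A j l * y l))) ⟨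
    d⁻¹ * ∑ (λ j → ∑ (λ l → A i j * (adjugate A j l * y l))) ≡⟨ cong (d⁻¹ *_) (∑-swap (λ j l → A i j * (adjugate A j l * y l))) ⟩
    d⁻¹ * ∑ (λ l → ∑ (λ j → A i j * (adjugate A j l * y l))) ≡⟨ cong (d⁻¹ *_) (∑-cong column) ⟩
    d⁻¹ * ∑ (λ l → det A * δ i l * y l) ≡⟨ ∑-*ˡ d⁻¹ (λ l → det A * δ i l * y l) ⟨
    ∑ (λ l → d⁻¹ * (det A * δ i l * y l)) ≡⟨ ∑-cong (λ l → push d⁻¹ (det A) (δ i l) (y l)) ⟩
    ∑ (λ l → det A * d⁻¹ * (δ i l * y l)) ≡⟨ ∑-*ˡ (det A * d⁻¹) (λ l → δ i l * y l) ⟩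
    det A * d⁻¹ * ∑ (λ l → δ i l * y l) ≡⟨ cong₂ _*_ dd⁻¹≡1 (∑-δ i y) ⟩
    1q * y i ≡⟨ *-identityˡ (y i) ⟩
    y i                                                             ∎
    where
    factor = solve 3 (λ a b y → a :* (b :* y) := y :* (a :* b)) refl
    column : ∀ l → ∑ (λ j → A i j * (adjugate A j l * y l)) ≡ det A * δ i l * y l
    column l = trans (∑-cong (λ j → factor (A i j) (adjugate A j l) (y l)))
      (trans (∑-*ˡ (y l) (λ j → A i j * adjugate A j l)) (trans (cong (y l *_) (mul-adjugate A i l)) (*-comm _ _)))

-- `mul-adjugate` multiplies by the adjugate on one side only; symmetry carries A across the inner
-- product and so supplies the other side.
cramer : ∀ {n} {A : Matrix n} → Symmetric A → ∀ {w v} → (∀ i → (A ⊛ w) i ≡ v i) → ∀ l → det A * w l ≡ v ∙ (λ j → adjugate A j l)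
cramer {n} {A} A-sym {w} {v} Aw≡v l = begin
  det A * w l ≡⟨ ∙-δ (det A) w l ⟨
  w ∙ (λ k → det A * δ k l) ≡⟨ ∙-cong (λ _ → refl) (λ k → mul-adjugate A k l) ⟨
  w ∙ A ⊛ (λ j → adjugate A j l) ≡⟨ self-adjoint {A = A} A-sym w (λ j → adjugate A j l) ⟩
  A ⊛ w ∙ (λ j → adjugate A j l) ≡⟨ ∙-cong {v = λ j → adjugate A j l} Aw≡v (λ _ → refl) ⟩
  v ∙ (λ j → adjugate A j l)             ∎

∑-const : ∀ n c → ∑ {n} (λ _ → c) ≡ ι n * c
∑-const zero    c = sym (*-zeroˡ c)
∑-const (suc n) c = trans (cong (c +_) (∑-const n c)) (trans (factor (ι n)) (cong (_* c) (sym (ι-suc n))))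
  where
  factor = λ k → solve 2 (λ c k → c :+ k :* c := (κ 1 :+ k) :* c) refl c k

-- Termwise 2 |s x t| ≤ K (s² + t²) when |x| ≤ K; summing over all pairs of coordinates produces the
-- factor n.
quadratic-form-bound : ∀ {n} {X : Matrix n} {K} → (∀ i j → ∣ X i j ∣≼ K) → ∀ b → ∣ b ∙ X ⊛ b ∣≼ (K * (ι n * (b ∙ b)))
quadratic-form-bound {n} {X} {K} X≼K b = bounds
  (0≼-cancel (0≺ι-suc 1) (0≼-resp (∑-≽0 (λ i → ∑-≽0 (λ j → pair₊ (X≼K i j) (b i) (b j)))) (trans (total 1q lem₊) (solve 4 (λ K s t u → κ 2 :* (K :* (s :* t) :+ κ 1 :* u) := κ 2 :* (K :* (s :* t) :+ u)) refl K (ι n) (b ∙ b) (b ∙ X ⊛ b)))))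
  (0≼-cancel (0≺ι-suc 1) (0≼-resp (∑-≽0 (λ i → ∑-≽0 (λ j → pair₋ (X≼K i j) (b i) (b j)))) (trans (total (- 1q) lem₋) (solve 4 (λ K s t u → κ 2 :* (K :* (s :* t) :+ :- κ 1 :* u) := κ 2 :* (K :* (s :* t) :- u)) refl K (ι n) (b ∙ b) (b ∙ X ⊛ b)))))
  where
  pair₊ : ∀ {x} → ∣ x ∣≼ K → ∀ s t → 0q ≼ K * (s * s) + K * (t * t) + ι 2 * (s * (x * t))
  pair₊ {x} (bounds l u) s t = 0≼-cancel (0≺ι-suc 1)
    (0≼-resp (0≼+ (0≼* l (0≼sq (s + t))) (0≼* u (0≼sq (s - t)))) (solve 4 (λ K x s t → (K :+ x) :* ((s :+ t) :* (s :+ t)) :+ (K :- x) :* ((s :- t) :* (s :- t)) := κ 2 :* (K :* (s :* s) :+ K :* (t :* t) :+ κ 2 :* (s :* (x :* t)))) refl K x s t))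
  pair₋ : ∀ {x} → ∣ x ∣≼ K → ∀ s t → 0q ≼ K * (s * s) + K * (t * t) - ι 2 * (s * (x * t))
  pair₋ {x} (bounds l u) s t = 0≼-cancel (0≺ι-suc 1)
    (0≼-resp (0≼+ (0≼* u (0≼sq (s + t))) (0≼* l (0≼sq (s - t)))) (solve 4 (λ K x s t → (K :- x) :* ((s :+ t) :* (s :+ t)) :+ (K :+ x) :* ((s :- t) :* (s :- t)) := κ 2 :* (K :* (s :* s) :+ K :* (t :* t) :- κ 2 :* (s :* (x :* t)))) refl K x s t))

  lem₊ : ∀ i j → K * (b i * b i) + K * (b j * b j) + ι 2 * (b i * (X i j * b j)) ≡
                 (K * (b i * b i) + K * (b j * b j)) + ι 2 * 1q * (b i * (X i j * b j))
  lem₊ i j = solve 4 (λ K s t u → K :* (s :* s) :+ K :* (t :* t) :+ κ 2 :* (s :* (u :* t)) := K :* (s :* s) :+ K :* (t :* t) :+ κ 2 :* κ 1 :* (s :* (u :* t))) refl K (b i) (b j) (X i j)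
  lem₋ : ∀ i j → K * (b i * b i) + K * (b j * b j) - ι 2 * (b i * (X i j * b j)) ≡
                 (K * (b i * b i) + K * (b j * b j)) + ι 2 * - 1q * (b i * (X i j * b j))
  lem₋ i j = solve 4 (λ K s t u → K :* (s :* s) :+ K :* (t :* t) :- κ 2 :* (s :* (u :* t)) := K :* (s :* s) :+ K :* (t :* t) :+ κ 2 :* :- κ 1 :* (s :* (u :* t))) refl K (b i) (b j) (X i j)

  total : ∀ c {g : Fin n → Fin n → Q} → (∀ i j → g i j ≡ (K * (b i * b i) + K * (b j * b j)) + ι 2 * c * (b i * (X i j * b j))) →
          ∑ (λ i → ∑ (g i)) ≡ ι 2 * (K * (ι n * (b ∙ b)) + c * (b ∙ X ⊛ b))
  total c {g} eq = begin
    ∑ (λ i → ∑ (g i))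
      ≡⟨ ∑-cong (λ i → trans (∑-cong (eq i)) (trans (∑-+ (λ j → K * (b i * b i) + K * (b j * b j)) (λ j → ι 2 * c * (b i * (X i j * b j))))
           (cong₂ _+_ (trans (∑-+ (λ _ → K * (b i * b i)) (λ j → K * (b j * b j))) (cong₂ _+_ (∑-const n (K * (b i * b i))) (∑-*ˡ K (λ j → b j * b j))))
               (trans (∑-*ˡ (ι 2 * c) (λ j → b i * (X i j * b j))) (cong (ι 2 * c *_) (∑-*ˡ (b i) (λ j → X i j * b j))))))) ⟩
    ∑ (λ i → ι n * (K * (b i * b i)) + K * (b ∙ b) + ι 2 * c * (b i * (X ⊛ b) i))
      ≡⟨ trans (∑-+ (λ i → ι n * (K * (b i * b i)) + K * (b ∙ b)) (λ i → ι 2 * c * (b i * (X ⊛ b) i)))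
           (cong₂ _+_ (trans (∑-+ (λ i → ι n * (K * (b i * b i))) (λ _ → K * (b ∙ b)))
               (cong₂ _+_ (trans (∑-*ˡ (ι n) (λ i → K * (b i * b i))) (cong (ι n *_) (∑-*ˡ K (λ i → b i * b i)))) (∑-const n (K * (b ∙ b)))))
               (∑-*ˡ (ι 2 * c) (λ i → b i * (X ⊛ b) i))) ⟩
    ι n * (K * (b ∙ b)) + ι n * (K * (b ∙ b)) + ι 2 * c * (b ∙ X ⊛ b)
      ≡⟨ collect (ι n) (b ∙ b) (b ∙ X ⊛ b) ⟩
    ι 2 * (K * (ι n * (b ∙ b)) + c * (b ∙ X ⊛ b)) ∎
    where
    collect = λ m s t → solve 5 (λ m K s c t → m :* (K :* s) :+ m :* (K :* s) :+ κ 2 :* c :* t := κ 2 :* (K :* (m :* s) :+ c :* t)) refl m K s c t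

∣sgn∣≼1 : ∀ {n} (j : Fin n) → ∣ sgn j ∣≼ 1q
∣sgn∣≼1 zero    = bounds (0≼-resp (0≼ι 2) (solve 0 (κ 2 := κ 1 :+ κ 1) refl)) (0≼-resp (0≼ι 0) (solve 0 (κ 0 := κ 1 :- κ 1) refl))
∣sgn∣≼1 (suc j) with ∣sgn∣≼1 j
... | bounds l u = bounds u (0≼-resp l (solve 1 (λ s → κ 1 :+ s := κ 1 :- :- s) refl (sgn j)))

∣δ∣≼1 : ∀ {n} (j k : Fin n) → ∣ δ j k ∣≼ 1q
∣δ∣≼1 zero    zero    = bounds (0≼-resp (0≼ι 2) (solve 0 (κ 2 := κ 1 :+ κ 1) refl)) (0≼-resp (0≼ι 0) (solve 0 (κ 0 := κ 1 :- κ 1) refl))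
∣δ∣≼1 zero    (suc k) = bounds (0≼-resp (0≼ι 1) (solve 0 (κ 1 := κ 1 :+ κ 0) refl)) (0≼-resp (0≼ι 1) (solve 0 (κ 1 := κ 1 :- κ 0) refl))
∣δ∣≼1 (suc j) zero    = bounds (0≼-resp (0≼ι 1) (solve 0 (κ 1 := κ 1 :+ κ 0) refl)) (0≼-resp (0≼ι 1) (solve 0 (κ 1 := κ 1 :- κ 0) refl))
∣δ∣≼1 (suc j) (suc k) = ∣δ∣≼1 j k

∣∑∣≼ : ∀ {n} {f : Fin n → Q} {C} → (∀ i → ∣ f i ∣≼ C) → ∣ ∑ f ∣≼ (ι n * C)
∣∑∣≼ {zero}  {C = C} f≼C = bounds (0≼-resp ≼-refl (solve 1 (λ C → κ 0 := κ 0 :* C :+ κ 0) refl C)) (0≼-resp ≼-refl (solve 1 (λ C → κ 0 := κ 0 :* C :- κ 0) refl C))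
∣∑∣≼ {suc n} {f} {C} f≼C = subst (∣ ∑ f ∣≼_) (trans (factor (ι n)) (cong (_* C) (sym (ι-suc n)))) (∣+∣≼ (f≼C zero) (∣∑∣≼ (f≼C ∘ suc)))
  where
  factor = λ k → solve 2 (λ C k → C :+ k :* C := (κ 1 :+ k) :* C) refl C k

-- The bound depends on the size and on B alone, so one C serves the whole pencil and all its
-- adjugates.
det-bound : ∀ n {B} → 0q ≼ B → Σ Q λ C → 0q ≼ C × (∀ {M : Matrix n} → (∀ i j → ∣ M i j ∣≼ B) → ∣ det M ∣≼ C)
det-bound zero    _ = 1q , 0≼ι 1 , λ _ → bounds (0≼-resp (0≼ι 2) (solve 0 (κ 2 := κ 1 :+ κ 1) refl)) (0≼-resp (0≼ι 0) (solve 0 (κ 0 := κ 1 :- κ 1) refl))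
det-bound (suc n) {B} 0≼B with det-bound n 0≼B
... | C , 0≼C , bd = ι (suc n) * (1q * (B * C)) , 0≼* (0≼ι (suc n)) (0≼* (0≼ι 1) (0≼* 0≼B 0≼C)) ,
                     λ M≼B → ∣∑∣≼ (λ j → ∣*∣≼ (∣sgn∣≼1 j) (∣*∣≼ (M≼B zero j) (bd (λ a b → M≼B (suc a) (punchIn j b)))))

module _ {n} {A : Matrix n} (A-sym : Symmetric A) where

  quadratic-combination : ∀ a b v w → let u = λ i → a * v i + b * w i in
    u ∙ A ⊛ u ≡ a * a * (v ∙ A ⊛ v) + ι 2 * (a * b) * (v ∙ A ⊛ w) + b * b * (w ∙ A ⊛ w)
  quadratic-combination a b v w = begin
    u ∙ A ⊛ u ≡⟨ ∙-cong (λ _ → refl) (λ i → ∙-linearʳ a b (A i) v w) ⟩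
    u ∙ (λ i → a * (A ⊛ v) i + b * (A ⊛ w) i) ≡⟨ ∙-linearʳ a b u (A ⊛ v) (A ⊛ w) ⟩
    a * (u ∙ A ⊛ v) + b * (u ∙ A ⊛ w) ≡⟨ cong₂ (λ x y → a * x + b * y) (∙-linearˡ a b (A ⊛ v) v w) (∙-linearˡ a b (A ⊛ w) v w) ⟩
    a * (a * vv + b * (w ∙ A ⊛ v)) + b * (a * vw + b * ww) ≡⟨ cong (λ z → a * (a * vv + b * z) + b * (a * vw + b * ww)) (trans (self-adjoint A-sym w v) (∙-comm (A ⊛ w) v)) ⟩
    a * (a * vv + b * vw) + b * (a * vw + b * ww) ≡⟨ collect vv vw ww ⟩
    a * a * vv + ι 2 * (a * b) * vw + b * b * ww                         ∎
    where
    u = λ i → a * v i + b * w i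
    vv = v ∙ A ⊛ v
    vw = v ∙ A ⊛ w
    ww = w ∙ A ⊛ w
    collect = λ p q r → solve 5 (λ a p b q r → a :* (a :* p :+ b :* q) :+ b :* (a :* q :+ b :* r) := a :* a :* p :+ κ 2 :* (a :* b) :* q :+ b :* b :* r) refl a p b q r

  module _ (psd : ∀ v → 0q ≼ v ∙ A ⊛ v) where

    cauchy-schwarz : ∀ v w → (v ∙ A ⊛ w) * (v ∙ A ⊛ w) ≼ (v ∙ A ⊛ v) * (w ∙ A ⊛ w)
    cauchy-schwarz v w = lemma (v ∙ A ⊛ v) (v ∙ A ⊛ w) (w ∙ A ⊛ w) (psd v) (psd w)
        (λ a b → 0≼-resp (psd (λ i → a * v i + b * w i)) (quadratic-combination a b v w))
      where
      lemma : ∀ p q r → 0q ≼ p → 0q ≼ r → (∀ a b → 0q ≼ a * a * p + ι 2 * (a * b) * q + b * b * r) → q * q ≼ p * r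
      lemma p q r 0≼p 0≼r nonneg with ≼⊎≻ r 0q
      -- At a = r and b = - q the nonnegative expression equals r (p r - q²), from which r is
      -- cancelled.
      ... | inj₂ 0≺r = ≼-by (0≼-cancel 0≺r (0≼-resp (nonneg r (- q)) (solve 3 (λ r p q → r :* r :* p :+ κ 2 :* (r :* :- q) :* q :+ :- q :* :- q :* r := r :* (p :* r :- q :* q)) refl r p q))) refl
      ... | inj₁ r≼0 = ≼-reflexive (trans qq≡0 (cong (p *_) (≼-antisym 0≼r r≼0)))
        where
        -- r = 0 is excluded by the vector q v − (p + 1) w unless q = 0
        qq≡0 : q * q ≡ p * 0q
        qq≡0 = trans (≼-antisym (≼-by (0≼-cancel (0≼+≻0 0≼p (0≺ι-suc 1))
            (0≼-resp (nonneg q (- (p + 1q))) (trans (cong (λ z → q * q * p + ι 2 * (q * - (p + 1q)) * q + - (p + 1q) * - (p + 1q) * z) (≼-antisym r≼0 0≼r)) (solve 2 (λ q p → q :* q :* p :+ κ 2 :* (q :* :- (p :+ κ 1)) :* q :+ :- (p :+ κ 1) :* :- (p :+ κ 1) :* κ 0 := (p :+ κ 2) :* (κ 0 :- q :* q)) refl q p)))) refl) (0≼sq q)) (solve 1 (λ p → κ 0 := p :* κ 0) refl p)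

    -- Cauchy-Schwarz against column v of the adjugate, which A maps to det A times the unit vector
    -- v. For positive definite A this is z_v² ≤ (z ∙ A z) (A⁻¹)_vv.
    det-coordinate : 0q ≺ det A → ∀ z v → det A * (z v * z v) ≼ (z ∙ A ⊛ z) * adjugate A v v
    det-coordinate 0≺D z v = ≼-cancel 0≺D (subst₂ (cauchy-schwarz z r))
      where
      r = λ j → adjugate A j v
      D = det A
      zAr : z ∙ A ⊛ r ≡ D * z v
      zAr = trans (∙-cong (λ _ → refl) (λ k → mul-adjugate A k v)) (∙-δ D z v)
      rAr : r ∙ A ⊛ r ≡ D * r v
      rAr = trans (∙-cong (λ _ → refl) (λ k → mul-adjugate A k v)) (∙-δ D r v)
      subst₂ : (z ∙ A ⊛ r) * (z ∙ A ⊛ r) ≼ (z ∙ A ⊛ z) * (r ∙ A ⊛ r) → D * (D * (z v * z v)) ≼ D * ((z ∙ A ⊛ z) * r v)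
      subst₂ le = ≼-by (≼⇒0≼- le) (trans (solve 4 (λ D s t u → D :* (s :* t) :- D :* (D :* (u :* u)) := s :* (D :* t) :- D :* u :* (D :* u)) refl D (z ∙ A ⊛ z) (r v) (z v))
                    (cong₂ (λ x y → (z ∙ A ⊛ z) * x - y * y) (sym rAr) (sym zAr)))

    adjugate-diagonal-≽0 : 0q ≺ det A → ∀ v → 0q ≼ adjugate A v v
    adjugate-diagonal-≽0 0≺D v = 0≼-cancel 0≺D (0≼-resp (psd r) (trans (∙-cong (λ _ → refl) (λ k → mul-adjugate A k v)) (∙-δ (det A) r v)))
      where
      r = λ j → adjugate A j v

    -- The argument of `det-coordinate` one dimension lower: on vectors vanishing at v the form is
    -- that of the principal submatrix without v, whose determinant is `adjugate A v v`. Replacing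
    -- row v of A by a unit vector represents this submatrix without changing the size.
    adjugate-coordinate : ∀ {C} z v w → z v ≡ 0q → v ≢ w → 0q ≼ C → 0q ≼ adjugate A v v → ∣ adjugate (A [ v ≔ δ v ]) w w ∣≼ C →
        adjugate A v v * (z w * z w) ≼ (z ∙ A ⊛ z) * C
    adjugate-coordinate {C} z v w zv≡0 v≢w 0≼C 0≼m r≼C with ≼⊎≻ (adjugate A v v) 0q
    ... | inj₁ m≼0 = subst (λ m → m * (z w * z w) ≼ (z ∙ A ⊛ z) * C) (≼-antisym 0≼m m≼0) (≼-by (0≼* (psd z) 0≼C) (solve 3 (λ s C t → s :* C :- κ 0 :* (t :* t) := s :* C) refl (z ∙ A ⊛ z) C (z w)))
    ... | inj₂ 0≺m = ≼-cancel 0≺m (≼-by (0≼+ (≼⇒0≼- (cauchy-schwarz z r)) (0≼* (0≼* (≺⇒≼ 0≺m) (psd z)) (∣_∣≼_.upper r≼C)))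
        (trans (solve 5 (λ m s C t u → m :* (s :* C) :- m :* (m :* (t :* t)) := s :* (m :* u) :- m :* t :* (m :* t) :+ m :* s :* (C :- u)) refl m (z ∙ A ⊛ z) C (z w) (r w))
        (cong₂ (λ x y → (z ∙ A ⊛ z) * x - y * y + m * (z ∙ A ⊛ z) * (C - r w)) (sym rAr) (sym zAr))))
      where
      A* = A [ v ≔ δ v ]
      m = adjugate A v v
      r = λ j → adjugate A* j w

      A*r : ∀ k → (A* ⊛ r) k ≡ m * δ k w
      A*r k = mul-adjugate A* k w

      Ar : ∀ k → k ≢ v → (A ⊛ r) k ≡ m * δ k w
      Ar k k≢v = trans (∙-cong {v = r} (λ j → sym ([≔]-other A (δ v) j k≢v)) (λ _ → refl)) (A*r k)

      rv≡0 : r v ≡ 0q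
      rv≡0 = begin
        r v ≡⟨ ∑-δ v r ⟨
        δ v ∙ r ≡⟨ ∙-cong {v = r} (λ j → sym ([≔]-same A v (δ v) j)) (λ _ → refl) ⟩
        (A* ⊛ r) v ≡⟨ A*r v ⟩
        m * δ v w ≡⟨ cong (m *_) (δ-≢ v≢w) ⟩
        m * 0q ≡⟨ (solve 1 (λ m → m :* κ 0 := κ 0) refl m) ⟩
        0q                   ∎

      pairing : ∀ u → u v ≡ 0q → u ∙ A ⊛ r ≡ m * u w
      pairing u uv≡0 = trans (∑-cong termwise) (∙-δ m u w)
        where
        termwise : ∀ k → u k * (A ⊛ r) k ≡ u k * (m * δ k w)
        termwise k with k ≟ v
        ... | yes refl = trans (cong (_* (A ⊛ r) k) uv≡0) (trans (*-zeroˡ _) (sym (trans (cong (_* (m * δ k w)) uv≡0) (*-zeroˡ _))))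
        ... | no k≢v   = cong (u k *_) (Ar k k≢v)

      zAr = pairing z zv≡0
      rAr = pairing r rv≡0

∑-mono : ∀ {n} {f g : Fin n → Q} → (∀ i → f i ≼ g i) → ∑ f ≼ ∑ g
∑-mono {zero}  le = ≼-refl
∑-mono {suc n} le = +-mono-≼ (le zero) (∑-mono (le ∘ suc))

largest-coordinate : ∀ {n} (z : Vector n) → (∀ i → z i ≡ 0q) ⊎ Σ (Fin n) λ v → z v ≢ 0q × (∀ i → z i * z i ≼ z v * z v)
largest-coordinate {zero}  z = inj₁ (λ ())
largest-coordinate {suc n} z with largest-coordinate (z ∘ suc) | z zero ≟q 0q
... | inj₁ rest≡0 | yes z₀≡0 = inj₁ λ { zero → z₀≡0 ; (suc i) → rest≡0 i }
... | inj₁ rest≡0 | no z₀≢0  = inj₂ (zero , z₀≢0 , λ { zero → ≼-refl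
    ; (suc i) → subst (_≼ z zero * z zero) (sym (trans (cong₂ _*_ (rest≡0 i) (rest≡0 i)) (*-zeroˡ 0q))) (0≼sq (z zero)) })
... | inj₂ (v , zv≢0 , max) | _ with ≼⊎≻ (z zero * z zero) (z (suc v) * z (suc v))
...   | inj₁ le = inj₂ (suc v , zv≢0 , λ { zero → le ; (suc i) → max i })
...   | inj₂ gt = inj₂ (zero , (λ z₀≡0 → ≺⇒⋡ gt (subst (_≼ z (suc v) * z (suc v)) (sym (trans (cong₂ _*_ z₀≡0 z₀≡0) (*-zeroˡ 0q))) (0≼sq (z (suc v)))))
    , λ { zero → ≼-refl ; (suc i) → ≼-trans (max i) (≺⇒≼ gt) })

norm-≼-largest : ∀ {n} (z : Vector n) v → (∀ i → z i * z i ≼ z v * z v) → z ∙ z ≼ ι n * (z v * z v)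
norm-≼-largest {n} z v max = subst (z ∙ z ≼_) (∑-const n (z v * z v)) (∑-mono max)

∣[≔]∣≼ : ∀ {n} {A : Matrix n} {B} → 1q ≼ B → (∀ i j → ∣ A i j ∣≼ B) → ∀ l j i k → ∣ (A [ l ≔ δ j ]) i k ∣≼ B
∣[≔]∣≼ 1≼B A≼B l j i k with i ≟ l
... | no _  = A≼B i k
... | yes _ = ∣∣≼-mono 1≼B (∣δ∣≼1 j k)

-- The pencil M + x and its resolvent

shift : ∀ {n} → Matrix n → Q → Matrix n
shift M x i j = M i j + x * δ i j

module Pencil {n} {M : Matrix n} (M-sym : Symmetric M) where

  shift-sym : ∀ x → Symmetric (shift M x)
  shift-sym x i j = cong₂ (λ m d → m + x * d) (M-sym i j) (δ-sym i j)

  shift-apply : ∀ x v i → (shift M x ⊛ v) i ≡ (M ⊛ v) i + x * v i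
  shift-apply x v i = begin
    ∑ (λ j → (M i j + x * δ i j) * v j) ≡⟨ ∑-cong (λ j → expand (M i j) (δ i j) (v j)) ⟩
    ∑ (λ j → M i j * v j + x * (δ i j * v j)) ≡⟨ ∑-+ (λ j → M i j * v j) (λ j → x * (δ i j * v j)) ⟩
    (M ⊛ v) i + ∑ (λ j → x * (δ i j * v j)) ≡⟨ cong ((M ⊛ v) i +_) (trans (∑-*ˡ x (λ j → δ i j * v j)) (cong (x *_) (∑-δ i v))) ⟩
    (M ⊛ v) i + x * v i                             ∎
    where
    expand = λ m d v → solve 4 (λ m x d v → (m :+ x :* d) :* v := m :* v :+ x :* (d :* v)) refl m x d v

  shift-difference : ∀ s t v i → (shift M t ⊛ v) i ≡ 1q * (shift M s ⊛ v) i + (t - s) * v i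
  shift-difference s t v i = begin
    (shift M t ⊛ v) i                             ≡⟨ shift-apply t v i ⟩
    (M ⊛ v) i + t * v i                           ≡⟨ solve 4 (λ u t v s → u :+ t :* v := κ 1 :* (u :+ s :* v) :+ (t :- s) :* v) refl ((M ⊛ v) i) t (v i) s ⟩
    1q * ((M ⊛ v) i + s * v i) + (t - s) * v i    ≡⟨ cong (λ z → 1q * z + (t - s) * v i) (shift-apply s v i) ⟨
    1q * (shift M s ⊛ v) i + (t - s) * v i        ∎

  shift-quadratic : ∀ s t v → v ∙ shift M t ⊛ v ≡ v ∙ shift M s ⊛ v + (t - s) * (v ∙ v)
  shift-quadratic s t v = trans (∙-cong (λ _ → refl) (shift-difference s t v))
    (trans (∙-linearʳ 1q (t - s) v (shift M s ⊛ v) v) (cong (_+ (t - s) * (v ∙ v)) (*-identityˡ _)))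

  Solves : Q → Vector n → Vector n → Set
  Solves x y a = ∀ i → (shift M x ⊛ a) i ≡ y i

  -- The resolvent identity (M + s)⁻¹ - (M + t)⁻¹ = (t - s) (M + s)⁻¹ (M + t)⁻¹, paired with y on
  -- both sides; the solutions a and b stand for the inverses applied to y.
  exchange : ∀ {s t y a b} → Solves s y a → Solves t y b → y ∙ a - y ∙ b ≡ (t - s) * (a ∙ b)
  exchange {s} {t} {y} {a} {b} sa tb = trans (cong (_- y ∙ b) (begin
    y ∙ a ≡⟨ ∙-cong {v = a} tb (λ _ → refl) ⟨
    shift M t ⊛ b ∙ a ≡⟨ self-adjoint (shift-sym t) b a ⟨
    b ∙ shift M t ⊛ a ≡⟨ ∙-cong (λ _ → refl) (λ i → trans (shift-difference s t a i) (cong (λ z → 1q * z + (t - s) * a i) (sa i))) ⟩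
    b ∙ (λ i → 1q * y i + (t - s) * a i) ≡⟨ ∙-linearʳ 1q (t - s) b y a ⟩
    1q * (b ∙ y) + (t - s) * (b ∙ a) ≡⟨ cong₂ (λ p q → 1q * p + (t - s) * q) (∙-comm b y) (∙-comm b a) ⟩
    1q * (y ∙ b) + (t - s) * (a ∙ b)                 ∎)) (cancel (y ∙ b) _)
    where
    cancel = solve 2 (λ p q → κ 1 :* p :+ q :- p := q) refl

  -- An interval on which the determinant keeps at least the distance d from 0. Together d and C
  -- bound the resolvent uniformly, so a step length that works everywhere can be fixed in advance;
  -- this replaces differentiation in x.
  module Interval {s t d B C : Q} (1≼B : 1q ≼ B) (0≼C : 0q ≼ C) (det≼C : ∀ {A : Matrix n} → (∀ i j → ∣ A i j ∣≼ B) → ∣ det A ∣≼ C)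
    (0≺d : 0q ≺ d) (entries : ∀ x → s ≼ x → x ≼ t → ∀ i j → ∣ shift M x i j ∣≼ B)
    (gap : ∀ x → s ≼ x → x ≼ t → d * d ≼ det (shift M x) * det (shift M x)) where

    det≢0 : ∀ x → s ≼ x → x ≼ t → det (shift M x) ≢ 0q
    det≢0 x s≼x x≼t det≡0 = ≺⇒⋡ (0≺* 0≺d 0≺d) (≼-trans (gap x s≼x x≼t) (≼-reflexive (trans (cong (λ z → z * z) det≡0) (*-zeroˡ 0q))))

    -- By `exchange` the decrease is η (a ∙ b). Since a - b solves the system with right side η b,
    -- the product D (a ∙ b) differs from D (b ∙ b) only by η times a quadratic form in b, which the
    -- smallness of η keeps dominated.
    short-step : ∀ {x η y a b} → s ≼ x → x ≼ t → 0q ≼ η → η * (C * (C * ι n)) ≼ d * d →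
                 Solves x y a → Solves (x + η) y b → y ∙ b ≼ y ∙ a
    short-step {x} {η} {y} {a} {b} s≼x x≼t 0≼η small xa x+ηb =
      ≼-by (0≼* 0≼η 0≼ab) (trans (exchange {x} {x + η} xa x+ηb) (solve 3 (λ x η s → (x :+ η :- x) :* s := η :* s) refl x η (a ∙ b)))
      where
      D = det (shift M x)
      X : Matrix n
      X l j = adjugate (shift M x) j l
      S = b ∙ X ⊛ b

      bb≽0 = ∙-self-≽0 b

      w : Vector n
      w i = 1q * a i + (- 1q) * b i

      isolate : ∀ y p q → y ≡ 1q * p + (x + η - x) * q → 1q * y + - 1q * p ≡ η * q
      isolate _ p q refl = solve 4 (λ p x η q → κ 1 :* (κ 1 :* p :+ (x :+ η :- x) :* q) :+ :- κ 1 :* p := η :* q) refl p x η q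

      w-solves : ∀ i → (shift M x ⊛ w) i ≡ η * b i
      w-solves i = trans (∙-linearʳ 1q (- 1q) (shift M x i) a b)
        (trans (cong (λ z → 1q * z + - 1q * (shift M x ⊛ b) i) (xa i))
               (isolate (y i) _ (b i) (trans (sym (x+ηb i)) (shift-difference x (x + η) b i))))

      Dw : ∀ l → D * w l ≡ η * (X ⊛ b) l
      Dw l = trans (cramer (shift-sym x) w-solves l)
        (trans (∑-cong (λ j → regroup (b j) (adjugate (shift M x) j l))) (∑-*ˡ η (λ j → X l j * b j)))
        where
        regroup = λ p q → solve 3 (λ η p q → η :* p :* q := η :* (q :* p)) refl η p q

      Dab : D * (a ∙ b) ≡ D * (b ∙ b) + η * S
      Dab = begin
        D * (a ∙ b) ≡⟨ ∑-*ˡ D (λ l → a l * b l) ⟨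
        ∑ (λ l → D * (a l * b l)) ≡⟨ ∑-cong (λ l → trans (split (a l) (b l)) (cong (λ z → D * (b l * b l) + z * b l) (Dw l))) ⟩
        ∑ (λ l → D * (b l * b l) + η * (X ⊛ b) l * b l) ≡⟨ ∑-cong (λ l → cong (D * (b l * b l) +_) (rotate (b l) ((X ⊛ b) l))) ⟩
        ∑ (λ l → D * (b l * b l) + η * (b l * (X ⊛ b) l)) ≡⟨ ∑-lin D η (λ l → b l * b l) (λ l → b l * (X ⊛ b) l) ⟩
        D * (b ∙ b) + η * S                                ∎
        where
        split = λ p q → solve 3 (λ D p q → D :* (p :* q) := D :* (q :* q) :+ D :* (κ 1 :* p :+ :- κ 1 :* q) :* q) refl D p q
        rotate = λ p q → solve 3 (λ η q p → η :* q :* p := η :* (p :* q)) refl η q p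

      ∣DS∣ : ∣ D * S ∣≼ (C * (C * (ι n * (b ∙ b))))
      ∣DS∣ = ∣*∣≼ (det≼C (entries x s≼x x≼t))
        (quadratic-form-bound (λ l j → det≼C (∣[≔]∣≼ 1≼B (entries x s≼x x≼t) l j)) b)

      certificate : ∀ m p q r u → D * p ≡ D * q + η * r →
        (D * D - d * d) * q + (d * d - η * (C * (C * m))) * q + η * (C * (C * (m * q)) + D * r) ≡ D * D * p
      certificate m p q r u eq = trans (solve 7 (λ D d q η C m r → (D :* D :- d :* d) :* q :+ (d :* d :- η :* (C :* (C :* m))) :* q :+ η :* (C :* (C :* (m :* q)) :+ D :* r) := D :* (D :* q :+ η :* r)) refl D d q η C m r) (trans (cong (D *_) (sym eq)) (solve 2 (λ D p → D :* (D :* p) := D :* D :* p) refl D p))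

      0≼ab : 0q ≼ a ∙ b
      0≼ab = 0≼-cancel (≺-≼-trans (0≺* 0≺d 0≺d) (gap x s≼x x≼t))
        (0≼-resp (0≼+ (0≼+ (0≼* (≼⇒0≼- (gap x s≼x x≼t)) bb≽0) (0≼* (≼⇒0≼- small) bb≽0)) (0≼* 0≼η (∣_∣≼_.lower ∣DS∣)))
                 (certificate (ι n) (a ∙ b) (b ∙ b) S 0q Dab))

    steps : ∀ k {x η y a b} → s ≼ x → 0q ≼ η → x + ι k * η ≼ t → η * (C * (C * ι n)) ≼ d * d →
            Solves x y a → Solves (x + ι k * η) y b → y ∙ b ≼ y ∙ a
    steps zero {x} {η} {y} {a} {b} s≼x 0≼η _ _ xa xb = ≼-by ≼-refl (trans (exchange {x} {x + 0q * η} xa xb) (solve 3 (λ x η s → (x :+ κ 0 :* η :- x) :* s := κ 0) refl x η (a ∙ b)))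
    steps (suc k) {x} {η} {y} {a} {b} s≼x 0≼η end≼t small xa xb =
      ≼-trans (steps k {x + η} s≼x+η 0≼η (subst (_≼ t) (sym end) end≼t) small (proj₂ c) (subst (λ e → Solves e y b) (sym end) xb))
              (short-step s≼x (≼-trans (≼-by 0≼η (solve 2 (λ x η → x :+ η :- x := η) refl x η)) x+η≼t) 0≼η small xa (proj₂ c))
      where
      end : x + η + ι k * η ≡ x + ι (suc k) * η
      end = trans (solve 3 (λ x η s → x :+ η :+ s :* η := x :+ (κ 1 :+ s) :* η) refl x η (ι k)) (cong (λ z → x + z * η) (sym (ι-suc k)))
      s≼x+η : s ≼ x + η
      s≼x+η = ≼-trans s≼x (≼-by 0≼η (solve 2 (λ x η → x :+ η :- x := η) refl x η))
      x+η≼t : x + η ≼ t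
      x+η≼t = ≼-trans (≼-by (0≼* (0≼ι k) 0≼η) (solve 3 (λ x η s → x :+ η :+ s :* η :- (x :+ η) := s :* η) refl x η (ι k))) (subst (_≼ t) (sym end) end≼t)
      c = solution (shift M (x + η)) (det≢0 (x + η) s≼x+η x+η≼t) y

    -- y ∙ (M + x)⁻¹ y decreases in x as long as M + x stays invertible.
    resolvent-decreasing : ∀ {y a b} → s ≼ t → Solves s y a → Solves t y b → y ∙ b ≼ y ∙ a
    resolvent-decreasing {y} {a} {b} s≼t sa tb = go (inverse-pos (0≺* 0≺d 0≺d))
      where
      W = C * (C * ι n)
      go : Σ Q (λ e → 0q ≺ e × d * d * e ≡ 1q) → y ∙ b ≼ y ∙ a
      go (e , 0≺e , dde≡1) = with-N (archimedean ((t - s) * W * e))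
       where
       with-r : ∀ N → (t - s) * W * e ≼ ι N → Σ Q (λ r → 0q ≺ r × ι (suc N) * r ≡ 1q) → y ∙ b ≼ y ∙ a
       with-r N le (r , 0≺r , Nr≡1) = steps (suc N) {s} {η} ≼-refl 0≼η (≼-reflexive end) small sa (subst (λ z → Solves z y b) (sym end) tb)
        where
        -- Here r is 1 / (N + 1) and e is 1 / d²: the interval is cut into N + 1 equal steps, and N
        -- ≥ (t - s) W / d² makes each of them short enough.
        η = (t - s) * r
        0≼η = 0≼* (≼⇒0≼- s≼t) (≺⇒≼ 0≺r)
        end : s + ι (suc N) * η ≡ t
        end = trans {j = s + (t - s) * (ι (suc N) * r)} (regroup (ι (suc N))) (trans (cong (λ z → s + (t - s) * z) Nr≡1) (solve 2 (λ s t → s :+ (t :- s) :* κ 1 := t) refl s t))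
          where
          regroup = λ m → solve 4 (λ s m t r → s :+ m :* ((t :- s) :* r) := s :+ (t :- s) :* (m :* r)) refl s m t r
        le′ : (t - s) * W * e ≼ ι (suc N)
        le′ = ≼-trans le (subst (ι N ≼_) (sym (ι-suc N)) (≼-by (0≼ι 1) (solve 1 (λ s → κ 1 :+ s :- s := κ 1) refl (ι N))))
        small : η * W ≼ d * d
        small = ≼-by (0≼* (0≼* (0≼* (≺⇒≼ 0≺d) (≺⇒≼ 0≺d)) (≺⇒≼ 0≺r)) (≼⇒0≼- le′)) (identity (ι (suc N)) Nr≡1 dde≡1)
          where
          identity : ∀ m → m * r ≡ 1q → d * d * e ≡ 1q → d * d - (t - s) * r * W ≡ d * d * r * (m - (t - s) * W * e)
          identity m p q = sym (trans (solve 7 (λ d r m t s W e → d :* d :* r :* (m :- (t :- s) :* W :* e) := d :* d :* (m :* r) :- (t :- s) :* r :* W :* (d :* d :* e)) refl d r m t s W e)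
              (trans (cong₂ (λ x z → d * d * x - (t - s) * r * W * z) p q) (solve 5 (λ d t s r W → d :* d :* κ 1 :- (t :- s) :* r :* W :* κ 1 := d :* d :- (t :- s) :* r :* W) refl d t s r W)))

       with-N : Σ ℕ (λ N → (t - s) * W * e ≼ ι N) → y ∙ b ≼ y ∙ a
       with-N (N , le) = with-r N le (inverse-pos (0≺ι-suc N))

-- Negative definite planes along the pencil

scaled-square-bound : ∀ {n} {p q ε : Q} (z : Vector n) v → z v ≢ 0q → (∀ i → z i * z i ≼ z v * z v) →
  0q ≼ ε → 0q ≼ q → p * (z v * z v) ≼ ε * (z ∙ z) * q → p ≼ ε * ι n * q
scaled-square-bound {n} {p} {q} {ε} z v zv≢0 max 0≼ε 0≼q le =
  ≼-cancel (0≺sq zv≢0) (≼-by (0≼+ (≼⇒0≼- le) (0≼* (0≼* 0≼ε 0≼q) (≼⇒0≼- (norm-≼-largest z v max)))) (certificate (z v * z v) (z ∙ z) (ι n)))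
  where
  certificate = λ s t m → solve 6 (λ s ε m q p t → s :* (ε :* m :* q) :- s :* p := ε :* t :* q :- p :* s :+ ε :* q :* (m :* s :- t)) refl s ε m q p t

-- Quantifying over all nonzero coefficient pairs includes the independence of the two vectors, as
-- the form is 0 at the zero vector.
NegativeOn : ∀ {n} → Matrix n → Vector n → Vector n → Set
NegativeOn {n} A w₁ w₂ = ∀ a b → a ≢ 0q ⊎ b ≢ 0q → w a b ∙ A ⊛ w a b ≺ 0q
  where
  w : Q → Q → Vector n
  w a b i = a * w₁ i + b * w₂ i

-- The quantitative core. Nothing is assumed between t₀ and t₁, where an eigenvalue may cross 0:
-- monotonicity is applied on either side, and across the gap only the growth of the form by t₁ - t₀
-- times the squared norm is used.
module NegativePlane {n} {M : Matrix n} (M-sym : Symmetric M) (M≼1 : ∀ i j → ∣ M i j ∣≼ 1q)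
  {x₀ t₀ t₁ U d₀ d₁ B C : Q} (x₀≼t₀ : x₀ ≼ t₀) (t₀≼t₁ : t₀ ≼ t₁) (t₁≼U : t₁ ≼ U) (n≼U : ι n ≼ U)
  (1≼B : 1q ≼ B) (0≼C : 0q ≼ C) (det≼C : ∀ {A : Matrix n} → (∀ i j → ∣ A i j ∣≼ B) → ∣ det A ∣≼ C)
  (entries : ∀ x → x₀ ≼ x → x ≼ U → ∀ i j → ∣ shift M x i j ∣≼ B) (0≺d₀ : 0q ≺ d₀) (0≺d₁ : 0q ≺ d₁)
  (gap₀ : ∀ x → x₀ ≼ x → x ≼ t₀ → d₀ * d₀ ≼ det (shift M x) * det (shift M x))
  (gap₁ : ∀ x → t₁ ≼ x → x ≼ U → d₁ * d₁ ≼ det (shift M x) * det (shift M x))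
  (0≺D : 0q ≺ det (shift M t₁))
  {w₁ w₂ : Vector n} (negative : NegativeOn (shift M x₀) w₁ w₂)
  where

  open Pencil M-sym

  private
    t₀≼U = ≼-trans t₀≼t₁ t₁≼U
    x₀≼t₁ = ≼-trans x₀≼t₀ t₀≼t₁

    module Lower = Interval {x₀} {t₀} {d₀} {B} {C} 1≼B 0≼C det≼C 0≺d₀ (λ x a b → entries x a (≼-trans b t₀≼U)) gap₀
    module Upper = Interval {t₁} {U} {d₁} {B} {C} 1≼B 0≼C det≼C 0≺d₁ (λ x a b → entries x (≼-trans x₀≼t₁ a) b) gap₁

    dominant : ∀ b → 0q ≼ b ∙ shift M U ⊛ b
    dominant b = 0≼-resp (0≼+ (∣_∣≼_.lower (quadratic-form-bound M≼1 b)) (0≼* (≼⇒0≼- n≼U) (∙-self-≽0 b))) (begin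
      1q * (ι n * (b ∙ b)) + b ∙ M ⊛ b + (U - ι n) * (b ∙ b) ≡⟨ collect (ι n) (b ∙ b) (b ∙ M ⊛ b) ⟩
      1q * (b ∙ M ⊛ b) + U * (b ∙ b) ≡⟨ ∙-linearʳ 1q U b (M ⊛ b) b ⟨
      b ∙ (λ i → 1q * (M ⊛ b) i + U * b i) ≡⟨ ∙-cong (λ _ → refl) (λ i → trans (cong (_+ U * b i) (*-identityˡ _)) (sym (shift-apply U b i))) ⟩
      b ∙ shift M U ⊛ b                                       ∎)
      where
      collect = λ m s t → solve 4 (λ m s t U → κ 1 :* (m :* s) :+ t :+ (U :- m) :* s := κ 1 :* t :+ U :* s) refl m s t U

    -- Monotonicity read downwards from U. With y = (M + t₁) v, the value of y ∙ (M + x)⁻¹ y at x =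
    -- t₁ is v ∙ (M + t₁) v, and it is at least the value at U, which is nonnegative by `dominant`.
    psd : ∀ v → 0q ≼ v ∙ shift M t₁ ⊛ v
    psd v = ≼-trans (0≼-resp (dominant b) (trans (∙-comm b (shift M U ⊛ b)) (∙-cong {v = b} b-solves (λ _ → refl))))
      (≼-trans (Upper.resolvent-decreasing t₁≼U (λ _ → refl) b-solves) (≼-reflexive (∙-comm (shift M t₁ ⊛ v) v)))
      where
      solved = solution (shift M U) (Upper.det≢0 U t₁≼U ≼-refl) (shift M t₁ ⊛ v)
      b = proj₁ solved
      b-solves = proj₂ solved

    ε : Q
    ε = t₁ - t₀

    0≼ε : 0q ≼ ε
    0≼ε = ≼⇒0≼- t₀≼t₁

  -- z₁, z₂ span the plane on which M + t₀ is still negative definite.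
  module _ (z₁ z₂ : Vector n) (z₁-solves : Solves t₀ (shift M x₀ ⊛ w₁) z₁) (z₂-solves : Solves t₀ (shift M x₀ ⊛ w₂) z₂) where

    private
      z : Q → Q → Vector n
      z a b i = a * z₁ i + b * z₂ i

    -- The image vectors y = (M + x₀) w are held fixed while w moves to z = (M + t₀)⁻¹ y. Both
    -- quadratic forms are then values of y ∙ (M + x)⁻¹ y, which only decreases.
    negative-at-t₀ : ∀ a b → a ≢ 0q ⊎ b ≢ 0q → z a b ∙ shift M t₀ ⊛ z a b ≺ 0q
    negative-at-t₀ a b ab≢0 = ≼-≺-trans (≼-trans (≼-reflexive zAz) (≼-trans (Lower.resolvent-decreasing {y} {w} {z a b} x₀≼t₀ w-solves z-solves) (≼-reflexive wAw))) (negative a b ab≢0)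
      where
      y₁ = shift M x₀ ⊛ w₁
      y₂ = shift M x₀ ⊛ w₂
      w y : Vector n
      w i = a * w₁ i + b * w₂ i
      y i = a * y₁ i + b * y₂ i
      w-solves : Solves x₀ y w
      w-solves i = ∙-linearʳ a b (shift M x₀ i) w₁ w₂
      z-solves : Solves t₀ y (z a b)
      z-solves i = trans (∙-linearʳ a b (shift M t₀ i) z₁ z₂) (cong₂ (λ p q → a * p + b * q) (z₁-solves i) (z₂-solves i))
      zAz : z a b ∙ shift M t₀ ⊛ z a b ≡ y ∙ z a b
      zAz = trans (∙-comm (z a b) (shift M t₀ ⊛ z a b)) (∙-cong {v = z a b} z-solves (λ _ → refl))
      wAw : y ∙ w ≡ w ∙ shift M x₀ ⊛ w
      wAw = trans (∙-comm y w) (∙-cong {u = w} (λ _ → refl) (λ i → sym (w-solves i)))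

    small-at-t₁ : ∀ a b → a ≢ 0q ⊎ b ≢ 0q → ∀ {m} → 0q ≼ m → (z a b ∙ shift M t₁ ⊛ z a b) * m ≼ ε * (z a b ∙ z a b) * m
    small-at-t₁ a b ab≢0 0≼m = *-mono-≼ 0≼m (0≼* 0≼ε (∙-self-≽0 (z a b)))
      (≼-by (≺⇒≼ (≺⇒0≺- (negative-at-t₀ a b ab≢0)))
        (trans (cong (λ q → ε * (z a b ∙ z a b) - q) (shift-quadratic t₀ t₁ (z a b))) (identity (z a b ∙ z a b) (z a b ∙ shift M t₀ ⊛ z a b)))) ≼-refl
      where
      identity = λ s q → solve 4 (λ t₁ t₀ s q → (t₁ :- t₀) :* s :- (q :+ (t₁ :- t₀) :* s) := κ 0 :- q) refl t₁ t₀ s q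

    large : ∀ a b → a ≢ 0q ⊎ b ≢ 0q → Σ (Fin n) λ v → z a b v ≢ 0q × (∀ i → z a b i * z a b i ≼ z a b v * z a b v)
    large a b ab≢0 = [ (λ z≡0 → contradiction (sym (∑-0 (λ i → trans (cong (_* (shift M t₀ ⊛ z a b) i) (z≡0 i)) (*-zeroˡ _))))
        (λ eq → proj₂ (negative-at-t₀ a b ab≢0) (sym eq))) , id ]′ (largest-coordinate (z a b))

    -- Two vectors of the plane each save one factor of order ε: `z₁` bounds the determinant by ε n
    -- times the principal minor at its largest coordinate v, and a combination vanishing at v
    -- bounds that minor by ε n C.
    det-≼′ : det (shift M t₁) ≼ ε * ι n * (ε * ι n * C)
    det-≼′ = go (large 1q 0q (inj₁ 1≢0))
      where
      A = shift M t₁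
      go : Σ (Fin n) (λ v → z 1q 0q v ≢ 0q × (∀ i → z 1q 0q i * z 1q 0q i ≼ z 1q 0q v * z 1q 0q v)) → det A ≼ ε * ι n * (ε * ι n * C)
      go (v , zv≢0 , max) = ≼-trans D≼ (*-mono-≼ 0≼m (0≼* 0≼ε (0≼ι n)) ≼-refl (m≼ (large (z₂ v) (- z₁ v) (inj₂ z₁v≢0))))
        where
        m = adjugate A v v
        0≼m : 0q ≼ m
        0≼m = adjugate-diagonal-≽0 (shift-sym t₁) psd 0≺D v
        D≼ : det A ≼ ε * ι n * m
        D≼ = scaled-square-bound (z 1q 0q) v zv≢0 max 0≼ε 0≼m
          (≼-trans (det-coordinate (shift-sym t₁) psd 0≺D (z 1q 0q) v) (small-at-t₁ 1q 0q (inj₁ 1≢0) 0≼m))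
        z₁v≢0 : - z₁ v ≢ 0q
        z₁v≢0 eq = zv≢0 (trans (unfold (z₁ v) (z₂ v)) (trans (cong -_ eq) (solve 0 (:- κ 0 := κ 0) refl)))
          where
          unfold = solve 2 (λ a b → κ 1 :* a :+ κ 0 :* b := :- (:- a)) refl
        -- The vector of the plane with coordinate v equal to 0; its second coefficient is nonzero
        -- because v was the largest coordinate of `z₁`.
        z′ = z (z₂ v) (- z₁ v)
        z′v≡0 : z′ v ≡ 0q
        z′v≡0 = cancel (z₁ v) (z₂ v)
          where
          cancel = solve 2 (λ a b → b :* a :+ :- a :* b := κ 0) refl
        m≼ : Σ (Fin n) (λ w → z′ w ≢ 0q × (∀ i → z′ i * z′ i ≼ z′ w * z′ w)) → m ≼ ε * ι n * C
        m≼ (w , z′w≢0 , max′) = scaled-square-bound z′ w z′w≢0 max′ 0≼ε 0≼C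
          (≼-trans (adjugate-coordinate (shift-sym t₁) psd z′ v w z′v≡0 (λ { refl → z′w≢0 z′v≡0 }) 0≼C 0≼m
                     (det≼C (∣[≔]∣≼ 1≼B (∣[≔]∣≼ 1≼B (entries t₁ x₀≼t₁ t₁≼U) v v) w w)))
                   (small-at-t₁ (z₂ v) (- z₁ v) (inj₂ z₁v≢0) 0≼C))

  det-≼ : det (shift M t₁) ≼ (t₁ - t₀) * ι n * ((t₁ - t₀) * ι n * C)
  det-≼ = det-≼′ (proj₁ s₁) (proj₁ s₂) (proj₂ s₁) (proj₂ s₂)
    where
    s₁ = solution (shift M t₀) (Lower.det≢0 t₀ x₀≼t₀ ≼-refl) (shift M x₀ ⊛ w₁)
    s₂ = solution (shift M t₀) (Lower.det≢0 t₀ x₀≼t₀ ≼-refl) (shift M x₀ ⊛ w₂)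

small-step : ∀ {c E} → 0q ≺ c → 0q ≼ E → Σ Q λ e → 0q ≺ e × 0q ≼ 1q - ι 2 * e × e * E ≺ c
small-step {c} {E} 0≺c 0≼E = go (inverse-pos 0≺P)
  where
  0≺P : 0q ≺ ι 2 * (E + c)
  0≺P = 0≺* (0≺ι-suc 1) (0≼+≻0 0≼E 0≺c)
  0≺Q : 0q ≺ E + ι 2 * c
  0≺Q = 0≼+≻0 0≼E (0≺* (0≺ι-suc 1) 0≺c)
  identity : ∀ E c p → ι 2 * (E + c) * p ≡ 1q → E * (ι 2 * p) ≡ 1q - ι 2 * (c * p)
  identity E c p eq = trans (solve 3 (λ E p c → E :* (κ 2 :* p) := κ 2 :* (E :+ c) :* p :- κ 2 :* (c :* p)) refl E p c) (cong (λ z → z - ι 2 * (c * p)) eq)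
  identity′ : ∀ E c p → ι 2 * (E + c) * p ≡ 1q → c - c * p * E ≡ c * (E + ι 2 * c) * p
  identity′ E c p eq = trans (solve 3 (λ c p E → c :- c :* p :* E := c :* κ 1 :- c :* p :* E) refl c p E) (trans (cong (λ z → c * z - c * p * E) (sym eq)) (solve 3 (λ c E p → c :* (κ 2 :* (E :+ c) :* p) :- c :* p :* E := c :* (E :+ κ 2 :* c) :* p) refl c E p))
  go : (Σ Q λ p → 0q ≺ p × ι 2 * (E + c) * p ≡ 1q) → Σ Q λ e → 0q ≺ e × 0q ≼ 1q - ι 2 * e × e * E ≺ c
  -- The choice e = c / (2 (E + c)) gives 1 - 2 e = E / (E + c) and keeps e E below c.
  go (p , 0≺p , Pp≡1) = c * p , 0≺* 0≺c 0≺p , first , second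
    where
    first : 0q ≼ 1q - ι 2 * (c * p)
    first = 0≼-resp (0≼* 0≼E (0≼* (0≼ι 2) (≺⇒≼ 0≺p))) (identity E c p Pp≡1)
    second : c * p * E ≺ c
    second = ≺-by (0≺* (0≺* 0≺c 0≺Q) 0≺p) (identity′ E c p Pp≡1)

-- If det (M + x) passes through 0 between x₀ and n only once and with positive speed (relative to f₀),
-- then M + x₀ has at most one negative eigenvalue. Just beyond the crossing M + t₁ is positive
-- definite, so a negative definite plane of M + x₀ would survive up to t₀ and M + t₁ would be of size
-- O(e) on it, forcing det (M + t₁) = O(e²), whereas the speed makes it at least of order e.
module _ {n} {M : Matrix n} (M-sym : Symmetric M) (M≼1 : ∀ i j → ∣ M i j ∣≼ 1q)
  {f₀ : Q → Q} {x₀ ρ : Q} (0≼x₀ : 0q ≼ x₀) (0≺ρ : 0q ≺ ρ) (x₀≼n : x₀ ≼ ι n)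
  (f₀-pos : ∀ {x} → x₀ ≼ x → 0q ≺ f₀ x)
  (f₀-mono : ∀ {x y} → x₀ ≼ x → x ≼ y → f₀ x ≼ f₀ y)
  (speed : ∀ {x y} → x₀ ≼ x → x ≼ y → y ≼ ι n + 1q →
           ρ * (y - x) ≼ det (shift M y) * f₀ x - det (shift M x) * f₀ y)
  (f-x₀ : det (shift M x₀) ≺ 0q) (f-n : 0q ≼ det (shift M (ι n)))
  where

  open Pencil M-sym

  private
    f : Q → Q
    f x = det (shift M x)

    U B : Q
    -- The unit beyond n leaves room for t₁ = t₀ + 2 e when t₀ ≤ n and 2 e ≤ 1.
    U = ι n + 1q
    B = 1q + U * 1q

    n≼U : ι n ≼ U
    n≼U = ≼-by (0≼ι 1) (solve 1 (λ s → s :+ κ 1 :- s := κ 1) refl (ι n))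

    x₀≼U : x₀ ≼ U
    x₀≼U = ≼-trans x₀≼n n≼U

    0≼U : 0q ≼ U
    0≼U = ≼-trans 0≼x₀ x₀≼U

    1≼B : 1q ≼ B
    1≼B = ≼-by 0≼U (solve 1 (λ s → κ 1 :+ (s :+ κ 1) :* κ 1 :- κ 1 := s :+ κ 1) refl (ι n))

    entries : ∀ x → x₀ ≼ x → x ≼ U → ∀ i j → ∣ shift M x i j ∣≼ B
    entries x x₀≼x x≼U i j = ∣+∣≼ (M≼1 i j) (∣*∣≼ (bounds (0≼+ 0≼U (≼-trans 0≼x₀ x₀≼x)) (≼⇒0≼- x≼U)) (∣δ∣≼1 i j))

    bound = det-bound n (≼-trans (0≼ι 1) 1≼B)
    C = proj₁ bound
    0≼C = proj₁ (proj₂ bound)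
    det≼C = proj₂ (proj₂ bound)

    f-beyond-n : ∀ x → ι n ≼ x → x ≼ U → 0q ≼ f x
    f-beyond-n x n≼x x≼U = 0≼-cancel (f₀-pos x₀≼n)
      (0≼-resp (0≼+ (≼⇒0≼- (speed x₀≼n n≼x x≼U)) (0≼+ (0≼* (≺⇒≼ 0≺ρ) (≼⇒0≼- n≼x)) (0≼* f-n (≺⇒≼ (f₀-pos (≼-trans x₀≼n n≼x))))))
        (certificate (f x) (f₀ (ι n)) (f (ι n)) (f₀ x) (ρ * (x - ι n))))
      where
      certificate = solve 5 (λ a b c d k → a :* b :- c :* d :- k :+ (k :+ c :* d) := b :* a) refl

    -- A discrete intermediate value theorem: walk from a negative value in steps of e. The number k
    -- of steps left suffices to reach n, beyond which f is nonnegative, so a change of sign must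
    -- occur on the way.
    sign-change : ∀ {e} → 0q ≼ e → e ≼ 1q → ∀ k x → x₀ ≼ x → x ≼ ι n → f x ≺ 0q → ι n ≼ x + ι k * e →
                  Σ Q λ t → x₀ ≼ t × t ≼ ι n × f t ≺ 0q × 0q ≼ f (t + e)
    sign-change {e} 0≼e e≼1 zero x x₀≼x x≼n fx≺0 n≼x+0 =
      contradiction (f-beyond-n x (≼-trans n≼x+0 (≼-reflexive (solve 2 (λ x e → x :+ κ 0 :* e := x) refl x e))) (≼-trans x≼n n≼U)) (≺⇒⋡ fx≺0)
    sign-change {e} 0≼e e≼1 (suc k) x x₀≼x x≼n fx≺0 n≼end with ≼⊎≻ 0q (f (x + e))
    ... | inj₁ 0≼fx+e = x , x₀≼x , x≼n , fx≺0 , 0≼fx+e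
    ... | inj₂ fx+e≺0 with ≼⊎≻ (x + e) (ι n)
    ...   | inj₁ x+e≼n = sign-change 0≼e e≼1 k (x + e) (≼-trans x₀≼x (≼-by 0≼e (solve 2 (λ x e → x :+ e :- x := e) refl x e))) x+e≼n fx+e≺0
        (≼-trans n≼end (≼-reflexive (trans (cong (λ z → x + z * e) (ι-suc k)) (solve 3 (λ x s e → x :+ (κ 1 :+ s) :* e := x :+ e :+ s :* e) refl x (ι k) e))))
    ...   | inj₂ n≺x+e = contradiction (f-beyond-n (x + e) (≺⇒≼ n≺x+e) (+-mono-≼ x≼n e≼1)) (≺⇒⋡ fx+e≺0)

    -- As f / f₀ increases, - f x ≥ - f t₀ · f₀ x / f₀ t₀ for x up to t₀, and f₀ x is at least f₀
    -- x₀; this is the constant d.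
    below : ∀ {t₀} → x₀ ≼ t₀ → t₀ ≼ U → f t₀ ≺ 0q → Σ Q λ d → 0q ≺ d × (∀ x → x₀ ≼ x → x ≼ t₀ → d * d ≼ f x * f x)
    below {t₀} x₀≼t₀ t₀≼U f-t₀ with inverse-pos (f₀-pos x₀≼t₀)
    ... | r , 0≺r , f₀r≡1 = d , 0≺d , gap
      where
      d : Q
      d = (0q - f t₀) * f₀ x₀ * r
      0≺d : 0q ≺ d
      0≺d = 0≺* (0≺* (≺⇒0≺- f-t₀) (f₀-pos ≼-refl)) 0≺r
      squares = solve 2 (λ d y → y :* y :- d :* d := (:- y :- d) :* (:- y :- d :+ κ 2 :* d)) refl
      certificate : ∀ a b g h r k y → b * r ≡ 1q → y * g - a * b - k + (k + (0q - y) * (g - h)) ≡ b * (- a - (0q - y) * h * r)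
      certificate a b g h r k y eq = sym (trans (solve 5 (λ b a y h r → b :* (:- a :- (κ 0 :- y) :* h :* r) := b :* :- a :- (κ 0 :- y) :* h :* (b :* r)) refl b a y h r) (trans (cong (λ z → b * - a - (0q - y) * h * z) eq) (solve 6 (λ b a y h g k → b :* :- a :- (κ 0 :- y) :* h :* κ 1 := y :* g :- a :* b :- k :+ (k :+ (κ 0 :- y) :* (g :- h))) refl b a y h g k)))
      gap : ∀ x → x₀ ≼ x → x ≼ t₀ → d * d ≼ f x * f x
      gap x x₀≼x x≼t₀ = ≼-by (0≼* fx≼-d (0≼+ fx≼-d (0≼* (0≼ι 2) (≺⇒≼ 0≺d)))) (squares d (f x))
        where
        fx≼-d : 0q ≼ - f x - d
        fx≼-d = 0≼-cancel (f₀-pos x₀≼t₀) (0≼-resp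
          (0≼+ (≼⇒0≼- (speed x₀≼x x≼t₀ t₀≼U)) (0≼+ (0≼* (≺⇒≼ 0≺ρ) (≼⇒0≼- x≼t₀)) (0≼* (≼⇒0≼- (≺⇒≼ f-t₀)) (≼⇒0≼- (f₀-mono ≼-refl x₀≼x)))))
          (certificate (f x) (f₀ t₀) (f₀ x) (f₀ x₀) r (ρ * (t₀ - x)) (f t₀) f₀r≡1))

    -- From the nonnegative value at τ the speed gives f x · f₀ τ ≥ ρ e once x ≥ τ + e. With ρ = c
    -- f₀ U and f₀ τ ≤ f₀ U this becomes f x ≥ c e.
    above : ∀ {c e τ} → 0q ≺ c → c * f₀ U ≡ ρ → 0q ≼ e → x₀ ≼ τ → 0q ≼ f τ → ∀ x → τ + e ≼ x → x ≼ U → 0q ≼ f x - c * e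
    above {c} {e} {τ} 0≺c c-def 0≼e x₀≼τ f-τ x τ+e≼x x≼U = 0≼-cancel (f₀-pos x₀≼τ) (0≼-resp
        (0≼+ (≼⇒0≼- (speed x₀≼τ τ≼x x≼U))
          (0≼+ (0≼+ (0≼* (≺⇒≼ 0≺ρ) (≼⇒0≼- τ+e≼x)) (0≼* f-τ (≺⇒≼ (f₀-pos (≼-trans x₀≼τ τ≼x)))))
               (0≼* (0≼* (≺⇒≼ 0≺c) 0≼e) (≼⇒0≼- (f₀-mono x₀≼τ (≼-trans τ≼x x≼U))))))
        (certificate (f x) (f₀ τ) (f τ) (f₀ x) (f₀ U) ρ c e τ x c-def))
      where
      τ≼x : τ ≼ x
      τ≼x = ≼-trans (≼-by 0≼e (add τ e)) τ+e≼x
        where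
        add = solve 2 (λ a b → a :+ b :- a := b) refl
      certificate : ∀ a b y g u ρ c e τ x → c * u ≡ ρ →
        a * b - y * g - ρ * (x - τ) + (ρ * (x - (τ + e)) + y * g + c * e * (u - b)) ≡ b * (a - c * e)
      certificate a b y g u ρ c e τ x eq = trans (solve 10 (λ a b y g ρ x τ e c u → a :* b :- y :* g :- ρ :* (x :- τ) :+ (ρ :* (x :- (τ :+ e)) :+ y :* g :+ c :* e :* (u :- b)) := a :* b :- ρ :* e :+ e :* (c :* u) :- c :* e :* b) refl a b y g ρ x τ e c u)
        (trans (cong (λ z → a * b - ρ * e + e * z - c * e * b) eq) (solve 5 (λ a b ρ e c → a :* b :- ρ :* e :+ e :* ρ :- c :* e :* b := b :* (a :- c :* e)) refl a b ρ e c))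

  no-negative-plane : (w₁ w₂ : Vector n) → NegativeOn (shift M x₀) w₁ w₂ → ⊥
  no-negative-plane w₁ w₂ negative = with-c (inverse-pos (f₀-pos x₀≼U))
    where
    E : Q
    -- Chosen so that the bound of `det-≼` reads e² E; the 4 comes from t₁ - t₀ = 2 e.
    E = ι 4 * (ι n * ι n) * C
    0≼E : 0q ≼ E
    0≼E = 0≼* (0≼* (0≼ι 4) (0≼* (0≼ι n) (0≼ι n))) 0≼C

    square-gap = solve 2 (λ d y → y :* y :- d :* d := (y :- d) :* (y :- d :+ κ 2 :* d)) refl

    conclude : ∀ {c e t₀} → 0q ≺ c → c * f₀ U ≡ ρ → 0q ≺ e → 0q ≼ 1q - ι 2 * e → e * E ≺ c →
               x₀ ≼ t₀ → t₀ ≼ ι n → f t₀ ≺ 0q → 0q ≼ f (t₀ + e) → ⊥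
    conclude {c} {e} {t₀} 0≺c c-def 0≺e e+e≼1 eE≺c x₀≼t₀ t₀≼n f-t₀ f-τ = lower (below x₀≼t₀ t₀≼U f-t₀)
      where
      τ t₁ : Q
      τ = t₀ + e
      t₁ = τ + e
      0≼e = ≺⇒≼ 0≺e
      t₀≼U = ≼-trans t₀≼n n≼U
      add = solve 2 (λ a b → a :+ b :- a := b) refl
      t₀≼τ : t₀ ≼ τ
      t₀≼τ = ≼-by 0≼e (add t₀ e)
      τ≼t₁ : τ ≼ t₁
      τ≼t₁ = ≼-by 0≼e (add τ e)
      t₁≼U : t₁ ≼ U
      t₁≼U = ≼-by (0≼+ (≼⇒0≼- t₀≼n) e+e≼1) (identity t₀ e (ι n))
        where
        identity = solve 3 (λ t e m → m :+ κ 1 :- (t :+ e :+ e) := m :- t :+ (κ 1 :- κ 2 :* e)) refl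
      upper : ∀ x → t₁ ≼ x → x ≼ U → 0q ≼ f x - c * e
      upper = above 0≺c c-def 0≼e (≼-trans x₀≼t₀ t₀≼τ) f-τ
      0≺ce = 0≺* 0≺c 0≺e
      certificate = solve 6 (λ D c e t m C → D :- c :* e :+ ((t :+ e :+ e :- t) :* m :* ((t :+ e :+ e :- t) :* m :* C) :- D) := e :* (e :* (κ 4 :* (m :* m) :* C) :- c)) refl
      lower : Σ Q (λ d → 0q ≺ d × (∀ x → x₀ ≼ x → x ≼ t₀ → d * d ≼ f x * f x)) → ⊥
      lower (d , 0≺d , gap) = ≺⇒⋡ eE≺c (≼-by (0≼-cancel 0≺e (0≼-resp (0≼+ (upper t₁ ≼-refl t₁≼U) (≼⇒0≼- plane)) (certificate (f t₁) c e t₀ (ι n) C))) refl)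
        where
        plane : f t₁ ≼ (t₁ - t₀) * ι n * ((t₁ - t₀) * ι n * C)
        plane = NegativePlane.det-≼ M-sym M≼1 x₀≼t₀ (≼-trans t₀≼τ τ≼t₁) t₁≼U n≼U 1≼B 0≼C det≼C entries 0≺d 0≺ce gap
          (λ x a b → ≼-by (0≼* (upper x a b) (0≼+ (upper x a b) (0≼* (0≼ι 2) (≺⇒≼ 0≺ce)))) (square-gap (c * e) (f x)))
          (≺-≼-trans 0≺ce (≼-by (upper t₁ ≼-refl t₁≼U) refl)) negative

    with-e : ∀ {c} → 0q ≺ c → c * f₀ U ≡ ρ → (Σ Q λ e → 0q ≺ e × 0q ≼ 1q - ι 2 * e × e * E ≺ c) → ⊥
    with-e {c} 0≺c c-def (e , 0≺e , e+e≼1 , eE≺c) = with-r (inverse-pos 0≺e)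
      where
      one-minus = solve 1 (λ e → κ 1 :- e := κ 1 :- κ 2 :* e :+ e) refl

      reach : ∀ m e r k → e * r ≡ 1q → x₀ + k * e - m ≡ e * (k - (m - x₀) * r)
      reach m e r k eq = sym (trans (solve 5 (λ e k m x r → e :* (k :- (m :- x) :* r) := e :* k :- (m :- x) :* (e :* r)) refl e k m x₀ r)
        (trans (cong (λ z → e * k - (m - x₀) * z) eq) (solve 4 (λ e k m x → e :* k :- (m :- x) :* κ 1 := x :+ k :* e :- m) refl e k m x₀)))

      with-t : (Σ Q λ t → x₀ ≼ t × t ≼ ι n × f t ≺ 0q × 0q ≼ f (t + e)) → ⊥
      with-t (t₀ , x₀≼t₀ , t₀≼n , f-t₀ , f-τ) = conclude 0≺c c-def 0≺e e+e≼1 eE≺c x₀≼t₀ t₀≼n f-t₀ f-τ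

      with-k : ∀ r → e * r ≡ 1q → (Σ ℕ λ k → (ι n - x₀) * r ≼ ι k) → ⊥
      with-k r er≡1 (k , le) = with-t (sign-change (≺⇒≼ 0≺e) (≼-by (0≼+ e+e≼1 (≺⇒≼ 0≺e)) (one-minus e)) k x₀ ≼-refl x₀≼n f-x₀
        (≼-by (0≼* (≺⇒≼ 0≺e) (≼⇒0≼- le)) (reach (ι n) e r (ι k) er≡1)))

      with-r : (Σ Q λ r → 0q ≺ r × e * r ≡ 1q) → ⊥
      with-r (r , _ , er≡1) = with-k r er≡1 (archimedean ((ι n - x₀) * r))

    with-c : (Σ Q λ r → 0q ≺ r × f₀ U * r ≡ 1q) → ⊥
    with-c (r , 0≺r , f₀r≡1) = with-e 0≺ρr (trans (rotate ρ r (f₀ U)) (trans (cong (ρ *_) f₀r≡1) (trans (*-comm ρ 1q) (*-identityˡ ρ)))) (small-step 0≺ρr 0≼E)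
      where
      0≺ρr = 0≺* 0≺ρ 0≺r
      rotate = solve 3 (λ a b c → a :* b :* c := a :* (c :* b)) refl

-- Polynomial functions

ev : List Q → Q → Q
ev []      x = 0q
ev (a ∷ c) x = a + x * ev c x

Polynomial : (Q → Q) → Set
Polynomial f = Σ (List Q) λ c → ∀ x → f x ≡ ev c x

const-polynomial : ∀ a → Polynomial (λ _ → a)
const-polynomial a = a ∷ [] , λ x → (solve 2 (λ a x → a := a :+ x :* κ 0) refl a x)

var-polynomial : Polynomial (λ x → x)
var-polynomial = 0q ∷ 1q ∷ [] , λ x → (solve 1 (λ x → x := κ 0 :+ x :* (κ 1 :+ x :* κ 0)) refl x)

addᵖ : List Q → List Q → List Q
addᵖ []      d       = d
addᵖ c       []      = c
addᵖ (a ∷ c) (b ∷ d) = a + b ∷ addᵖ c d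

ev-addᵖ : ∀ c d x → ev (addᵖ c d) x ≡ ev c x + ev d x
ev-addᵖ []      d       x = sym (+-identityˡ _)
ev-addᵖ (a ∷ c) []      x = trans (sym (+-identityˡ _)) (+-comm _ _)
ev-addᵖ (a ∷ c) (b ∷ d) x = trans (cong (λ e → a + b + x * e) (ev-addᵖ c d x)) (regroup a b x (ev c x) (ev d x))
  where
  regroup = solve 5 (λ a b x p q → a :+ b :+ x :* (p :+ q) := a :+ x :* p :+ (b :+ x :* q)) refl

scaleᵖ : Q → List Q → List Q
scaleᵖ s = List.map (s *_)

ev-scaleᵖ : ∀ s c x → ev (scaleᵖ s c) x ≡ s * ev c x
ev-scaleᵖ s []      x = trans (sym (*-zeroˡ s)) (*-comm 0q s)
ev-scaleᵖ s (a ∷ c) x = trans (cong (λ e → s * a + x * e) (ev-scaleᵖ s c x)) (regroup a x (ev c x))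
  where
  regroup = λ a x p → solve 4 (λ s a x p → s :* a :+ x :* (s :* p) := s :* (a :+ x :* p)) refl s a x p

mulᵖ : List Q → List Q → List Q
mulᵖ []      d = []
mulᵖ (a ∷ c) d = addᵖ (scaleᵖ a d) (0q ∷ mulᵖ c d)

ev-mulᵖ : ∀ c d x → ev (mulᵖ c d) x ≡ ev c x * ev d x
ev-mulᵖ []      d x = sym (*-zeroˡ _)
ev-mulᵖ (a ∷ c) d x = begin
  ev (addᵖ (scaleᵖ a d) (0q ∷ mulᵖ c d)) x ≡⟨ ev-addᵖ (scaleᵖ a d) (0q ∷ mulᵖ c d) x ⟩
  ev (scaleᵖ a d) x + (0q + x * ev (mulᵖ c d) x) ≡⟨ cong₂ (λ p q → p + (0q + x * q)) (ev-scaleᵖ a d x) (ev-mulᵖ c d x) ⟩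
  a * ev d x + (0q + x * (ev c x * ev d x)) ≡⟨ regroup (ev c x) (ev d x) ⟩
  (a + x * ev c x) * ev d x                           ∎
  where
  regroup = λ p q → solve 4 (λ a q x p → a :* q :+ (κ 0 :+ x :* (p :* q)) := (a :+ x :* p) :* q) refl a q x p

+-polynomial : ∀ {f g} → Polynomial f → Polynomial g → Polynomial (λ x → f x + g x)
+-polynomial (c , f≡) (d , g≡) = addᵖ c d , λ x → trans (cong₂ _+_ (f≡ x) (g≡ x)) (sym (ev-addᵖ c d x))

*-polynomial : ∀ {f g} → Polynomial f → Polynomial g → Polynomial (λ x → f x * g x)
*-polynomial (c , f≡) (d , g≡) = mulᵖ c d , λ x → trans (cong₂ _*_ (f≡ x) (g≡ x)) (sym (ev-mulᵖ c d x))


difference-polynomial : ∀ {f g} → Polynomial f → Polynomial g → Polynomial (λ x → f x - g x)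
difference-polynomial {f} {g} (c , f≡) (d , g≡) = addᵖ c (scaleᵖ (- 1q) d) , λ x →
  trans (cong₂ _-_ (f≡ x) (g≡ x)) (trans (negate (ev c x) (ev d x)) (sym (trans (ev-addᵖ c (scaleᵖ (- 1q) d) x) (cong (ev c x +_) (ev-scaleᵖ (- 1q) d x)))))
  where
  negate = solve 2 (λ a b → a :- b := a :+ :- κ 1 :* b) refl

∑-polynomial : ∀ {n} {f : Fin n → Q → Q} → (∀ i → Polynomial (f i)) → Polynomial (λ x → ∑ (λ i → f i x))
∑-polynomial {zero}  p = const-polynomial 0q
∑-polynomial {suc n} p = +-polynomial (p zero) (∑-polynomial (p ∘ suc))

det-polynomial : ∀ {n} {N : Q → Matrix n} → (∀ i j → Polynomial (λ x → N x i j)) → Polynomial (λ x → det (N x))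
det-polynomial {zero}  p = const-polynomial 1q
det-polynomial {suc n} p = ∑-polynomial λ j → *-polynomial (const-polynomial (sgn j))
  (*-polynomial (p zero j) (det-polynomial (λ a b → p (suc a) (punchIn j b))))

det-shift-polynomial : ∀ {n} (M : Matrix n) → Polynomial (λ x → det (shift M x))
det-shift-polynomial M = det-polynomial λ i j → +-polynomial (const-polynomial (M i j)) (*-polynomial var-polynomial (const-polynomial (δ i j)))

-- Synthetic division by x - a: the coefficients of the quotient are the values at a of the
-- successive tails.
quotient : List Q → Q → List Q
quotient []              a = []
quotient (b ∷ [])        a = []
quotient (b ∷ c@(_ ∷ _)) a = ev c a ∷ quotient c a

length-quotient : ∀ c a → length (quotient c a) ≡ ℕ.pred (length c)
length-quotient []              a = refl
length-quotient (b ∷ [])        a = refl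
length-quotient (b ∷ c@(_ ∷ _)) a = cong suc (length-quotient c a)

ev-quotient : ∀ c a x → ev c x ≡ ev c a + (x - a) * ev (quotient c a) x
ev-quotient []              a x = sym (trans (+-identityˡ _) (trans (*-comm _ 0q) (*-zeroˡ _)))
ev-quotient (b ∷ [])        a x = solve 3 (λ b x a → b :+ x :* κ 0 := b :+ a :* κ 0 :+ (x :- a) :* κ 0) refl b x a
ev-quotient (b ∷ c@(_ ∷ _)) a x = trans (cong (λ e → b + x * e) (ev-quotient c a x)) (regroup (ev c a) (ev (quotient c a) x))
  where
  regroup = λ p q → solve 5 (λ b x p a q → b :+ x :* (p :+ (x :- a) :* q) := b :+ a :* p :+ (x :- a) :* (p :+ x :* q)) refl b x p a q

-- The zeros come as an injective sequence, so after dividing out the first one the remaining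
-- sequence serves the shorter quotient; no degree has to be known.
vanishes-everywhere : ∀ n c → length c ≡ n → (s : ℕ → Q) → (∀ {i j} → s i ≡ s j → i ≡ j) → (∀ i → ev c (s i) ≡ 0q) → ∀ x → ev c x ≡ 0q
vanishes-everywhere zero    []      _   s inj zeros x = refl
vanishes-everywhere (suc n) c len s inj zeros x =
  trans (ev-quotient c (s 0) x) (trans (cong₂ (λ p q → p + (x - s 0) * q) (zeros 0) quotient≡0) (nil (x - s 0)))
  where
  nil = solve 1 (λ a → κ 0 :+ a :* κ 0 := κ 0) refl
  s≢s₀ : ∀ i → s (suc i) - s 0 ≢ 0q
  s≢s₀ i eq with inj (-≡0⇒≡ eq)
  ... | ()
  quotient≡0 : ev (quotient c (s 0)) x ≡ 0q
  quotient≡0 = vanishes-everywhere n (quotient c (s 0)) (trans (length-quotient c (s 0)) (cong ℕ.pred len)) (s ∘ suc)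
    (λ eq → ℕₚ.suc-injective (inj eq))
    (λ i → inverse-0 (s≢s₀ i) (trans (sym (+-identityˡ _)) (trans (cong (_+ (s (suc i) - s 0) * ev (quotient c (s 0)) (s (suc i))) (sym (zeros 0))) (trans (sym (ev-quotient c (s 0) (s (suc i)))) (zeros (suc i)))))) x

ι-injective : ∀ {m n} → ι m ≡ ι n → m ≡ n
ι-injective {zero}  {zero}  eq = refl
ι-injective {zero}  {suc n} eq = contradiction (sym eq) (0≺⇒≢0 (0≺ι-suc n))
ι-injective {suc m} {zero}  eq = contradiction eq (0≺⇒≢0 (0≺ι-suc m))
ι-injective {suc m} {suc n} eq = cong suc (ι-injective (cancel (trans (sym (ι-suc m)) (trans eq (ι-suc n)))))
  where
  cancel : ∀ {a b} → 1q + a ≡ 1q + b → a ≡ b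
  cancel {a} {b} p = trans (solve 1 (λ a → a := κ 1 :+ a :- κ 1) refl a) (trans (cong (_- 1q) p) (solve 1 (λ b → κ 1 :+ b :- κ 1 := b) refl b))

agree-everywhere : ∀ {f g} → Polynomial f → Polynomial g → (s : ℕ → Q) → (∀ {i j} → s i ≡ s j → i ≡ j) →
                   (∀ i → f (s i) ≡ g (s i)) → ∀ x → f x ≡ g x
agree-everywhere {f} {g} p q s inj eq x with difference-polynomial {f} {g} p q
... | d , d≡ = -≡0⇒≡ (trans (d≡ x) (vanishes-everywhere (length d) d refl s inj (λ i → trans (sym (d≡ (s i))) (≡⇒-≡0 (eq i))) x))

coefficients-vanish : ∀ c → (∀ x → ev c x ≡ 0q) → All (_≡ 0q) c
coefficients-vanish []      _     = []
coefficients-vanish (a ∷ c) zeros = a≡0 ∷ coefficients-vanish c (vanishes-everywhere (length c) c refl (ι ∘ suc) (ℕₚ.suc-injective ∘ ι-injective)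
    (λ i → inverse-0 (0≺⇒≢0 (0≺ι-suc i)) (drop (ι (suc i)) (ev c (ι (suc i))) (zeros (ι (suc i))) a≡0)))
  where
  constant-term = solve 2 (λ a e → a :+ κ 0 :* e := a) refl
  a≡0 : a ≡ 0q
  a≡0 = trans (sym (constant-term a (ev c 0q))) (zeros 0q)
  drop : ∀ x e → a + x * e ≡ 0q → a ≡ 0q → x * e ≡ 0q
  drop x e eq refl = trans (sym (+-identityˡ _)) eq

-- Complete multipartite graphs

det-zero-column : ∀ {n} (M : Matrix (suc n)) → (∀ i → M i zero ≡ 0q) → det M ≡ 0q
det-zero-column {n} M col≡0 = ∑-0 (term n M col≡0)
  where
  term : ∀ n (M : Matrix (suc n)) → (∀ i → M i zero ≡ 0q) → ∀ j → sgn j * (M zero j * det (minor M j)) ≡ 0q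
  term n       M col≡0 zero    = trans (cong (λ m → 1q * (m * det (minor M zero))) (col≡0 zero)) (nil (det (minor M zero)))
    where
    nil = solve 1 (λ d → κ 1 :* (κ 0 :* d) := κ 0) refl
  term (suc n) M col≡0 (suc j) = trans (cong (λ d → - sgn j * (M zero (suc j) * d)) (det-zero-column (minor M (suc j)) (λ i → col≡0 (suc i)))) (nil (sgn j) (M zero (suc j)))
    where
    nil = solve 2 (λ s m → :- s :* (m :* κ 0) := κ 0) refl

det-first-column : ∀ {n} (M : Matrix (suc n)) → (∀ i → M (suc i) zero ≡ 0q) → det M ≡ M zero zero * det (minor M zero)
det-first-column {n} M col≡0 = trans (cong (1q * (M zero zero * det (minor M zero)) +_) (∑-0 (term n M col≡0))) (tidy (M zero zero * det (minor M zero)))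
  where
  tidy = solve 1 (λ a → κ 1 :* a :+ κ 0 := a) refl
  term : ∀ n (M : Matrix (suc n)) → (∀ i → M (suc i) zero ≡ 0q) → ∀ j → sgn (suc j) * (M zero (suc j) * det (minor M (suc j))) ≡ 0q
  term (suc n) M col≡0 j = trans (cong (λ d → - sgn j * (M zero (suc j) * d)) (det-zero-column (minor M (suc j)) col≡0)) (nil (sgn j) (M zero (suc j)))
    where
    nil = solve 2 (λ s m → :- s :* (m :* κ 0) := κ 0) refl

-- For two vertices of one part, rows 0 and 1 differ only by the x on the diagonal. Row 0 is row 1
-- plus x (δ 0 - δ 1): the first summand repeats a row, the others are unit rows and leave minors.
det-twins : ∀ {n} (A : Matrix (2 ℕ.+ n)) x → (∀ j → A zero j ≡ A (suc zero) j + x * δ zero j - x * δ (suc zero) j) →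
  (∀ i → A (suc i) zero ≡ A (suc i) (suc zero) - x * δ zero i) →
  det A ≡ ι 2 * x * det (minor A zero) - x * x * det (minor (minor A zero) zero)
det-twins {n} A x rows cols = begin
  det A ≡⟨ det-linear zero 1q 1q {A [ zero ≔ A (suc zero) ]} {A [ zero ≔ r ]} {A}
      (λ i i≢0 j → [≔]-other A _ j i≢0) (λ i i≢0 j → [≔]-other A _ j i≢0) row₀ ⟩
  1q * det (A [ zero ≔ A (suc zero) ]) + 1q * det (A [ zero ≔ r ])
      ≡⟨ cong₂ (λ p q → 1q * p + 1q * q) (alt-≔ A {zero} {suc zero} (λ ())) (linear-≔ A zero x (- x) (δ zero) (δ (suc zero))) ⟩
  1q * 0q + 1q * (x * det (A [ zero ≔ δ zero ]) + - x * det (A [ zero ≔ δ (suc zero) ]))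
      ≡⟨ cong₂ (λ p q → 1q * 0q + 1q * (x * p + - x * q)) first second ⟩
  1q * 0q + 1q * (x * (1q * D₁) + - x * (- 1q * (1q * D₁ + - x * (1q * D₂))))
      ≡⟨ collect D₁ D₂ ⟩
  ι 2 * x * D₁ - x * x * D₂                                   ∎
  where
  open AlternatingProperties (det-alternating (2 ℕ.+ n))
  r : Vector (2 ℕ.+ n)
  r j = x * δ zero j + - x * δ (suc zero) j
  D₁ = det (minor A zero)
  D₂ = det (minor (minor A zero) zero)
  N = A [ zero ≔ δ (suc zero) ]

  collect = λ d₁ d₂ → solve 3 (λ x d₁ d₂ → κ 1 :* κ 0 :+ κ 1 :* (x :* (κ 1 :* d₁) :+ :- x :* (:- κ 1 :* (κ 1 :* d₁ :+ :- x :* (κ 1 :* d₂)))) :=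
    κ 2 :* x :* d₁ :- x :* x :* d₂) refl x d₁ d₂

  row₀ : ∀ j → A zero j ≡ 1q * (A [ zero ≔ A (suc zero) ]) zero j + 1q * (A [ zero ≔ r ]) zero j
  row₀ j = trans (rows j) (tidy (A (suc zero) j) (δ zero j) (δ (suc zero) j))
    where
    tidy = λ a d e → solve 4 (λ a x d e → a :+ x :* d :- x :* e := κ 1 :* a :+ κ 1 :* (x :* d :+ :- x :* e)) refl a x d e

  first : det (A [ zero ≔ δ zero ]) ≡ 1q * D₁
  first = det-first-δ (A [ zero ≔ δ zero ]) zero (λ j → refl)

  second : det N ≡ - 1q * (1q * D₁ + - x * (1q * D₂))
  second = trans (det-first-δ N (suc zero) (λ j → refl)) (cong (- 1q *_) (begin
    -- Removing column 1 instead of column 0 changes the minor only in its corner, by - x, since the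
    -- two columns agree below row 0 up to that entry.
    det (minor N (suc zero)) ≡⟨ det-linear zero 1q (- x) {minor A zero} {minor A zero [ zero ≔ δ zero ]} {minor N (suc zero)} other
        (λ { zero 0≢0 → contradiction refl 0≢0 ; (suc i) i≢0 j → other (suc i) (λ ()) j }) at-0 ⟩
    1q * D₁ + - x * det (minor A zero [ zero ≔ δ zero ]) ≡⟨ cong (λ d → 1q * D₁ + - x * d) (det-first-δ (minor A zero [ zero ≔ δ zero ]) zero (λ j → refl)) ⟩
    1q * D₁ + - x * (1q * D₂)                                                 ∎))
    where
    zeroth = λ a d → solve 3 (λ a x d → a :- x :* d := κ 1 :* a :+ :- x :* d) refl a x d
    keep = λ a → solve 2 (λ a x → a := κ 1 :* a :+ :- x :* κ 0) refl a x
    drop = λ a → solve 2 (λ a x → a :- x :* κ 0 := a) refl a x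
    other : ∀ i → i ≢ zero → ∀ j → A (suc i) (suc j) ≡ A (suc i) (punchIn (suc zero) j)
    other zero    i≢0 j       = contradiction refl i≢0
    other (suc i) i≢0 zero    = sym (trans (cols (suc i)) (drop _))
    other (suc i) i≢0 (suc j) = refl
    at-0 : ∀ j → A (suc zero) (punchIn (suc zero) j) ≡ 1q * A (suc zero) (suc j) + - x * δ zero j
    at-0 zero    = trans (cols zero) (zeroth _ 1q)
    at-0 (suc j) = keep _

-- For a vertex that is a part of its own. Row 0 is a times a unit row plus s times the all-ones
-- row; under an all-ones row, s can be subtracted from every entry below, which clears column 0 and
-- removes the summand s J from the rest. Hence the recursion needs the matrices for s and for 0
-- together.
det-isolated : ∀ {n} (A : Matrix (suc n)) a s → A zero zero ≡ a + s → (∀ j → A zero (suc j) ≡ s) → (∀ i → A (suc i) zero ≡ s) →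
  det A ≡ a * det (minor A zero) + s * det (λ i j → A (suc i) (suc j) - s)
det-isolated {n} A a s corner row col = begin
  det A ≡⟨ det-linear zero a s {A [ zero ≔ δ zero ]} {A [ zero ≔ (λ _ → 1q) ]} {A}
      (λ i i≢0 j → [≔]-other A _ j i≢0) (λ i i≢0 j → [≔]-other A _ j i≢0) row₀ ⟩
  a * det (A [ zero ≔ δ zero ]) + s * det (A [ zero ≔ (λ _ → 1q) ])
      ≡⟨ cong₂ (λ p q → a * p + s * q) (trans (det-first-δ (A [ zero ≔ δ zero ]) zero (λ j → refl)) (*-identityˡ _)) ones ⟩
  a * det (minor A zero) + s * det (minor N zero)              ∎
  where
  N : Matrix (suc n)
  N zero    j = 1q
  N (suc i) j = A (suc i) j - s

  row₀ : ∀ j → A zero j ≡ a * (A [ zero ≔ δ zero ]) zero j + s * (A [ zero ≔ (λ _ → 1q) ]) zero j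
  row₀ zero    = trans corner (tidy a s)
    where
    tidy = solve 2 (λ a s → a :+ s := a :* κ 1 :+ s :* κ 1) refl
  row₀ (suc j) = trans (row j) (tidy a s)
    where
    tidy = solve 2 (λ a s → s := a :* κ 0 :+ s :* κ 1) refl

  ones : det (A [ zero ≔ (λ _ → 1q) ]) ≡ det (minor N zero)
  ones = trans (sym (add-first-row (det-alternating (suc n)) {A [ zero ≔ (λ _ → 1q) ]} {N} (λ _ → - s) (λ j → refl) (λ i j → tidy (A (suc i) j) s)))
    (trans (det-first-column N (λ i → ≡⇒-≡0 (col i))) (*-identityˡ _))
    where
    tidy = solve 2 (λ a s → a :- s := a :+ :- s :* κ 1) refl

block : ∀ ps → Matrix (sum ps)
block ps i j = if ⌊ partOf ps i ℕ.≟ partOf ps j ⌋ then 1q else 0q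

-- multipartite ps s is 2B + s J, where B is the block matrix of the parts and J the all-ones matrix;
-- s = - 1 gives I + S for the complete multipartite graph.
multipartite : ∀ ps → Q → Matrix (sum ps)
multipartite ps s i j = ι 2 * block ps i j + s

partOf-suc : ∀ p ps v → partOf (suc p ∷ ps) (suc v) ≡ partOf (p ∷ ps) v
partOf-suc p ps v with splitAt p v
... | inj₁ _ = refl
... | inj₂ _ = refl

⌊suc≟suc⌋ : ∀ a b → ⌊ suc a ℕ.≟ suc b ⌋ ≡ ⌊ a ℕ.≟ b ⌋
⌊suc≟suc⌋ a b with a ℕ.≟ b | suc a ℕ.≟ suc b
... | yes _   | yes _  = refl
... | no _    | no _   = refl
... | yes a≡b | no ≢   = contradiction (cong suc a≡b) ≢
... | no a≢b  | yes eq = contradiction (ℕₚ.suc-injective eq) a≢b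

block-0∷ : ∀ ps i j → block (0 ∷ ps) i j ≡ block ps i j
block-0∷ ps i j = cong (λ b → if b then 1q else 0q) (⌊suc≟suc⌋ (partOf ps i) (partOf ps j))

block-suc : ∀ p ps i j → block (suc p ∷ ps) (suc i) (suc j) ≡ block (p ∷ ps) i j
block-suc p ps i j = cong₂ (λ a b → if ⌊ a ℕ.≟ b ⌋ then 1q else 0q) (partOf-suc p ps i) (partOf-suc p ps j)

shifted : List ℕ → Q → Q → Q
shifted ps s x = det (shift (multipartite ps s) x)

shifted-0∷ : ∀ ps s x → shifted (0 ∷ ps) s x ≡ shifted ps s x
shifted-0∷ ps s x = det-cong (λ i j → cong (λ b → ι 2 * b + s + x * δ i j) (block-0∷ ps i j))

minor-shift : ∀ p ps s x i j → shift (multipartite (suc p ∷ ps) s) x (suc i) (suc j) ≡ shift (multipartite (p ∷ ps) s) x i j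
minor-shift p ps s x i j = cong (λ b → ι 2 * b + s + x * δ i j) (block-suc p ps i j)

shifted-twins : ∀ p ps s x → shifted (suc (suc p) ∷ ps) s x ≡ ι 2 * x * shifted (suc p ∷ ps) s x - x * x * shifted (p ∷ ps) s x
shifted-twins p ps s x = trans (det-twins (shift (multipartite (suc (suc p) ∷ ps) s) x) x rows cols)
  (cong₂ (λ d e → ι 2 * x * d - x * x * e)
    (det-cong (minor-shift (suc p) ps s x))
    (det-cong (λ i j → trans (minor-shift (suc p) ps s x (suc i) (suc j)) (minor-shift p ps s x i j))))
  where
  A = shift (multipartite (suc (suc p) ∷ ps) s) x
  rows : ∀ j → A zero j ≡ A (suc zero) j + x * δ zero j - x * δ (suc zero) j
  rows zero          = tidy s x
    where
    tidy = solve 2 (λ s x → κ 2 :* κ 1 :+ s :+ x :* κ 1 := κ 2 :* κ 1 :+ s :+ x :* κ 0 :+ x :* κ 1 :- x :* κ 0) refl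
  rows (suc zero)    = tidy s x
    where
    tidy = solve 2 (λ s x → κ 2 :* κ 1 :+ s :+ x :* κ 0 := κ 2 :* κ 1 :+ s :+ x :* κ 1 :+ x :* κ 0 :- x :* κ 1) refl
  rows (suc (suc j)) = tidy s x (block (suc (suc p) ∷ ps) zero (suc (suc j)))
    where
    tidy = solve 3 (λ s x b → κ 2 :* b :+ s :+ x :* κ 0 := κ 2 :* b :+ s :+ x :* κ 0 :+ x :* κ 0 :- x :* κ 0) refl
  cols : ∀ i → A (suc i) zero ≡ A (suc i) (suc zero) - x * δ zero i
  cols zero    = tidy s x
    where
    tidy = solve 2 (λ s x → κ 2 :* κ 1 :+ s :+ x :* κ 0 := κ 2 :* κ 1 :+ s :+ x :* κ 1 :- x :* κ 1) refl
  cols (suc i) = tidy s x (block (suc (suc p) ∷ ps) (suc (suc i)) zero)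
    where
    tidy = solve 3 (λ s x b → κ 2 :* b :+ s :+ x :* κ 0 := κ 2 :* b :+ s :+ x :* κ 0 :- x :* κ 0) refl

shifted-isolated : ∀ ps s x → shifted (1 ∷ ps) s x ≡ (x + ι 2) * shifted ps s x + s * shifted ps 0q x
shifted-isolated ps s x = trans (det-isolated (shift (multipartite (1 ∷ ps) s) x) (x + ι 2) s (corner s x) (λ j → off s x) (λ i → off s x))
  (cong₂ (λ d e → (x + ι 2) * d + s * e) (det-cong (λ i j → cong (λ b → ι 2 * b + s + x * δ i j) (block-1∷ i j))) (det-cong (λ i j → trans (cong (λ b → ι 2 * b + s + x * δ i j - s) (block-1∷ i j)) (minus-s (block ps i j) (δ i j)))))
  where
  block-1∷ : ∀ i j → block (1 ∷ ps) (suc i) (suc j) ≡ block ps i j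
  block-1∷ i j = block-0∷ ps i j
  corner = solve 2 (λ s x → κ 2 :* κ 1 :+ s :+ x :* κ 1 := x :+ κ 2 :+ s) refl
  off = solve 2 (λ s x → κ 2 :* κ 0 :+ s :+ x :* κ 0 := s) refl
  minus-s = λ b d → solve 4 (λ b s x d → κ 2 :* b :+ s :+ x :* d :- s := κ 2 :* b :+ κ 0 :+ x :* d) refl b s x d

_^_ : Q → ℕ → Q
x ^ zero  = 1q
x ^ suc n = x * x ^ n

-- `shifted-twins` is a linear recurrence in the part size with characteristic polynomial (λ - x)²,
-- so the solution is a power of x times a linear function of the size. Sizes 1 and 2 are the
-- initial values.
shifted-∷ : ∀ p ps s x → shifted (suc p ∷ ps) s x ≡ x ^ p * ((x + ι 2 * ι (suc p)) * shifted ps s x + s * ι (suc p) * shifted ps 0q x)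
shifted-∷ zero          ps s x = trans (shifted-isolated ps s x) (tidy (shifted ps s x) (shifted ps 0q x))
  where
  tidy = λ d e → solve 4 (λ x d s e → (x :+ κ 2) :* d :+ s :* e := κ 1 :* ((x :+ κ 2 :* κ 1) :* d :+ s :* κ 1 :* e)) refl x d s e
shifted-∷ (suc zero)    ps s x = begin
  shifted (2 ∷ ps) s x ≡⟨ shifted-twins 0 ps s x ⟩
  ι 2 * x * shifted (1 ∷ ps) s x - x * x * shifted (0 ∷ ps) s x ≡⟨ cong₂ (λ d e → ι 2 * x * d - x * x * e) (shifted-isolated ps s x) (shifted-0∷ ps s x) ⟩
  ι 2 * x * ((x + ι 2) * d + s * e) - x * x * d ≡⟨ tidy d e ⟩
  x * 1q * ((x + ι 2 * ι 2) * d + s * ι 2 * e)                            ∎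
  where
  d = shifted ps s x
  e = shifted ps 0q x
  tidy = λ d e → solve 4 (λ x d s e → κ 2 :* x :* ((x :+ κ 2) :* d :+ s :* e) :- x :* x :* d := x :* κ 1 :* ((x :+ κ 2 :* κ 2) :* d :+ s :* κ 2 :* e)) refl x d s e
shifted-∷ (suc (suc p)) ps s x = begin
  shifted (3 ℕ.+ p ∷ ps) s x ≡⟨ shifted-twins (suc p) ps s x ⟩
  ι 2 * x * shifted (2 ℕ.+ p ∷ ps) s x - x * x * shifted (suc p ∷ ps) s x ≡⟨ cong₂ (λ d e → ι 2 * x * d - x * x * e) (shifted-∷ (suc p) ps s x) (shifted-∷ p ps s x) ⟩
  ι 2 * x * (x * x ^ p * ((x + ι 2 * ι (2 ℕ.+ p)) * d + s * ι (2 ℕ.+ p) * e)) - x * x * (x ^ p * ((x + ι 2 * ι (suc p)) * d + s * ι (suc p) * e))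
    ≡⟨ cong₂ (λ k l → ι 2 * x * (x * x ^ p * ((x + ι 2 * k) * d + s * k * e)) - x * x * (x ^ p * ((x + ι 2 * l) * d + s * l * e))) (ι-+ 2 p) (ι-+ 1 p) ⟩
  ι 2 * x * (x * x ^ p * ((x + ι 2 * (ι 2 + ι p)) * d + s * (ι 2 + ι p) * e)) - x * x * (x ^ p * ((x + ι 2 * (1q + ι p)) * d + s * (1q + ι p) * e))
    ≡⟨ tidy (x ^ p) (ι p) d e ⟩
  x * (x * x ^ p) * ((x + ι 2 * (ι 3 + ι p)) * d + s * (ι 3 + ι p) * e) ≡⟨ cong (λ k → x * (x * x ^ p) * ((x + ι 2 * k) * d + s * k * e)) (ι-+ 3 p) ⟨
  x * (x * x ^ p) * ((x + ι 2 * ι (3 ℕ.+ p)) * d + s * ι (3 ℕ.+ p) * e)   ∎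
  where
  d = shifted ps s x
  e = shifted ps 0q x
  tidy = λ y m d e → solve 6 (λ x y m d s e → κ 2 :* x :* (x :* y :* ((x :+ κ 2 :* (κ 2 :+ m)) :* d :+ s :* (κ 2 :+ m) :* e)) :- x :* x :* (y :* ((x :+ κ 2 :* (κ 1 :+ m)) :* d :+ s :* (κ 1 :+ m) :* e)) :=
    x :* (x :* y) :* ((x :+ κ 2 :* (κ 3 :+ m)) :* d :+ s :* (κ 3 :+ m) :* e)) refl x y m d s e

-- Closed forms of `shifted` at s = 0 and at s = - 1. The separate clause for empty parts keeps the
-- exponent, the size minus 1, a natural number.
g₀ g : List ℕ → Q → Q
g₀ []           x = 1q
g₀ (zero ∷ ps)  x = g₀ ps x
g₀ (suc p ∷ ps) x = x ^ p * ((x + ι 2 * ι (suc p)) * g₀ ps x)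
g []           x = 1q
g (zero ∷ ps)  x = g ps x
g (suc p ∷ ps) x = x ^ p * ((x + ι 2 * ι (suc p)) * g ps x - ι (suc p) * g₀ ps x)

shifted-0 : ∀ ps x → shifted ps 0q x ≡ g₀ ps x
shifted-0 []           x = refl
shifted-0 (zero ∷ ps)  x = trans (shifted-0∷ ps 0q x) (shifted-0 ps x)
shifted-0 (suc p ∷ ps) x = trans (shifted-∷ p ps 0q x) (trans (cong (λ d → x ^ p * ((x + ι 2 * ι (suc p)) * d + 0q * ι (suc p) * d)) (shifted-0 ps x)) (tidy (x ^ p) (ι (suc p)) (g₀ ps x)))
  where
  tidy = λ y k d → solve 4 (λ y x k d → y :* ((x :+ κ 2 :* k) :* d :+ κ 0 :* k :* d) := y :* ((x :+ κ 2 :* k) :* d)) refl y x k d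

shifted-1 : ∀ ps x → shifted ps (- 1q) x ≡ g ps x
shifted-1 []           x = refl
shifted-1 (zero ∷ ps)  x = trans (shifted-0∷ ps (- 1q) x) (shifted-1 ps x)
shifted-1 (suc p ∷ ps) x = trans (shifted-∷ p ps (- 1q) x)
  (trans (cong₂ (λ d e → x ^ p * ((x + ι 2 * ι (suc p)) * d + - 1q * ι (suc p) * e)) (shifted-1 ps x) (shifted-0 ps x)) (tidy (x ^ p) (ι (suc p)) (g ps x) (g₀ ps x)))
  where
  tidy = λ y k d e → solve 5 (λ y x k d e → y :* ((x :+ κ 2 :* k) :* d :+ :- κ 1 :* k :* e) := y :* ((x :+ κ 2 :* k) :* d :- k :* e)) refl y x k d e

-- Sign and growth of the determinant at positive x

^-pos : ∀ {x} p → 0q ≺ x → 0q ≺ x ^ p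
^-pos zero    0≺x = 0≺1
^-pos (suc p) 0≺x = 0≺* 0≺x (^-pos p 0≺x)

^-mono : ∀ {x y} p → 0q ≺ x → x ≼ y → x ^ p ≼ y ^ p
^-mono zero    0≺x x≼y = ≼-refl
^-mono (suc p) 0≺x x≼y = *-mono-≼ (≺⇒≼ (^-pos p 0≺x)) (≺⇒≼ (≺-≼-trans 0≺x x≼y)) x≼y (^-mono p 0≺x x≼y)

^-+ : ∀ x p n → x ^ (p ℕ.+ n) ≡ x ^ p * x ^ n
^-+ x zero    n = sym (*-identityˡ _)
^-+ x (suc p) n = trans (cong (x *_) (^-+ x p n)) (sym (*-assoc _ _ _))

0≼2ι : ∀ p → 0q ≼ ι 2 * ι p
0≼2ι p = 0≼* (0≼ι 2) (0≼ι p)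

g₀-pos : ∀ ps {x} → 0q ≺ x → 0q ≺ g₀ ps x
g₀-pos []           0≺x = 0≺1
g₀-pos (zero ∷ ps)  0≺x = g₀-pos ps 0≺x
g₀-pos (suc p ∷ ps) 0≺x = 0≺* (^-pos p 0≺x) (0≺* (0≺+≽0 0≺x (0≼2ι (suc p))) (g₀-pos ps 0≺x))

g₀-mono : ∀ ps {x y} → 0q ≺ x → x ≼ y → g₀ ps x ≼ g₀ ps y
g₀-mono []           0≺x x≼y = ≼-refl
g₀-mono (zero ∷ ps)  0≺x x≼y = g₀-mono ps 0≺x x≼y
g₀-mono (suc p ∷ ps) 0≺x x≼y =
  *-mono-≼ (≺⇒≼ (0≺* (0≺+≽0 0≺x (0≼2ι (suc p))) (g₀-pos ps 0≺x))) (≺⇒≼ (^-pos p 0≺y)) (^-mono p 0≺x x≼y)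
    (*-mono-≼ (≺⇒≼ (g₀-pos ps 0≺x)) (≺⇒≼ (0≺+≽0 0≺y (0≼2ι (suc p)))) (+-mono-≼ x≼y ≼-refl) (g₀-mono ps 0≺x x≼y))
  where
  0≺y = ≺-≼-trans 0≺x x≼y

-- The spread is the increment of g / g₀ from x to y, cleared of denominators. A part of size m
-- contributes m / (x + 2m) - m / (y + 2m) = m (y - x) / ((x + 2m)(y + 2m)).
spread-∷ : ∀ p ps x y → g (suc p ∷ ps) y * g₀ (suc p ∷ ps) x - g (suc p ∷ ps) x * g₀ (suc p ∷ ps) y ≡
  x ^ p * y ^ p * ((x + ι 2 * ι (suc p)) * (y + ι 2 * ι (suc p))) * (g ps y * g₀ ps x - g ps x * g₀ ps y) +
  x ^ p * y ^ p * ι (suc p) * (g₀ ps x * g₀ ps y) * (y - x)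
spread-∷ p ps x y = identity (x ^ p) (y ^ p) (ι (suc p)) (g ps x) (g ps y) (g₀ ps x) (g₀ ps y)
  where
  identity = λ a b m gx gy hx hy → solve 9 (λ b y m gy hy a x hx gx → b :* ((y :+ κ 2 :* m) :* gy :- m :* hy) :* (a :* ((x :+ κ 2 :* m) :* hx)) :- a :* ((x :+ κ 2 :* m) :* gx :- m :* hx) :* (b :* ((y :+ κ 2 :* m) :* hy)) :=
    a :* b :* ((x :+ κ 2 :* m) :* (y :+ κ 2 :* m)) :* (gy :* hx :- gx :* hy) :+ a :* b :* m :* (hx :* hy) :* (y :- x)) refl b y m gy hy a x hx gx

spread-≽0 : ∀ ps {x y} → 0q ≺ x → x ≼ y → 0q ≼ g ps y * g₀ ps x - g ps x * g₀ ps y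
spread-≽0 []           0≺x x≼y = 0≼-resp ≼-refl (solve 0 (κ 0 := κ 1 :* κ 1 :- κ 1 :* κ 1) refl)
spread-≽0 (zero ∷ ps)  0≺x x≼y = spread-≽0 ps 0≺x x≼y
spread-≽0 (suc p ∷ ps) {x} {y} 0≺x x≼y = 0≼-resp
  (0≼+ (0≼* (0≼* xy≽0 (≺⇒≼ (0≺* (0≺+≽0 0≺x (0≼2ι (suc p))) (0≺+≽0 0≺y (0≼2ι (suc p)))))) (spread-≽0 ps 0≺x x≼y))
       (0≼* (0≼* (0≼* xy≽0 (0≼ι (suc p))) (≺⇒≼ (0≺* (g₀-pos ps 0≺x) (g₀-pos ps 0≺y)))) (≼⇒0≼- x≼y)))
  (sym (spread-∷ p ps x y))
  where
  0≺y = ≺-≼-trans 0≺x x≼y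
  xy≽0 = ≺⇒≼ (0≺* (^-pos p 0≺x) (^-pos p 0≺y))

-- The contribution of the first part alone, with both arguments lowered to x₀; one part already
-- gives a positive speed.
speed-at : ℕ → List ℕ → Q → Q
speed-at p ps x₀ = x₀ ^ p * x₀ ^ p * ι (suc p) * (g₀ ps x₀ * g₀ ps x₀)

spread-≽ : ∀ p ps {x₀ x y} → 0q ≺ x₀ → x₀ ≼ x → x ≼ y →
           speed-at p ps x₀ * (y - x) ≼ g (suc p ∷ ps) y * g₀ (suc p ∷ ps) x - g (suc p ∷ ps) x * g₀ (suc p ∷ ps) y
spread-≽ p ps {x₀} {x} {y} 0≺x₀ x₀≼x x≼y = ≼-trans
  (*-mono-≼ (≼⇒0≼- x≼y) (0≼* (0≼* xy≽0 (0≼ι (suc p))) (≺⇒≼ (0≺* (g₀-pos ps 0≺x) (g₀-pos ps 0≺y)))) coefficient ≼-refl)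
  (≼-trans (≼-by (0≼* (0≼* xy≽0 (≺⇒≼ (0≺* (0≺+≽0 0≺x (0≼2ι (suc p))) (0≺+≽0 0≺y (0≼2ι (suc p)))))) (spread-≽0 ps 0≺x x≼y)) (drop _ _))
           (≼-reflexive (sym (spread-∷ p ps x y))))
  where
  x₀≼y = ≼-trans x₀≼x x≼y
  0≺x = ≺-≼-trans 0≺x₀ x₀≼x
  0≺y = ≺-≼-trans 0≺x₀ x₀≼y
  xy≽0 = ≺⇒≼ (0≺* (^-pos p 0≺x) (^-pos p 0≺y))
  drop = solve 2 (λ a b → a :+ b :- b := a) refl
  coefficient : speed-at p ps x₀ ≼ x ^ p * y ^ p * ι (suc p) * (g₀ ps x * g₀ ps y)
  coefficient = *-mono-≼ (≺⇒≼ (0≺* (g₀-pos ps 0≺x₀) (g₀-pos ps 0≺x₀))) (0≼* xy≽0 (0≼ι (suc p)))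
    (*-mono-≼ (0≼ι (suc p)) xy≽0 (*-mono-≼ (≺⇒≼ (^-pos p 0≺x₀)) (≺⇒≼ (^-pos p 0≺x)) (^-mono p 0≺x₀ x₀≼x) (^-mono p 0≺x₀ x₀≼y)) ≼-refl)
    (*-mono-≼ (≺⇒≼ (g₀-pos ps 0≺x₀)) (≺⇒≼ (g₀-pos ps 0≺x)) (g₀-mono ps 0≺x₀ x₀≼x) (g₀-mono ps 0≺x₀ x₀≼y))

speed-at-pos : ∀ p ps {x₀} → 0q ≺ x₀ → 0q ≺ speed-at p ps x₀
speed-at-pos p ps 0≺x₀ = 0≺* (0≺* (0≺* (^-pos p 0≺x₀) (^-pos p 0≺x₀)) (0≺ι-suc p)) (0≺* (g₀-pos ps 0≺x₀) (g₀-pos ps 0≺x₀))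

Positive : List ℕ → Set
Positive = All (1 ≤_)

-- g / g₀ = 1 − Σ p / (x + 2p), and every summand is at least 2/5 at x = 1/2.
g-half : ∀ ps → Positive ps → ∀ {h} → ι 2 * h ≡ 1q → 0q ≺ h → 0q ≼ (ι 5 - ι 2 * ι (length ps)) * g₀ ps h - ι 5 * g ps h
g-half []           []                 2h≡1 0≺h = 0≼-resp ≼-refl (solve 0 (κ 0 := (κ 5 :- κ 2 :* κ 0) :* κ 1 :- κ 5 :* κ 1) refl)
g-half (suc p ∷ ps) (_ ∷ pos-ps) {h} 2h≡1 0≺h = 0≼-resp
  (0≼* (≺⇒≼ (^-pos p 0≺h)) (0≼+ (0≼* (≺⇒≼ (0≺+≽0 0≺h (0≼2ι (suc p)))) (g-half ps pos-ps 2h≡1 0≺h)) (0≼* (≺⇒≼ (g₀-pos ps 0≺h)) (0≼ι p))))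
  (trans (cong₂ (λ m l → h ^ p * ((h + ι 2 * m) * ((ι 5 - ι 2 * ι (length ps)) * g₀ ps h - ι 5 * g ps h) + g₀ ps h * l)) refl (sym (-≡0⇒≡ p≡)))
    (trans (identity (h ^ p) (ι (suc p)) (ι (length ps)) (g ps h) (g₀ ps h))
      (cong (λ k → (ι 5 - ι 2 * k) * (h ^ p * ((h + ι 2 * ι (suc p)) * g₀ ps h)) - ι 5 * (h ^ p * ((h + ι 2 * ι (suc p)) * g ps h - ι (suc p) * g₀ ps h))) (sym (ι-suc (length ps))))))
  where
  p≡ : (ι (suc p) - ι 2 * h) - ι p ≡ 0q
  p≡ = trans (cong₂ (λ m l → (m - l) - ι p) (ι-suc p) 2h≡1) (solve 1 (λ s → κ 1 :+ s :- κ 1 :- s := κ 0) refl (ι p))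
  identity = λ y m k a b → solve 6 (λ y h m k b a → y :* ((h :+ κ 2 :* m) :* ((κ 5 :- κ 2 :* k) :* b :- κ 5 :* a) :+ b :* (m :- κ 2 :* h)) :=
    (κ 5 :- κ 2 :* (κ 1 :+ k)) :* (y :* ((h :+ κ 2 :* m) :* b)) :- κ 5 :* (y :* ((h :+ κ 2 :* m) :* a :- m :* b))) refl y h m k b a

-- With k ≥ 3 parts 5 - 2 k is at most - 1, so `g-half` gives 5 g ≤ - g₀ < 0.
g-half-neg : ∀ ps → Positive ps → 3 ≤ length ps → ∀ {h} → ι 2 * h ≡ 1q → 0q ≺ h → g ps h ≺ 0q
g-half-neg ps pos-ps 3≤k {h} 2h≡1 0≺h = ⋠⇒≻ λ 0≼g → ≺⇒⋡ (g₀-pos ps 0≺h)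
  (≼-by (0≼+ (0≼+ (g-half ps pos-ps 2h≡1 0≺h) (0≼* (0≼ι 5) 0≼g)) (0≼* (0≼* (0≼ι 2) k≽3) (≺⇒≼ (g₀-pos ps 0≺h)))) (identity (ι (length ps)) (g₀ ps h) (g ps h)))
  where
  k≽3 : 0q ≼ ι (length ps) - ι 3
  k≽3 = 0≼-resp (0≼ι (length ps ℕ.∸ 3)) (trans (remove (ι 3) (ι (length ps ℕ.∸ 3))) (cong (_- ι 3) (trans (sym (ι-+ 3 (length ps ℕ.∸ 3))) (cong ι (ℕₚ.m+[n∸m]≡n 3≤k)))))
    where
    remove = solve 2 (λ a b → b := a :+ b :- a) refl
  identity = solve 3 (λ k a b → κ 0 :- a := (κ 5 :- κ 2 :* k) :* a :- κ 5 :* b :+ κ 5 :* b :+ κ 2 :* (k :- κ 3) :* a) refl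

-- Since p / (x + 2p) ≤ p / x, the quotient g / g₀ is at least 1 - (∑ p) / x, which is 0 at x = n.
g-large : ∀ ps {x} → 0q ≺ x → 0q ≼ x * g ps x - (x - ι (sum ps)) * g₀ ps x
g-large []           {x} 0≺x = 0≼-resp ≼-refl (solve 1 (λ x → κ 0 := x :* κ 1 :- (x :- κ 0) :* κ 1) refl x)
g-large (zero ∷ ps)  0≺x = g-large ps 0≺x
g-large (suc p ∷ ps) {x} 0≺x = 0≼-resp
  (0≼* (≺⇒≼ (^-pos p 0≺x)) (0≼+ (0≼* (≺⇒≼ (0≺+≽0 0≺x (0≼2ι (suc p)))) (g-large ps 0≺x)) (0≼* (0≼* (0≼2ι (suc p)) (0≼ι (suc p))) (≺⇒≼ (g₀-pos ps 0≺x)))))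
  (trans (identity (x ^ p) (ι (suc p)) (ι (sum ps)) (g ps x) (g₀ ps x))
    (cong (λ k → x * (x ^ p * ((x + ι 2 * ι (suc p)) * g ps x - ι (suc p) * g₀ ps x)) - (x - k) * (x ^ p * ((x + ι 2 * ι (suc p)) * g₀ ps x))) (sym (ι-+ (suc p) (sum ps)))))
  where
  identity = λ y m k a b → solve 6 (λ y x m a k b → y :* ((x :+ κ 2 :* m) :* (x :* a :- (x :- k) :* b) :+ κ 2 :* m :* m :* b) :=
    x :* (y :* ((x :+ κ 2 :* m) :* a :- m :* b)) :- (x :- (m :+ k)) :* (y :* ((x :+ κ 2 :* m) :* b))) refl y x m a k b

g-sum-≽0 : ∀ ps n → sum ps ≡ suc n → 0q ≼ g ps (ι (suc n))
g-sum-≽0 ps n eq = 0≼-cancel (0≺ι-suc n) (0≼-resp (g-large ps (0≺ι-suc n))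
  (trans (cong (λ k → ι (suc n) * g ps (ι (suc n)) - (ι (suc n) - ι k) * g₀ ps (ι (suc n))) eq) (tidy (ι (suc n)) (g ps (ι (suc n))) (g₀ ps (ι (suc n))))))
  where
  tidy = solve 3 (λ x a b → x :* a :- (x :- x) :* b := x :* a) refl

-- The polynomial of the part sizes and its roots

-- ev₁ and ev₂ evaluate θ c and θ² c, where θ = z d/dz.
ev₁ ev₂ : List Q → Q → Q
ev₁ []      z = 0q
ev₁ (a ∷ c) z = z * (ev c z + ev₁ c z)
ev₂ []      z = 0q
ev₂ (a ∷ c) z = z * (ev c z + ι 2 * ev₁ c z + ev₂ c z)

ev₁-addᵖ : ∀ c d z → ev₁ (addᵖ c d) z ≡ ev₁ c z + ev₁ d z
ev₁-addᵖ []      d       z = sym (+-identityˡ _)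
ev₁-addᵖ (a ∷ c) []      z = trans (sym (+-identityˡ _)) (+-comm _ _)
ev₁-addᵖ (a ∷ c) (b ∷ d) z = trans (cong₂ (λ p q → z * (p + q)) (ev-addᵖ c d z) (ev₁-addᵖ c d z)) (regroup (ev c z) (ev d z) (ev₁ c z) (ev₁ d z))
  where
  regroup = λ a b c d → solve 5 (λ z a b c d → z :* (a :+ b :+ (c :+ d)) := z :* (a :+ c) :+ z :* (b :+ d)) refl z a b c d

ev₂-addᵖ : ∀ c d z → ev₂ (addᵖ c d) z ≡ ev₂ c z + ev₂ d z
ev₂-addᵖ []      d       z = sym (+-identityˡ _)
ev₂-addᵖ (a ∷ c) []      z = trans (sym (+-identityˡ _)) (+-comm _ _)
ev₂-addᵖ (a ∷ c) (b ∷ d) z rewrite ev-addᵖ c d z | ev₁-addᵖ c d z | ev₂-addᵖ c d z = solve 7 (λ z s t u v w x → z :* (s :+ t :+ κ 2 :* (u :+ v) :+ (w :+ x)) := z :* (s :+ κ 2 :* u :+ w) :+ z :* (t :+ κ 2 :* v :+ x)) refl z (ev c z) (ev d z) (ev₁ c z) (ev₁ d z) (ev₂ c z) (ev₂ d z)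

ev₁-scaleᵖ : ∀ s c z → ev₁ (scaleᵖ s c) z ≡ s * ev₁ c z
ev₁-scaleᵖ s []      z = trans (sym (*-zeroˡ s)) (*-comm 0q s)
ev₁-scaleᵖ s (a ∷ c) z rewrite ev-scaleᵖ s c z | ev₁-scaleᵖ s c z = solve 4 (λ z s t u → z :* (s :* t :+ s :* u) := s :* (z :* (t :+ u))) refl z s (ev c z) (ev₁ c z)

ev₂-scaleᵖ : ∀ s c z → ev₂ (scaleᵖ s c) z ≡ s * ev₂ c z
ev₂-scaleᵖ s []      z = trans (sym (*-zeroˡ s)) (*-comm 0q s)
ev₂-scaleᵖ s (a ∷ c) z rewrite ev-scaleᵖ s c z | ev₁-scaleᵖ s c z | ev₂-scaleᵖ s c z = solve 5 (λ z s t u v → z :* (s :* t :+ κ 2 :* (s :* u) :+ s :* v) := s :* (z :* (t :+ κ 2 :* u :+ v))) refl z s (ev c z) (ev₁ c z) (ev₂ c z)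

-- The coefficients of ∏ (1 + 2 p z).
partPoly : List ℕ → List Q
partPoly []       = 1q ∷ []
partPoly (p ∷ ps) = addᵖ (partPoly ps) (0q ∷ scaleᵖ (ι 2 * ι p) (partPoly ps))

P P₁ P₂ : List ℕ → Q → Q
P ps = ev (partPoly ps)
P₁ ps = ev₁ (partPoly ps)
P₂ ps = ev₂ (partPoly ps)

P-∷ : ∀ p ps z → P (p ∷ ps) z ≡ (1q + ι 2 * ι p * z) * P ps z
P-∷ p ps z rewrite ev-addᵖ (partPoly ps) (0q ∷ scaleᵖ (ι 2 * ι p) (partPoly ps)) z | ev-scaleᵖ (ι 2 * ι p) (partPoly ps) z = identity (P ps z) (ι p)
  where
  identity = λ a m → solve 3 (λ a z m → a :+ (κ 0 :+ z :* (κ 2 :* m :* a)) := (κ 1 :+ κ 2 :* m :* z) :* a) refl a z m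

P₁-∷ : ∀ p ps z → P₁ (p ∷ ps) z ≡ ι 2 * ι p * z * P ps z + (1q + ι 2 * ι p * z) * P₁ ps z
P₁-∷ p ps z rewrite ev₁-addᵖ (partPoly ps) (0q ∷ scaleᵖ (ι 2 * ι p) (partPoly ps)) z | ev-scaleᵖ (ι 2 * ι p) (partPoly ps) z
  | ev₁-scaleᵖ (ι 2 * ι p) (partPoly ps) z = identity (P ps z) (P₁ ps z) (ι p)
  where
  identity = λ a b m → solve 4 (λ b z m a → b :+ z :* (κ 2 :* m :* a :+ κ 2 :* m :* b) := κ 2 :* m :* z :* a :+ (κ 1 :+ κ 2 :* m :* z) :* b) refl b z m a

P₂-∷ : ∀ p ps z → P₂ (p ∷ ps) z ≡ ι 2 * ι p * z * (P ps z + ι 2 * P₁ ps z) + (1q + ι 2 * ι p * z) * P₂ ps z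
P₂-∷ p ps z rewrite ev₂-addᵖ (partPoly ps) (0q ∷ scaleᵖ (ι 2 * ι p) (partPoly ps)) z | ev-scaleᵖ (ι 2 * ι p) (partPoly ps) z
  | ev₁-scaleᵖ (ι 2 * ι p) (partPoly ps) z | ev₂-scaleᵖ (ι 2 * ι p) (partPoly ps) z = identity (P ps z) (P₁ ps z) (P₂ ps z) (ι p)
  where
  identity = λ a b c m → solve 5 (λ c z m a b → c :+ z :* (κ 2 :* m :* a :+ κ 2 :* (κ 2 :* m :* b) :+ κ 2 :* m :* c) :=
    κ 2 :* m :* z :* (a :+ κ 2 :* b) :+ (κ 1 :+ κ 2 :* m :* z) :* c) refl c z m a b

-- With z = 1 / x each factor x + 2p is x (1 + 2 p z), and together with the powers of x the
-- exponents add up to the number of vertices.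
g₀-P : ∀ ps {x z} → x * z ≡ 1q → g₀ ps x ≡ x ^ sum ps * P ps z
g₀-P []           {x} {z} xz≡1 = solve 1 (λ z → κ 1 := κ 1 :* (κ 1 :+ z :* κ 0)) refl z
g₀-P (zero ∷ ps)  {x} {z} xz≡1 = trans (g₀-P ps xz≡1) (cong (x ^ sum ps *_) (sym (trans (P-∷ 0 ps z) (tidy (P ps z)))))
  where
  tidy = λ a → solve 2 (λ z a → (κ 1 :+ κ 2 :* κ 0 :* z) :* a := a) refl z a
g₀-P (suc p ∷ ps) {x} {z} xz≡1 = begin
  x ^ p * ((x + ι 2 * ι (suc p)) * g₀ ps x) ≡⟨ cong (λ e → x ^ p * ((x + ι 2 * ι (suc p)) * e)) (g₀-P ps xz≡1) ⟩
  x ^ p * ((x + ι 2 * ι (suc p)) * (x ^ sum ps * P ps z)) ≡⟨ identity (x ^ p) (x ^ sum ps) (ι (suc p)) (P ps z) xz≡1 ⟩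
  x * (x ^ p * x ^ sum ps) * ((1q + ι 2 * ι (suc p) * z) * P ps z) ≡⟨ cong₂ (λ y a → x * y * a) (^-+ x p (sum ps)) (P-∷ (suc p) ps z) ⟨
  x * x ^ (p ℕ.+ sum ps) * P (suc p ∷ ps) z                          ∎
  where
  identity : ∀ y w m a → x * z ≡ 1q → y * ((x + ι 2 * m) * (w * a)) ≡ x * (y * w) * ((1q + ι 2 * m * z) * a)
  identity y w m a eq = trans (solve 5 (λ y x m w a → y :* ((x :+ κ 2 :* m) :* (w :* a)) := y :* w :* a :* (x :+ κ 2 :* m :* κ 1)) refl y x m w a) (trans (cong (λ d → y * w * a * (x + ι 2 * m * d)) (sym eq)) (solve 6 (λ y w a x m z → y :* w :* a :* (x :+ κ 2 :* m :* (x :* z)) := x :* (y :* w) :* ((κ 1 :+ κ 2 :* m :* z) :* a)) refl y w a x m z))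

-- The sum of 2 p / (x + 2p) becomes the sum of 2 p z / (1 + 2 p z), the logarithmic derivative θ P
-- / P; doubling g avoids halves.
g-P : ∀ ps {x z} → x * z ≡ 1q → ι 2 * g ps x ≡ x ^ sum ps * (ι 2 * P ps z - P₁ ps z)
g-P []           {x} {z} xz≡1 = solve 1 (λ z → κ 2 :* κ 1 := κ 1 :* (κ 2 :* (κ 1 :+ z :* κ 0) :- z :* (κ 0 :+ κ 0))) refl z
g-P (zero ∷ ps)  {x} {z} xz≡1 = trans (g-P ps xz≡1) (cong₂ (λ a b → x ^ sum ps * (ι 2 * a - b))
    (sym (trans (P-∷ 0 ps z) (tidy (P ps z)))) (sym (trans (P₁-∷ 0 ps z) (tidy₁ (P ps z) (P₁ ps z)))))
  where
  tidy = λ a → solve 2 (λ z a → (κ 1 :+ κ 2 :* κ 0 :* z) :* a := a) refl z a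
  tidy₁ = λ a b → solve 3 (λ z a b → κ 2 :* κ 0 :* z :* a :+ (κ 1 :+ κ 2 :* κ 0 :* z) :* b := b) refl z a b
g-P (suc p ∷ ps) {x} {z} xz≡1 = begin
  ι 2 * (x ^ p * ((x + ι 2 * ι (suc p)) * g ps x - ι (suc p) * g₀ ps x)) ≡⟨ factor (x ^ p) (ι (suc p)) (g ps x) (g₀ ps x) ⟩
  x ^ p * ((x + ι 2 * ι (suc p)) * (ι 2 * g ps x) - ι 2 * ι (suc p) * g₀ ps x)
    ≡⟨ cong₂ (λ d e → x ^ p * ((x + ι 2 * ι (suc p)) * d - ι 2 * ι (suc p) * e)) (g-P ps xz≡1) (g₀-P ps xz≡1) ⟩
  x ^ p * ((x + ι 2 * ι (suc p)) * (x ^ sum ps * (ι 2 * P ps z - P₁ ps z)) - ι 2 * ι (suc p) * (x ^ sum ps * P ps z))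
    ≡⟨ identity (x ^ p) (x ^ sum ps) (ι (suc p)) (P ps z) (P₁ ps z) xz≡1 ⟩
  x * (x ^ p * x ^ sum ps) * (ι 2 * ((1q + ι 2 * ι (suc p) * z) * P ps z) - (ι 2 * ι (suc p) * z * P ps z + (1q + ι 2 * ι (suc p) * z) * P₁ ps z))
    ≡⟨ cong₂ (λ a b → x * (x ^ p * x ^ sum ps) * (ι 2 * a - b)) (P-∷ (suc p) ps z) (P₁-∷ (suc p) ps z) ⟨
  x * (x ^ p * x ^ sum ps) * (ι 2 * P (suc p ∷ ps) z - P₁ (suc p ∷ ps) z) ≡⟨ cong (λ y → x * y * (ι 2 * P (suc p ∷ ps) z - P₁ (suc p ∷ ps) z)) (^-+ x p (sum ps)) ⟨
  x * x ^ (p ℕ.+ sum ps) * (ι 2 * P (suc p ∷ ps) z - P₁ (suc p ∷ ps) z)      ∎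
  where
  factor = λ y m a b → solve 5 (λ y x m a b → κ 2 :* (y :* ((x :+ κ 2 :* m) :* a :- m :* b)) := y :* ((x :+ κ 2 :* m) :* (κ 2 :* a) :- κ 2 :* m :* b)) refl y x m a b
  identity : ∀ y w m a b → x * z ≡ 1q → y * ((x + ι 2 * m) * (w * (ι 2 * a - b)) - ι 2 * m * (w * a)) ≡
    x * (y * w) * (ι 2 * ((1q + ι 2 * m * z) * a) - (ι 2 * m * z * a + (1q + ι 2 * m * z) * b))
  identity y w m a b eq = trans (solve 6 (λ y x m w a b → y :* ((x :+ κ 2 :* m) :* (w :* (κ 2 :* a :- b)) :- κ 2 :* m :* (w :* a)) := y :* w :* ((x :+ κ 2 :* m :* κ 1) :* (κ 2 :* a :- b) :- κ 2 :* m :* κ 1 :* a)) refl y x m w a b)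
    (trans (cong (λ d → y * w * ((x + ι 2 * m * d) * (ι 2 * a - b) - ι 2 * m * d * a)) (sym eq)) (solve 7 (λ y w x m z a b → y :* w :* ((x :+ κ 2 :* m :* (x :* z)) :* (κ 2 :* a :- b) :- κ 2 :* m :* (x :* z) :* a) := x :* (y :* w) :* (κ 2 :* ((κ 1 :+ κ 2 :* m :* z) :* a) :- (κ 2 :* m :* z :* a :+ (κ 1 :+ κ 2 :* m :* z) :* b))) refl y w x m z a b))

-- twist t multiplies the coefficient of z ^ j by t − j, so that it evaluates t − θ.
twist : Q → List Q → List Q
twist t []      = []
twist t (a ∷ c) = t * a ∷ twist (t - 1q) c

ev-twist : ∀ t c z → ev (twist t c) z ≡ t * ev c z - ev₁ c z
ev-twist t []      z = sym (nil t)
  where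
  nil = solve 1 (λ t → t :* κ 0 :- κ 0 := κ 0) refl
ev-twist t (a ∷ c) z = trans (cong (λ e → t * a + z * e) (ev-twist (t - 1q) c z)) (identity (ev c z) (ev₁ c z))
  where
  identity = λ p q → solve 5 (λ t a z p q → t :* a :+ z :* ((t :- κ 1) :* p :- q) := t :* (a :+ z :* p) :- z :* (p :+ q)) refl t a z p q

-- Starting below 0, the multipliers t, t - 1, ... never reach 0, so no coefficient is lost.
twist-negative : ∀ t c → t ≺ 0q → All (_≡ 0q) (twist t c) → All (_≡ 0q) c
twist-negative t []      t≺0 []         = []
twist-negative t (a ∷ c) t≺0 (ta≡0 ∷ zs) = inverse-0 (proj₂ t≺0) ta≡0 ∷ twist-negative (t - 1q) c (≼-≺-trans (≼-by (0≼ι 1) (lower t)) t≺0) zs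
  where
  lower = solve 1 (λ t → t :- (t :- κ 1) := κ 1) refl

all-zero : ∀ c → All (_≡ 0q) c → ∀ z → ev c z ≡ 0q × ev₁ c z ≡ 0q × ev₂ c z ≡ 0q
all-zero []      []         z = refl , refl , refl
all-zero (a ∷ c) (refl ∷ zs) z with all-zero c zs z
... | e , e₁ , e₂ rewrite e | e₁ | e₂ = (solve 1 (λ z → κ 0 :+ z :* κ 0 := κ 0) refl z) , (solve 1 (λ z → z :* (κ 0 :+ κ 0) := κ 0) refl z) , (solve 1 (λ z → z :* (κ 0 :+ κ 2 :* κ 0 :+ κ 0) := κ 0) refl z)

-- θ D = 2 D forces D = q z².
euler : ∀ c → All (_≡ 0q) (twist (ι 2) c) → Σ Q λ q → ∀ z → ev c z ≡ q * (z * z) × ev₁ c z ≡ ι 2 * q * (z * z) × ev₂ c z ≡ ι 4 * q * (z * z)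
euler []              _ = 0q , λ z → (solve 1 (λ z → κ 0 := κ 0 :* (z :* z)) refl z) , (solve 1 (λ z → κ 0 := κ 2 :* κ 0 :* (z :* z)) refl z) , (solve 1 (λ z → κ 0 := κ 4 :* κ 0 :* (z :* z)) refl z)
euler (a ∷ [])        (a≡ ∷ _) = 0q , λ z → trans (cong (_+ z * 0q) (inverse-0 (0≺⇒≢0 (0≺ι-suc 1)) a≡)) (solve 1 (λ z → κ 0 :+ z :* κ 0 := κ 0 :* (z :* z)) refl z) , (solve 1 (λ z → z :* (κ 0 :+ κ 0) := κ 2 :* κ 0 :* (z :* z)) refl z) , (solve 1 (λ z → z :* (κ 0 :+ κ 2 :* κ 0 :+ κ 0) := κ 4 :* κ 0 :* (z :* z)) refl z)
euler (a ∷ b ∷ [])    (a≡ ∷ b≡ ∷ _) = 0q , λ z → values z (inverse-0 (0≺⇒≢0 (0≺ι-suc 1)) a≡) (trans (sym (unit b)) b≡)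
  where
  unit = solve 1 (λ b → (κ 2 :- κ 1) :* b := b) refl
  values : ∀ z {a b} → a ≡ 0q → b ≡ 0q → ev (a ∷ b ∷ []) z ≡ 0q * (z * z) × ev₁ (a ∷ b ∷ []) z ≡ ι 2 * 0q * (z * z) × ev₂ (a ∷ b ∷ []) z ≡ ι 4 * 0q * (z * z)
  values z refl refl = (solve 1 (λ z → κ 0 :+ z :* (κ 0 :+ z :* κ 0) := κ 0 :* (z :* z)) refl z) , (solve 1 (λ z → z :* (κ 0 :+ z :* κ 0 :+ z :* (κ 0 :+ κ 0)) := κ 2 :* κ 0 :* (z :* z)) refl z) , (solve 1 (λ z → z :* (κ 0 :+ z :* κ 0 :+ κ 2 :* (z :* (κ 0 :+ κ 0)) :+ z :* (κ 0 :+ κ 2 :* κ 0 :+ κ 0)) := κ 4 :* κ 0 :* (z :* z)) refl z)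
euler (a ∷ b ∷ q ∷ c) (a≡ ∷ b≡ ∷ _ ∷ rest) = q , λ z →
    values z (inverse-0 (0≺⇒≢0 (0≺ι-suc 1)) a≡) (trans (sym (unit b)) b≡) (all-zero c (twist-negative (ι 2 - 1q - 1q - 1q) c (≺-by 0≺1 (solve 0 (κ 0 :- (κ 2 :- κ 1 :- κ 1 :- κ 1) := κ 1) refl)) rest) z)
  where
  unit = solve 1 (λ b → (κ 2 :- κ 1) :* b := b) refl
  values : ∀ z {a b} → a ≡ 0q → b ≡ 0q → ev c z ≡ 0q × ev₁ c z ≡ 0q × ev₂ c z ≡ 0q →
    ev (a ∷ b ∷ q ∷ c) z ≡ q * (z * z) × ev₁ (a ∷ b ∷ q ∷ c) z ≡ ι 2 * q * (z * z) × ev₂ (a ∷ b ∷ q ∷ c) z ≡ ι 4 * q * (z * z)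
  values z refl refl (e , e₁ , e₂) rewrite e | e₁ | e₂ = (solve 2 (λ z q → κ 0 :+ z :* (κ 0 :+ z :* (q :+ z :* κ 0)) := q :* (z :* z)) refl z q) , (solve 2 (λ z q → z :* (κ 0 :+ z :* (q :+ z :* κ 0) :+ z :* (q :+ z :* κ 0 :+ z :* (κ 0 :+ κ 0))) := κ 2 :* q :* (z :* z)) refl z q) , (solve 2 (λ z q → z :* (κ 0 :+ z :* (q :+ z :* κ 0) :+ κ 2 :* (z :* (q :+ z :* κ 0 :+ z :* (κ 0 :+ κ 0))) :+ z :* (q :+ z :* κ 0 :+ κ 2 :* (z :* (κ 0 :+ κ 0)) :+ z :* (κ 0 :+ κ 2 :* κ 0 :+ κ 0))) := κ 4 :* q :* (z :* z)) refl z q)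

-- T = (θ P)² − P θ² P is − P² θ² log P = − Σ a P² / (1 + a)² with a = 2 q z < 0.
T-form : List ℕ → Q → Q
T-form qs z = P₁ qs z * P₁ qs z - P qs z * P₂ qs z

T-form-∷ : ∀ q qs z → T-form (q ∷ qs) z ≡ (1q + ι 2 * ι q * z) * (1q + ι 2 * ι q * z) * T-form qs z + ι 2 * ι q * (0q - z) * (P qs z * P qs z)
T-form-∷ q qs z = trans (cong₂ (λ a b → a * a - P (q ∷ qs) z * b) (P₁-∷ q qs z) (P₂-∷ q qs z)) (trans (cong
    (λ a → (ι 2 * ι q * z * P qs z + (1q + ι 2 * ι q * z) * P₁ qs z) * (ι 2 * ι q * z * P qs z + (1q + ι 2 * ι q * z) * P₁ qs z)
           - a * (ι 2 * ι q * z * (P qs z + ι 2 * P₁ qs z) + (1q + ι 2 * ι q * z) * P₂ qs z)) (P-∷ q qs z)) (identity (ι q) (P qs z) (P₁ qs z) (P₂ qs z)))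
  where
  identity = λ m a b c → solve 5 (λ m z a b c → (κ 2 :* m :* z :* a :+ (κ 1 :+ κ 2 :* m :* z) :* b) :* (κ 2 :* m :* z :* a :+ (κ 1 :+ κ 2 :* m :* z) :* b) :- (κ 1 :+ κ 2 :* m :* z) :* a :* (κ 2 :* m :* z :* (a :+ κ 2 :* b) :+ (κ 1 :+ κ 2 :* m :* z) :* c) :=
    (κ 1 :+ κ 2 :* m :* z) :* (κ 1 :+ κ 2 :* m :* z) :* (b :* b :- a :* c) :+ κ 2 :* m :* (κ 0 :- z) :* (a :* a)) refl m z a b c

T-form-≽0 : ∀ qs {z} → z ≺ 0q → 0q ≼ T-form qs z
T-form-≽0 []       {z} z≺0 = 0≼-resp ≼-refl (solve 1 (λ z → κ 0 := z :* (κ 0 :+ κ 0) :* (z :* (κ 0 :+ κ 0)) :- (κ 1 :+ z :* κ 0) :* (z :* (κ 0 :+ κ 2 :* κ 0 :+ κ 0))) refl z)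
T-form-≽0 (q ∷ qs) {z} z≺0 = 0≼-resp (0≼+ (0≼* (0≼sq _) (T-form-≽0 qs z≺0)) (0≼* (0≼* (0≼2ι q) (≺⇒≼ (≺⇒0≺- z≺0))) (0≼sq _))) (sym (T-form-∷ q qs z))

-- Both summands of `T-form-∷` are nonnegative, so the one containing the square of P qs z vanishes;
-- its coefficient is positive because z is negative and the part is nonempty.
T-form-zero : ∀ q qs {z} → z ≺ 0q → T-form (suc q ∷ qs) z ≡ 0q → P (suc q ∷ qs) z ≡ 0q
T-form-zero q qs {z} z≺0 T≡0 = trans (P-∷ (suc q) qs z) (trans (cong ((1q + ι 2 * ι (suc q) * z) *_) P′≡0) (nil (1q + ι 2 * ι (suc q) * z)))
  where
  nil = solve 1 (λ a → a :* κ 0 := κ 0) refl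
  summand : 0q ≼ (1q + ι 2 * ι (suc q) * z) * (1q + ι 2 * ι (suc q) * z) * T-form qs z
  summand = 0≼* (0≼sq _) (T-form-≽0 qs z≺0)
  0≺c : 0q ≺ ι 2 * ι (suc q) * (0q - z)
  0≺c = 0≺* (0≺* (0≺ι-suc 1) (0≺ι-suc q)) (≺⇒0≺- z≺0)
  P′²≼0 : ι 2 * ι (suc q) * (0q - z) * (P qs z * P qs z) ≼ 0q
  P′²≼0 = ≼-by summand (split _ _ (trans (sym (T-form-∷ (suc q) qs z)) T≡0))
    where
    split : ∀ a b → a + b ≡ 0q → 0q - b ≡ a
    split a b eq = trans (cong (_- b) (sym eq)) (solve 2 (λ a b → a :+ b :- b := a) refl a b)
  P′≡0 : P qs z ≡ 0q
  P′≡0 = [ id , id ]′ (*≡0⇒ _ _ (inverse-0 (0≺⇒≢0 0≺c) (≼-antisym P′²≼0 (0≼* (≺⇒≼ 0≺c) (0≼sq _)))))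

-- At z ≠ 0 these express multiplicity at least 1, 2 and 3, with θ in the role of the derivative.
-- Each repeated factor 1 + 2 m z raises the multiplicity by one.
Root₁ Root₂ Root₃ : List ℕ → Q → Set
Root₁ ps z = P ps z ≡ 0q
Root₂ ps z = Root₁ ps z × P₁ ps z ≡ 0q
Root₃ ps z = Root₂ ps z × P₂ ps z ≡ 0q

RootOf : ℕ → Q → Set
RootOf m z = 1q + ι 2 * ι m * z ≡ 0q

root₁ : ∀ {m} ps {z} → RootOf m z → Root₁ (m ∷ ps) z
root₁ {m} ps {z} root = trans (P-∷ m ps z) (trans (cong (_* P ps z) root) (*-zeroˡ _))

root₂ : ∀ {m} ps {z} → RootOf m z → Root₁ ps z → Root₂ (m ∷ ps) z
root₂ {m} ps {z} root r₁ = root₁ {m} ps root , trans (P₁-∷ m ps z) (trans (cong₂ (λ a b → ι 2 * ι m * z * a + b * P₁ ps z) r₁ root) (nil (ι 2 * ι m * z) (P₁ ps z)))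
  where
  nil = solve 2 (λ a b → a :* κ 0 :+ κ 0 :* b := κ 0) refl

root₃ : ∀ {m} ps {z} → RootOf m z → Root₂ ps z → Root₃ (m ∷ ps) z
root₃ {m} ps {z} root (r₁ , r₂) = root₂ {m} ps root r₁ ,
  trans (P₂-∷ m ps z) (trans (cong₂ (λ a b → ι 2 * ι m * z * (a + ι 2 * b) + (1q + ι 2 * ι m * z) * P₂ ps z) r₁ r₂)
    (trans (cong (λ c → ι 2 * ι m * z * (0q + ι 2 * 0q) + c * P₂ ps z) root) (nil (ι 2 * ι m * z) (P₂ ps z))))
  where
  nil = solve 2 (λ a b → a :* (κ 0 :+ κ 2 :* κ 0) :+ κ 0 :* b := κ 0) refl

root₃-∷ : ∀ p ps {z} → Root₃ ps z → Root₃ (p ∷ ps) z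
root₃-∷ p ps {z} ((r₁ , r₂) , r₃) =
  (trans (P-∷ p ps z) (trans (cong (a *_) r₁) (nil a)) ,
   trans (P₁-∷ p ps z) (trans (cong₂ (λ u v → b * u + a * v) r₁ r₂) (nil₂ a b))) ,
  trans (P₂-∷ p ps z) (trans (cong₂ (λ u v → b * (u + ι 2 * v) + a * P₂ ps z) r₁ r₂) (trans (cong (λ u → b * (0q + ι 2 * 0q) + a * u) r₃) (nil₃ a b)))
  where
  a = 1q + ι 2 * ι p * z
  b = ι 2 * ι p * z
  nil = solve 1 (λ a → a :* κ 0 := κ 0) refl
  nil₂ = solve 2 (λ a b → b :* κ 0 :+ a :* κ 0 := κ 0) refl
  nil₃ = solve 2 (λ a b → b :* (κ 0 :+ κ 2 :* κ 0) :+ a :* κ 0 := κ 0) refl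

root₃-++ : ∀ xs ps {z} → Root₃ ps z → Root₃ (xs List.++ ps) z
root₃-++ []       ps r = r
root₃-++ (x ∷ xs) ps r = root₃-∷ x (xs List.++ ps) (root₃-++ xs ps r)

triple-root : ∀ rn → All (λ p → 1 ≤ proj₁ p × 1 ≤ proj₂ p) rn → Any (λ p → 3 ≤ proj₁ p) rn →
              Σ ℕ λ m → ∀ {z} → RootOf (suc m) z → Root₃ (partSizes rn) z
triple-root ((suc (suc (suc r)) , suc m) ∷ rn) ((_ , _) ∷ _) (here (ℕ.s≤s (ℕ.s≤s (ℕ.s≤s _)))) =
  m , λ root → root₃ {suc m} (suc m ∷ suc m ∷ rest) root (root₂ {suc m} (suc m ∷ rest) root (root₁ {suc m} rest root))
  where
  rest = List.replicate r (suc m) List.++ partSizes rn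
triple-root ((suc zero , _) ∷ _) _ (here (ℕ.s≤s ()))
triple-root ((suc (suc zero) , _) ∷ _) _ (here (ℕ.s≤s (ℕ.s≤s ())))
triple-root ((r , m) ∷ rn) (_ ∷ all) (there any) with triple-root rn all any
... | m′ , roots = m′ , λ root → root₃-++ (List.replicate r m) (partSizes rn) (roots root)

unit-fraction : ∀ m → Σ Q λ z → RootOf (suc m) z × z ≺ 0q
unit-fraction m = go (inverse-pos (0≺* (0≺ι-suc 1) (0≺ι-suc m)))
  where
  go : (Σ Q λ r → 0q ≺ r × ι 2 * ι (suc m) * r ≡ 1q) → Σ Q λ z → RootOf (suc m) z × z ≺ 0q
  go (r , 0≺r , eq) = - r , trans (negate (ι 2 * ι (suc m)) r) (trans (cong (λ s → 1q - s) eq) (solve 0 (κ 1 :- κ 1 := κ 0) refl)) , ≺-by 0≺r (minus r)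
    where
    negate = solve 2 (λ a r → κ 1 :+ a :* :- r := κ 1 :- a :* r) refl
    minus = solve 1 (λ r → κ 0 :- :- r := r) refl

reciprocal : ∀ i → Σ Q λ r → ι (suc i) * r ≡ 1q
reciprocal i = proj₁ (inverse-pos (0≺ι-suc i)) , proj₂ (proj₂ (inverse-pos (0≺ι-suc i)))

reciprocal-injective : ∀ {i j} → proj₁ (reciprocal i) ≡ proj₁ (reciprocal j) → i ≡ j
reciprocal-injective {i} {j} eq = ℕₚ.suc-injective (ι-injective (begin
  ι (suc i) ≡⟨ *-identityˡ _ ⟨
  1q * ι (suc i) ≡⟨ cong (_* ι (suc i)) (proj₂ (reciprocal j)) ⟨
  ι (suc j) * proj₁ (reciprocal j) * ι (suc i) ≡⟨ cong (λ r → ι (suc j) * r * ι (suc i)) eq ⟨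
  ι (suc j) * proj₁ (reciprocal i) * ι (suc i) ≡⟨ rotate (ι (suc j)) (proj₁ (reciprocal i)) (ι (suc i)) ⟩
  ι (suc i) * proj₁ (reciprocal i) * ι (suc j) ≡⟨ cong (_* ι (suc j)) (proj₂ (reciprocal i)) ⟩
  1q * ι (suc j) ≡⟨ *-identityˡ _ ⟩
  ι (suc j)                                          ∎))
  where
  rotate = solve 3 (λ a b c → a :* b :* c := c :* b :* a) refl

0≺⇒^≢0 : ∀ {x} n → 0q ≺ x → x ^ n ≢ 0q
0≺⇒^≢0 n 0≺x = 0≺⇒≢0 (^-pos n 0≺x)

-- P ps and P qs differ by a multiple q z², and at the triple root of P ps the form T of qs vanishes,
-- which leaves only q = 0.
P-determined : ∀ ps q qs m → (∀ {z} → RootOf (suc m) z → Root₃ ps z) → sum ps ≡ sum (suc q ∷ qs) →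
               (∀ x → g ps x ≡ g (suc q ∷ qs) x) → ∀ z → P ps z ≡ P (suc q ∷ qs) z
P-determined ps q qs m roots sums same z = conclude (euler D (coefficients-vanish (twist (ι 2) D) twisted))
  where
  rs = suc q ∷ qs
  D = addᵖ (partPoly ps) (scaleᵖ (- 1q) (partPoly rs))

  difference = solve 2 (λ a b → a :+ :- κ 1 :* b := a :- b) refl

  ev-D : ∀ z → ev D z ≡ P ps z - P rs z
  ev-D z = trans (ev-addᵖ (partPoly ps) _ z) (trans (cong (P ps z +_) (ev-scaleᵖ (- 1q) (partPoly rs) z)) (difference _ _))
  ev₁-D : ∀ z → ev₁ D z ≡ P₁ ps z - P₁ rs z
  ev₁-D z = trans (ev₁-addᵖ (partPoly ps) _ z) (trans (cong (P₁ ps z +_) (ev₁-scaleᵖ (- 1q) (partPoly rs) z)) (difference _ _))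
  ev₂-D : ∀ z → ev₂ D z ≡ P₂ ps z - P₂ rs z
  ev₂-D z = trans (ev₂-addᵖ (partPoly ps) _ z) (trans (cong (P₂ ps z +_) (ev₂-scaleᵖ (- 1q) (partPoly rs) z)) (difference _ _))

  -- `g-P` relates z to x = 1 / z, so the comparison is made at z = 1 / (i + 1); these are
  -- infinitely many points, enough for a polynomial identity.
  at-reciprocal : ∀ i → ev (twist (ι 2) D) (proj₁ (reciprocal i)) ≡ 0q
  at-reciprocal i = trans (ev-twist (ι 2) D s) (trans (cong₂ (λ a b → ι 2 * a - b) (ev-D s) (ev₁-D s))
      (trans (regroup (P ps s) (P rs s) (P₁ ps s) (P₁ rs s)) (≡⇒-≡0 (*-cancelˡ (0≺⇒^≢0 (sum ps) (0≺ι-suc i)) (begin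
        x ^ sum ps * (ι 2 * P ps s - P₁ ps s) ≡⟨ g-P ps (proj₂ (reciprocal i)) ⟨
        ι 2 * g ps x ≡⟨ cong (ι 2 *_) (same x) ⟩
        ι 2 * g rs x ≡⟨ g-P rs (proj₂ (reciprocal i)) ⟩
        x ^ sum rs * (ι 2 * P rs s - P₁ rs s) ≡⟨ cong (λ n → x ^ n * (ι 2 * P rs s - P₁ rs s)) sums ⟨
        x ^ sum ps * (ι 2 * P rs s - P₁ rs s)      ∎)))))
    where
    s = proj₁ (reciprocal i)
    x = ι (suc i)
    regroup = solve 4 (λ a b c d → κ 2 :* (a :- b) :- (c :- d) := κ 2 :* a :- c :- (κ 2 :* b :- d)) refl

  twisted : ∀ z → ev (twist (ι 2) D) z ≡ 0q
  twisted = vanishes-everywhere (length (twist (ι 2) D)) (twist (ι 2) D) refl (λ i → proj₁ (reciprocal i)) reciprocal-injective at-reciprocal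

  conclude : (Σ Q λ q → ∀ z → ev D z ≡ q * (z * z) × ev₁ D z ≡ ι 2 * q * (z * z) × ev₂ D z ≡ ι 4 * q * (z * z)) → P ps z ≡ P rs z
  conclude (q′ , D≡) = -≡0⇒≡ (trans (sym (ev-D z)) (trans (proj₁ (D≡ z)) (trans (cong (_* (z * z)) q′≡0) (*-zeroˡ _))))
    where
    at-root : (Σ Q λ z → RootOf (suc m) z × z ≺ 0q) → q′ ≡ 0q
    at-root (z₀ , root , z₀≺0) = [ id , (λ z₀²≡0 → contradiction z₀²≡0 (0≺⇒≢0 (0≺sq (proj₂ z₀≺0)))) ]′ (*≡0⇒ q′ (z₀ * z₀) q′z₀²≡0)
      where
      root-of-ps = roots root
      solve-for : ∀ {a b c} → c ≡ a - b → a ≡ 0q → b ≡ - c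
      solve-for {a} {b} refl refl = solve 1 (λ b → b := :- (κ 0 :- b)) refl b
      P≡ : P rs z₀ ≡ - (q′ * (z₀ * z₀))
      P≡ = solve-for (trans (sym (proj₁ (D≡ z₀))) (ev-D z₀)) (proj₁ (proj₁ root-of-ps))
      P₁≡ : P₁ rs z₀ ≡ - (ι 2 * q′ * (z₀ * z₀))
      P₁≡ = solve-for (trans (sym (proj₁ (proj₂ (D≡ z₀)))) (ev₁-D z₀)) (proj₂ (proj₁ root-of-ps))
      P₂≡ : P₂ rs z₀ ≡ - (ι 4 * q′ * (z₀ * z₀))
      P₂≡ = solve-for (trans (sym (proj₂ (proj₂ (D≡ z₀)))) (ev₂-D z₀)) (proj₂ root-of-ps)
      -- The three values are - q′ z₀² times 1, 2 and 4, and 2² = 1 · 4.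
      T≡0 : T-form rs z₀ ≡ 0q
      T≡0 = trans (cong₂ (λ a b → a * a - b * P₂ rs z₀) P₁≡ P≡) (trans (cong (λ c → - (ι 2 * q′ * (z₀ * z₀)) * - (ι 2 * q′ * (z₀ * z₀)) - - (q′ * (z₀ * z₀)) * c) P₂≡) (cancel q′ (z₀ * z₀)))
        where
        cancel = solve 2 (λ q w → :- (κ 2 :* q :* w) :* :- (κ 2 :* q :* w) :- :- (q :* w) :* :- (κ 4 :* q :* w) := κ 0) refl
      q′z₀²≡0 : q′ * (z₀ * z₀) ≡ 0q
      q′z₀²≡0 = trans (double-negation (q′ * (z₀ * z₀))) (trans (cong -_ (trans (sym P≡) (T-form-zero q qs z₀≺0 T≡0))) (solve 0 (:- κ 0 := κ 0) refl))
        where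
        double-negation = solve 1 (λ a → a := :- (:- a)) refl
    q′≡0 : q′ ≡ 0q
    q′≡0 = at-root (unit-fraction m)

-- A vanishing product has a vanishing factor, and at z ≠ 0 the equation 1 + 2 q z = 0 determines q.
-- That part is moved to the front.
root-is-part : ∀ {p} qs {z} → RootOf p z → z ≺ 0q → P qs z ≡ 0q → Positive qs →
               Σ (List ℕ) λ rs → qs ↭ p ∷ rs × Positive rs × (∀ z → P qs z ≡ P (p ∷ rs) z)
root-is-part []       {z} root z≺0 Pz≡0 _ = contradiction (trans (sym (unit z)) Pz≡0) 1≢0
  where
  unit = solve 1 (λ z → κ 1 :+ z :* κ 0 := κ 1) refl
root-is-part {p} (q ∷ qs) {z} root z≺0 Pz≡0 (1≤q ∷ pos-qs) with *≡0⇒ (1q + ι 2 * ι q * z) (P qs z) (trans (sym (P-∷ q qs z)) Pz≡0)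
... | inj₁ q-root = qs , subst (λ r → q ∷ qs ↭ r ∷ qs) q≡p ↭-refl , pos-qs , λ z → cong (λ r → P (r ∷ qs) z) q≡p
  where
  q≡p : q ≡ p
  q≡p = ι-injective (*-cancelˡ {ι 2 * z} (λ eq → contradiction (inverse-0 (0≺⇒≢0 (0≺ι-suc 1)) eq) (proj₂ z≺0))
    (-≡0⇒≡ (trans (factor (ι q) (ι p) z) (trans (cong₂ _-_ q-root root) (solve 0 (κ 0 :- κ 0 := κ 0) refl)))))
    where
    factor = solve 3 (λ a b z → κ 2 :* z :* a :- κ 2 :* z :* b := κ 1 :+ κ 2 :* a :* z :- (κ 1 :+ κ 2 :* b :* z)) refl
... | inj₂ rest≡0 = extend (root-is-part qs root z≺0 rest≡0 pos-qs)
  where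
  extend : (Σ (List ℕ) λ rs → qs ↭ p ∷ rs × Positive rs × (∀ z → P qs z ≡ P (p ∷ rs) z)) →
           Σ (List ℕ) λ rs → q ∷ qs ↭ p ∷ rs × Positive rs × (∀ z → P (q ∷ qs) z ≡ P (p ∷ rs) z)
  extend (rs , perm , pos-rs , same) = q ∷ rs , ↭-trans (prep q perm) (swap q p ↭-refl) , 1≤q ∷ pos-rs , λ z → begin
    P (q ∷ qs) z ≡⟨ P-∷ q qs z ⟩
    (1q + ι 2 * ι q * z) * P qs z ≡⟨ cong ((1q + ι 2 * ι q * z) *_) (trans (same z) (P-∷ p rs z)) ⟩
    (1q + ι 2 * ι q * z) * ((1q + ι 2 * ι p * z) * P rs z) ≡⟨ exchange′ (1q + ι 2 * ι q * z) (1q + ι 2 * ι p * z) (P rs z) ⟩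
    (1q + ι 2 * ι p * z) * ((1q + ι 2 * ι q * z) * P rs z) ≡⟨ cong ((1q + ι 2 * ι p * z) *_) (P-∷ q rs z) ⟨
    (1q + ι 2 * ι p * z) * P (q ∷ rs) z ≡⟨ P-∷ p (q ∷ rs) z ⟨
    P (p ∷ q ∷ rs) z                                                    ∎
    where
    exchange′ = solve 3 (λ a b c → a :* (b :* c) := b :* (a :* c)) refl

-- A part of the first list gives a root, hence the same part in the second. The common factor is
-- cancelled at the natural numbers, where it is positive, and these are enough points to compare
-- the remaining products.
P-injective : ∀ ps qs → Positive ps → Positive qs → (∀ z → P ps z ≡ P qs z) → ps ↭ qs
P-injective []           []           _ _ same = ↭-refl
P-injective []           (zero ∷ qs)  _ (() ∷ _) _
P-injective []           (suc q ∷ qs) _ _ same = ⊥-elim (1≢0 (no-root (unit-fraction q)))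
  where
  unit = solve 1 (λ z → κ 1 :+ z :* κ 0 := κ 1) refl
  no-root : (Σ Q λ z → RootOf (suc q) z × z ≺ 0q) → 1q ≡ 0q
  no-root (z , root , _) = trans (sym (unit z)) (trans (same z) (root₁ {suc q} qs root))
P-injective (suc p ∷ ps) qs           (_ ∷ pos-ps) pos-qs same = go (unit-fraction p)
  where
  go : (Σ Q λ z → RootOf (suc p) z × z ≺ 0q) → suc p ∷ ps ↭ qs
  go (z , root , z≺0) = finish (root-is-part qs root z≺0 (trans (sym (same z)) (root₁ {suc p} ps root)) pos-qs)
    where
    finish : (Σ (List ℕ) λ rs → qs ↭ suc p ∷ rs × Positive rs × (∀ z → P qs z ≡ P (suc p ∷ rs) z)) → suc p ∷ ps ↭ qs
    finish (rs , perm , pos-rs , qs≡) = ↭-trans (prep (suc p) (P-injective ps rs pos-ps pos-rs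
        (agree-everywhere (partPoly ps , λ _ → refl) (partPoly rs , λ _ → refl) ι ι-injective cancelled))) (↭-sym perm)
      where
      cancelled : ∀ i → P ps (ι i) ≡ P rs (ι i)
      cancelled i = *-cancelˡ (0≺⇒≢0 (0≺+≽0 0≺1 (0≼* (0≼2ι (suc p)) (0≼ι i))))
        (trans (sym (P-∷ (suc p) ps (ι i))) (trans (trans (same (ι i)) (qs≡ (ι i))) (P-∷ (suc p) rs (ι i))))

-- Two-graphs

signed : Bool → Q
signed true  = - 1q
signed false = 1q

signed-xor : ∀ x y → signed (x xor y) ≡ signed x * signed y
signed-xor true  true  = solve 0 (κ 1 := :- κ 1 :* :- κ 1) refl
signed-xor true  false = solve 0 (:- κ 1 := :- κ 1 :* κ 1) refl
signed-xor false y     = sym (*-identityˡ (signed y))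

signed² : ∀ x → signed x * signed x ≡ 1q
signed² true  = solve 0 (:- κ 1 :* :- κ 1 := κ 1) refl
signed² false = solve 0 (κ 1 :* κ 1 := κ 1) refl

∣signed∣≼1 : ∀ x → ∣ signed x ∣≼ 1q
∣signed∣≼1 true  = bounds (0≼-resp (0≼ι 0) (solve 0 (κ 0 := κ 1 :- κ 1) refl)) (0≼-resp (0≼ι 2) (solve 0 (κ 2 := κ 1 :- :- κ 1) refl))
∣signed∣≼1 false = bounds (0≼-resp (0≼ι 2) (solve 0 (κ 2 := κ 1 :+ κ 1) refl)) (0≼-resp (0≼ι 0) (solve 0 (κ 0 := κ 1 :- κ 1) refl))

combination : ∀ {k n} → (Fin k → Q) → (Fin k → Fin n) → Vector n
combination c v i = ∑ (λ p → c p * δ (v p) i)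

∙-combination : ∀ {k n} (y : Vector n) (c : Fin k → Q) (v : Fin k → Fin n) → y ∙ combination c v ≡ ∑ (λ p → c p * y (v p))
∙-combination y c v = begin
  ∑ (λ i → y i * ∑ (λ p → c p * δ (v p) i)) ≡⟨ ∑-cong (λ i → ∑-*ˡ (y i) (λ p → c p * δ (v p) i)) ⟨
  ∑ (λ i → ∑ (λ p → y i * (c p * δ (v p) i))) ≡⟨ ∑-swap (λ i p → y i * (c p * δ (v p) i)) ⟩
  ∑ (λ p → ∑ (λ i → y i * (c p * δ (v p) i))) ≡⟨ ∑-cong (λ p → trans (∑-cong (λ i → regroup (y i) (c p) (δ (v p) i))) (trans (∑-*ˡ (c p) (λ i → δ (v p) i * y i)) (cong (c p *_) (∑-δ (v p) y)))) ⟩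
  ∑ (λ p → c p * y (v p))                          ∎
  where
  regroup = solve 3 (λ y c d → y :* (c :* d) := c :* (d :* y)) refl

combination-quadratic : ∀ {k n} (A : Matrix n) (c : Fin k → Q) (v : Fin k → Fin n) →
  combination c v ∙ A ⊛ combination c v ≡ ∑ (λ p → ∑ (λ q → c p * (c q * A (v p) (v q))))
combination-quadratic A c v = trans (∙-comm (combination c v) (A ⊛ combination c v))
  (trans (∙-combination (A ⊛ combination c v) c v)
    (∑-cong (λ p → trans (cong (c p *_) (∙-combination (A (v p)) c v)) (sym (∑-*ˡ (c p) (λ q → c q * A (v p) (v q)))))))

open xor-∧-Solver using () renaming (solve to solve₂; _:+_ to _⊕_; _:=_ to _⊜_; con to bit)

-- tri i j l holds when the number of edges in i, j, l is odd; these triples form the two-graph of H,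
-- and switching does not change it.
module TwoGraph {n} (H : Graph n) where

  tri : Fin n → Fin n → Fin n → Bool
  tri i j l = (adj H i j xor adj H i l) xor adj H j l

  tri-swap₁₂ : ∀ i j l → tri j i l ≡ tri i j l
  tri-swap₁₂ i j l rewrite D.Graph.sym H j i = solve₂ 3 (λ x y z → x ⊕ z ⊕ y ⊜ x ⊕ y ⊕ z) refl (adj H i j) (adj H i l) (adj H j l)

  tri-swap₂₃ : ∀ i j l → tri i l j ≡ tri i j l
  tri-swap₂₃ i j l rewrite D.Graph.sym H l j = solve₂ 3 (λ x y z → y ⊕ x ⊕ z ⊜ x ⊕ y ⊕ z) refl (adj H i j) (adj H i l) (adj H j l)

  tri-rotate : ∀ i j l → tri l i j ≡ tri i j l
  tri-rotate i j l = trans (tri-swap₁₂ i l j) (tri-swap₂₃ i j l)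

  tri-iil : ∀ i l → tri i i l ≡ false
  tri-iil i l rewrite D.irrefl H i with adj H i l
  ... | true  = refl
  ... | false = refl

  tri-ijj : ∀ i j → tri i j j ≡ false
  tri-ijj i j = trans (sym (tri-rotate i j j)) (trans (tri-swap₂₃ j j i) (tri-iil j i))

  -- Each of the six edges on four vertices lies in exactly two of the four triples, so the number
  -- of odd triples is even.
  tri-cocycle : ∀ i j k l → tri j k l ≡ (tri i j k xor tri i j l) xor tri i k l
  tri-cocycle i j k l = solve₂ 6
    (λ ij ik il jk jl kl → jk ⊕ jl ⊕ kl ⊜ ((ij ⊕ ik ⊕ jk) ⊕ (ij ⊕ il ⊕ jl)) ⊕ (ik ⊕ il ⊕ kl)) refl
    (adj H i j) (adj H i k) (adj H i l) (adj H j k) (adj H j l) (adj H k l)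

  Twin : Fin n → Fin n → Set
  Twin i j = ∀ l → tri i j l ≡ false

  twin? : ∀ i j → Dec (Twin i j)
  twin? i j = all? (λ l → tri i j l Bool.≟ false)

  twin-refl : ∀ i → Twin i i
  twin-refl i l = tri-iil i l

  twin-sym : ∀ {i j} → Twin i j → Twin j i
  twin-sym {i} {j} tw l = trans (tri-swap₁₂ i j l) (tw l)

  twin-trans : ∀ {i j k} → Twin i j → Twin j k → Twin i k
  twin-trans {i} {j} {k} ij jk l = sym (trans (sym (jk l)) (trans (tri-cocycle i j k l) (cong₂ (λ x y → (x xor y) xor tri i k l) (ij k) (ij l))))

  not-twin : ∀ {i j} → ¬ Twin i j → Σ (Fin n) λ l → tri i j l ≡ true
  not-twin {i} {j} ¬tw with ¬∀⟶∃¬ n (λ l → tri i j l ≡ false) (λ l → tri i j l Bool.≟ false) ¬tw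
  ... | l , ≢false = l , true-of (tri i j l) ≢false
    where
    true-of : ∀ b → b ≢ false → b ≡ true
    true-of true  _  = refl
    true-of false ≢f = contradiction refl ≢f

  M : Matrix n
  M i j = signed (adj H i j)

  M-sym : Symmetric M
  M-sym i j = cong signed (D.Graph.sym H i j)

  -- Switching so that l becomes isolated multiplies entry (i , j) by `M l i * M l j`, and the
  -- adjacency that remains is `tri l i j`.
  M-tri : ∀ l i j → M i j ≡ M l i * M l j * signed (tri l i j)
  M-tri l i j = trans (cong signed (solve₂ 3 (λ x y z → z ⊜ (x ⊕ y) ⊕ (x ⊕ y ⊕ z)) refl (adj H l i) (adj H l j) (adj H i j)))
    (trans (signed-xor (adj H l i xor adj H l j) (tri l i j)) (cong (_* signed (tri l i j)) (signed-xor (adj H l i) (adj H l j))))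

  module _ (l : Fin n) {k} (v : Fin k → Fin n) (v-injective : ∀ {p q} → v p ≡ v q → p ≡ q)
           (E : Fin k → Fin k → Bool) (E≡ : ∀ p q → tri l (v p) (v q) ≡ E p q) where

    weighted : (Fin k → Q) → Vector n
    weighted u = combination (λ p → M l (v p) * u p) v

    weighted-linear : ∀ a b s t i → a * weighted s i + b * weighted t i ≡ weighted (λ p → a * s p + b * t p) i
    weighted-linear a b s t i = trans (sym (∑-lin a b (λ p → M l (v p) * s p * δ (v p) i) (λ p → M l (v p) * t p * δ (v p) i)))
      (∑-cong (λ p → distribute (M l (v p)) (s p) (t p) (δ (v p) i)))
      where
      distribute = λ e s t d → solve 6 (λ a e s d b t → a :* (e :* s :* d) :+ b :* (e :* t :* d) := e :* (a :* s :+ b :* t) :* d) refl a e s d b t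

    -- The weights `M l (v p)` undo the switching that isolates l, so the form depends only on the
    -- normalised adjacency `E` and its value can be computed once per switching class.
    weighted-quadratic : ∀ h u → weighted u ∙ shift M h ⊛ weighted u ≡ ∑ (λ p → ∑ (λ q → u p * (u q * (signed (E p q) + h * δ p q))))
    weighted-quadratic h u = trans (combination-quadratic (shift M h) _ v) (∑-cong (λ p → ∑-cong (λ q → term p q)))
      where
      ε : Fin k → Q
      ε p = M l (v p)
      δ-v : ∀ p q → ε p * ε q * δ (v p) (v q) ≡ δ p q
      δ-v p q with p ≟ q
      ... | yes refl = trans (cong₂ _*_ (signed² (adj H l (v p))) (δ-refl (v p))) (trans (*-identityˡ 1q) (sym (δ-refl p)))
      ... | no p≢q   = trans (cong (ε p * ε q *_) (δ-≢ (p≢q ∘ v-injective))) (trans (*-comm _ 0q) (trans (*-zeroˡ _) (sym (δ-≢ p≢q))))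
      normalise : ∀ a b s t e d d′ → a * a ≡ 1q → b * b ≡ 1q → a * b * d ≡ d′ →
        a * s * (b * t * (a * b * e + h * d)) ≡ s * (t * (e + h * d′))
      normalise a b s t e d d′ aa bb refl = trans (solve 7 (λ a s b t e h d → a :* s :* (b :* t :* (a :* b :* e :+ h :* d)) := s :* (t :* (a :* a :* (b :* b) :* e :+ h :* (a :* b :* d)))) refl a s b t e h d)
        (trans (cong₂ (λ x y → s * (t * (x * y * e + h * (a * b * d)))) aa bb) (solve 7 (λ s t e h a b d → s :* (t :* (κ 1 :* κ 1 :* e :+ h :* (a :* b :* d))) := s :* (t :* (e :+ h :* (a :* b :* d)))) refl s t e h a b d))
      term : ∀ p q → ε p * u p * (ε q * u q * (M (v p) (v q) + h * δ (v p) (v q))) ≡ u p * (u q * (signed (E p q) + h * δ p q))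
      term p q = trans (cong (λ m → ε p * u p * (ε q * u q * (m + h * δ (v p) (v q)))) (trans (M-tri l (v p) (v q)) (cong (λ b → ε p * ε q * signed b) (E≡ p q))))
        (normalise (ε p) (ε q) (u p) (u q) (signed (E p q)) (δ (v p) (v q)) (δ p q) (signed² (adj H l (v p))) (signed² (adj H l (v q))) (δ-v p q))

-- The two switching classes on five vertices that are not complete multipartite, normalised at vertex 2:
-- the edges are 0–3, 1–4 and, if s holds, 3–4. If s holds this is the class of the pentagon.
exceptional : Bool → Fin 5 → Fin 5 → Bool
exceptional s 0F 3F = true
exceptional s 3F 0F = true
exceptional s 1F 4F = true
exceptional s 4F 1F = true
exceptional s 3F 4F = s
exceptional s 4F 3F = s
exceptional s _  _  = false

-- With pairwise different rows, vertices realising the pattern are automatically distinct;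
-- `v-injective` below rests on this.
exceptional-rows : ∀ s p q → (∀ r → exceptional s p r ≡ exceptional s q r) → p ≡ q
exceptional-rows true  = toWitness {a? = all? λ p → all? λ q → all? (λ r → exceptional true p r Bool.≟ exceptional true q r) →-dec (p ≟ q)} tt
exceptional-rows false = toWitness {a? = all? λ p → all? λ q → all? (λ r → exceptional false p r Bool.≟ exceptional false q r) →-dec (p ≟ q)} tt

-- Integer spanning vectors of a plane on which the form of the exceptional class plus 1/2 is negative.
coordinate₁ coordinate₂ : Bool → Fin 5 → ℤ
coordinate₁ s 0F = pos 1
coordinate₁ s 1F = -[1+ 0 ]
coordinate₁ s 2F = pos 0
coordinate₁ s 3F = pos 1
coordinate₁ s 4F = -[1+ 0 ]
coordinate₂ true  2F = -[1+ 3 ]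
coordinate₂ true  _  = pos 1
coordinate₂ false 2F = pos 5
coordinate₂ false _  = -[1+ 1 ]

plane₁ plane₂ : Bool → Fin 5 → Q
plane₁ s p = fromℤ (coordinate₁ s p)
plane₂ s p = fromℤ (coordinate₂ s p)

exceptional-form : Bool → Q → Q → Q → Q
exceptional-form s h a b = ∑ (λ p → ∑ (λ q → (a * plane₁ s p + b * plane₂ s p) * ((a * plane₁ s q + b * plane₂ s q) * (signed (exceptional s p q) + h * δ p q))))

-- The form has 25 terms. Building the solver expression by the same recursions as the form lets the
-- two match by computation.
module ExceptionalForm where

  :∑ : ∀ {m n} → (Fin n → Expr m) → Expr m
  :∑ {n = zero}  f = κ 0
  :∑ {n = suc n} f = f zero :+ :∑ (f ∘ suc)

  :δ : ∀ {m n} → Fin n → Fin n → Expr m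
  :δ zero    zero    = κ 1
  :δ zero    (suc _) = κ 0
  :δ (suc _) zero    = κ 0
  :δ (suc i) (suc j) = :δ i j

  :signed : ∀ {m} → Bool → Expr m
  :signed true  = :- κ 1
  :signed false = κ 1

  :form : ∀ {m} → Bool → Expr m → Expr m → Expr m → Expr m
  :form {m} s h a b = :∑ λ p → :∑ λ q → entry p :* (entry q :* (:signed (exceptional s p q) :+ h :* :δ p q))
    where
    entry : Fin 5 → Expr m
    entry p = a :* con (coordinate₁ s p) :+ b :* con (coordinate₂ s p)

exceptional-negative : ∀ s {h} → ι 2 * h ≡ 1q → 0q ≺ h → ∀ a b → a ≢ 0q ⊎ b ≢ 0q → exceptional-form s h a b ≺ 0q
exceptional-negative s {h} 2h≡1 0≺h a b ab≢0 = value s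
  where
  positive : ∀ m k → 0q ≺ h * (ι (suc m) * (a * a) + ι (suc k) * (b * b))
  positive m k = 0≺* 0≺h ([ (λ a≢0 → 0≺+≽0 (0≺* (0≺ι-suc m) (0≺sq a≢0)) (0≼* (0≼ι (suc k)) (0≼sq b)))
      , (λ b≢0 → 0≼+≻0 (0≼* (0≼ι (suc m)) (0≼sq a)) (0≺* (0≺ι-suc k) (0≺sq b≢0))) ]′ ab≢0)
  -- The value is wanted only where 2 h = 1, so the ring identity carries a multiple of 1 - 2 h that
  -- vanishes there.
  reduce : ∀ x y {z} → z ≡ x + (1q - ι 2 * h) * y → z ≡ x
  reduce x y eq = trans eq (trans (cong (λ w → x + (1q - w) * y) 2h≡1) (nil x y))
    where
    nil = solve 2 (λ x y → x :+ (κ 1 :- κ 1) :* y := x) refl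
  open ExceptionalForm using (:form)
  value : ∀ s → exceptional-form s h a b ≺ 0q
  -- There is no term in a b: exchanging 0 with 1 and 3 with 4 preserves the class, negates the
  -- first spanning vector and fixes the second. The same holds in the other case.
  value true  = ≺-by (positive 3 3) (reduce (h * (ι 4 * (a * a) + ι 4 * (b * b))) (ι 4 * (a * a) + ι 12 * (b * b)) (solve 3 (λ h a b → κ 0 :- :form true h a b := h :* (κ 4 :* (a :* a) :+ κ 4 :* (b :* b)) :+ (κ 1 :- κ 2 :* h) :* (κ 4 :* (a :* a) :+ κ 12 :* (b :* b))) refl h a b))
  value false = ≺-by (positive 11 4) (reduce (h * (ι 12 * (a * a) + ι 5 * (b * b))) (ι 8 * (a * a) + ι 23 * (b * b)) (solve 3 (λ h a b → κ 0 :- :form false h a b := h :* (κ 12 :* (a :* a) :+ κ 5 :* (b :* b)) :+ (κ 1 :- κ 2 :* h) :* (κ 8 :* (a :* a) :+ κ 23 :* (b :* b))) refl h a b))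

-- Switching classes without a negative definite plane

module Classification {n} (H : Graph n) {h : Q} (2h≡1 : ι 2 * h ≡ 1q) (0≺h : 0q ≺ h)
  (no-plane : ∀ w₁ w₂ → NegativeOn (shift (TwoGraph.M H) h) w₁ w₂ → ⊥)
  where

  open TwoGraph H

  -- Relative to the even triple, a singles out i and b singles out j. Switched so that l is
  -- isolated, the edges are i-a, j-b and possibly a-b, while i-j, i-b and j-a are not edges.
  -- Whether a-b is one decides between the two exceptional classes.
  no-exceptional : ∀ i j l a b → tri i j l ≡ false → tri i j a ≡ true → tri j l a ≡ false → tri i j b ≡ true → tri i l b ≡ false → ⊥
  no-exceptional i j l a b ijl ija jla ijb ilb = no-plane (W (plane₁ s)) (W (plane₂ s)) λ c d cd≢0 →
      ≼-≺-trans (≼-reflexive (trans (∙-cong {u′ = U c d} {v′ = shift M h ⊛ U c d} (linear c d) (λ k → ∙-cong {u = shift M h k} {v′ = U c d} (λ _ → refl) (linear c d)))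
          (weighted-quadratic l v v-injective (exceptional s) E≡ h (λ p → c * plane₁ s p + d * plane₂ s p))))
                (exceptional-negative s 2h≡1 0≺h c d cd≢0)
    where
    s = tri l a b

    v : Fin 5 → Fin n
    v 0F = i
    v 1F = j
    v 2F = l
    v 3F = a
    v 4F = b

    ila : tri i l a ≡ true
    ila = negated (sym (trans (sym jla) (trans (tri-cocycle i j l a) (cong₂ (λ x y → (x xor y) xor tri i l a) ijl ija))))
      where
      negated : ∀ {x} → not x ≡ false → x ≡ true
      negated {true} _ = refl

    jlb : tri j l b ≡ true
    jlb = trans (tri-cocycle i j l b) (trans (cong₂ (λ x y → (x xor y) xor tri i l b) ijl ijb) (cong not ilb))

    base-sym : ∀ {p q e} → tri l p q ≡ e → tri l q p ≡ e
    base-sym {p} {q} eq = trans (tri-swap₂₃ l p q) eq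

    lij : tri l i j ≡ false
    lij = trans (tri-rotate i j l) ijl
    lia : tri l i a ≡ true
    lia = trans (tri-swap₁₂ i l a) ila
    lib : tri l i b ≡ false
    lib = trans (tri-swap₁₂ i l b) ilb
    lja : tri l j a ≡ false
    lja = trans (tri-swap₁₂ j l a) jla
    ljb : tri l j b ≡ true
    ljb = trans (tri-swap₁₂ j l b) jlb

    E≡ : ∀ p q → tri l (v p) (v q) ≡ exceptional s p q
    E≡ 0F 0F = tri-ijj l i
    E≡ 0F 1F = lij
    E≡ 0F 2F = base-sym (tri-iil l i)
    E≡ 0F 3F = lia
    E≡ 0F 4F = lib
    E≡ 1F 0F = base-sym lij
    E≡ 1F 1F = tri-ijj l j
    E≡ 1F 2F = base-sym (tri-iil l j)
    E≡ 1F 3F = lja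
    E≡ 1F 4F = ljb
    E≡ 2F 0F = tri-iil l i
    E≡ 2F 1F = tri-iil l j
    E≡ 2F 2F = tri-iil l l
    E≡ 2F 3F = tri-iil l a
    E≡ 2F 4F = tri-iil l b
    E≡ 3F 0F = base-sym lia
    E≡ 3F 1F = base-sym lja
    E≡ 3F 2F = base-sym (tri-iil l a)
    E≡ 3F 3F = tri-ijj l a
    E≡ 3F 4F = refl
    E≡ 4F 0F = base-sym lib
    E≡ 4F 1F = base-sym ljb
    E≡ 4F 2F = base-sym (tri-iil l b)
    E≡ 4F 3F = base-sym refl
    E≡ 4F 4F = tri-ijj l b

    v-injective : ∀ {p q} → v p ≡ v q → p ≡ q
    v-injective {p} {q} eq = exceptional-rows s p q λ r → trans (sym (E≡ p r)) (trans (cong (λ x → tri l x (v r)) eq) (E≡ q r))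

    W : (Fin 5 → Q) → Vector n
    W = weighted l v v-injective (exceptional s) E≡

    U : Q → Q → Vector n
    U c d = W (λ p → c * plane₁ s p + d * plane₂ s p)

    linear : ∀ c d k → c * W (plane₁ s) k + d * W (plane₂ s) k ≡ U c d k
    linear c d = weighted-linear l v v-injective (exceptional s) E≡ c d (plane₁ s) (plane₂ s)

  -- Relative to an even triple i, j, l every further vertex is odd for none or for exactly one of
  -- i, j, l; if no two of them are twins, two different ones occur.
  distinct-classes-odd : ∀ {i j l} → ¬ Twin i j → ¬ Twin i l → ¬ Twin j l → tri i j l ≡ true
  distinct-classes-odd {i} {j} {l} ¬ij ¬il ¬jl with tri i j l in ijl
  ... | true  = refl
  ... | false = ⊥-elim (go (not-twin ¬ij))
    where
    third : ∀ x → tri j l x ≡ tri i j x xor tri i l x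
    third x = trans (tri-cocycle i j l x) (cong (λ e → (e xor tri i j x) xor tri i l x) ijl)

    -- By `third` a vertex odd with one pair is odd with exactly two, and singles out their common
    -- vertex. So a singles out i or j, and b is then taken from the pair that a does not separate,
    -- which makes it single out another vertex.
    go : (Σ (Fin n) λ a → tri i j a ≡ true) → ⊥
    go (a , ija) with tri i l a in ila
    ... | true  = second (not-twin ¬jl)
      where
      jla : tri j l a ≡ false
      jla = trans (third a) (cong₂ _xor_ ija ila)
      second : (Σ (Fin n) λ b → tri j l b ≡ true) → ⊥
      second (b , jlb) with tri i j b in ijb
      ... | true  = no-exceptional i j l a b ijl ija jla ijb (flip (trans (sym jlb) (trans (third b) (cong (_xor tri i l b) ijb))))
        where
        flip : ∀ {x} → true ≡ not x → x ≡ false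
        flip {false} _ = refl
      ... | false = no-exceptional i l j a b (trans (tri-swap₂₃ i j l) ijl) ila (trans (tri-swap₁₂ j l a) jla)
          (sym (trans (sym jlb) (trans (third b) (cong (_xor tri i l b) ijb)))) ijb
    ... | false = second (not-twin ¬il)
      where
      jla : tri j l a ≡ true
      jla = trans (third a) (cong₂ _xor_ ija ila)
      second : (Σ (Fin n) λ b → tri i l b ≡ true) → ⊥
      second (b , ilb) with tri i j b in ijb
      ... | true  = no-exceptional j i l a b (trans (tri-swap₁₂ i j l) ijl) (trans (tri-swap₁₂ i j a) ija) ila
          (trans (tri-swap₁₂ i j b) ijb) (trans (third b) (cong₂ _xor_ ijb ilb))
      ... | false = no-exceptional j l i a b (trans (sym (tri-rotate j l i)) ijl) jla (trans (tri-swap₁₂ i l a) ila)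
          (trans (third b) (cong₂ _xor_ ijb ilb)) (trans (tri-swap₁₂ i j b) ijb)

  same : Fin n → Fin n → Bool
  same i j = ⌊ twin? i j ⌋

  -- Chosen to make r nonadjacent to its own class and adjacent to everything else.
  side : Fin n → Fin n → Bool
  side r i = if same r i then adj H r i else not (adj H r i)

  -- The switched adjacency of i and j is `tri r i j`, complemented once for each of the two that
  -- lies outside the class of r.
  switched : ∀ r i j → switchAdj H (side r) i j ≡ not (same i j)
  switched r i j with twin? r i | twin? r j | twin? i j
  ... | yes _  | yes ri | yes _ = trans (tri-swap₂₃ r j i) (ri i)
  ... | yes ri | yes rj | no ¬ij = contradiction (twin-trans (twin-sym ri) rj) ¬ij
  ... | yes ri | no ¬rj | yes ij = contradiction (twin-trans ri ij) ¬rj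
  ... | yes ri | no ¬rj | no ¬ij = trans (move (adj H r i) (adj H r j) (adj H i j)) (cong not (ri j))
    where
    move = solve₂ 3 (λ x y z → x ⊕ (bit true ⊕ y) ⊕ z ⊜ bit true ⊕ (x ⊕ y ⊕ z)) refl
  ... | no ¬ri | yes rj | yes ij = contradiction (twin-trans rj (twin-sym ij)) ¬ri
  ... | no ¬ri | yes rj | no ¬ij = trans (move (adj H r i) (adj H r j) (adj H i j)) (cong not (trans (tri-swap₂₃ r j i) (rj i)))
    where
    move = solve₂ 3 (λ x y z → (bit true ⊕ x) ⊕ y ⊕ z ⊜ bit true ⊕ (x ⊕ y ⊕ z)) refl
  ... | no ¬ri | no ¬rj | yes ij = trans (move (adj H r i) (adj H r j) (adj H i j)) (trans (tri-rotate i j r) (ij r))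
    where
    move = solve₂ 3 (λ x y z → (bit true ⊕ x) ⊕ (bit true ⊕ y) ⊕ z ⊜ x ⊕ y ⊕ z) refl
  ... | no ¬ri | no ¬rj | no ¬ij = trans (move (adj H r i) (adj H r j) (adj H i j)) (distinct-classes-odd ¬ri ¬rj ¬ij)
    where
    move = solve₂ 3 (λ x y z → (bit true ⊕ x) ⊕ (bit true ⊕ y) ⊕ z ⊜ x ⊕ y ⊕ z) refl

  same-refl : ∀ i → same i i ≡ true
  same-refl i with twin? i i
  ... | yes _  = refl
  ... | no ¬tw = contradiction (twin-refl i) ¬tw

  same-sym : ∀ i j → same i j ≡ same j i
  same-sym i j with twin? i j | twin? j i
  ... | yes _  | yes _  = refl
  ... | no _   | no _   = refl
  ... | yes ij | no ¬ji = contradiction (twin-sym ij) ¬ji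
  ... | no ¬ij | yes ji = contradiction (twin-sym ji) ¬ij

  same-class : ∀ i j → same i j ≡ true → ∀ k → same i k ≡ same j k
  same-class i j eq k with twin? i j | twin? i k | twin? j k
  ... | yes ij | yes _  | yes _  = refl
  ... | yes ij | no _   | no _   = refl
  ... | yes ij | yes ik | no ¬jk = contradiction (twin-trans (twin-sym ij) ik) ¬jk
  ... | yes ij | no ¬ik | yes jk = contradiction (twin-trans ij jk) ¬ik

-- Partitions

record Iso {A B : Set} (R : A → A → Bool) (S : B → B → Bool) : Set where
  field
    to        : A → B
    from      : B → A
    to-from   : ∀ b → to (from b) ≡ b
    from-to   : ∀ a → from (to a) ≡ a
    preserves : ∀ a a′ → R a a′ ≡ S (to a) (to a′)

iso-refl : ∀ {A : Set} {R : A → A → Bool} → Iso R R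
iso-refl = record { to = id ; from = id ; to-from = λ _ → refl ; from-to = λ _ → refl ; preserves = λ _ _ → refl }

iso-sym : ∀ {A B : Set} {R : A → A → Bool} {S : B → B → Bool} → Iso R S → Iso S R
iso-sym {S = S} f = record
  { to = from ; from = to ; to-from = from-to ; from-to = to-from
  ; preserves = λ b b′ → trans (sym (cong₂ S (to-from b) (to-from b′))) (sym (preserves (from b) (from b′))) }
  where open Iso f

iso-trans : ∀ {A B C : Set} {R : A → A → Bool} {S : B → B → Bool} {T′ : C → C → Bool} → Iso R S → Iso S T′ → Iso R T′
iso-trans f g = record
  { to = G.to ∘ F.to ; from = F.from ∘ G.from
  ; to-from = λ c → trans (cong G.to (F.to-from (G.from c))) (G.to-from c)
  ; from-to = λ a → trans (cong F.from (G.from-to (F.to a))) (F.from-to a)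
  ; preserves = λ a a′ → trans (F.preserves a a′) (G.preserves (F.to a) (F.to a′)) }
  where
  module F = Iso f
  module G = Iso g

-- Vertex ps is Fin (sum ps) with the splitting into parts made visible.
Vertex : List ℕ → Set
Vertex []       = ⊥
Vertex (p ∷ ps) = Fin p ⊎ Vertex ps

samePart : ∀ ps → Vertex ps → Vertex ps → Bool
samePart (p ∷ ps) (inj₁ _) (inj₁ _) = true
samePart (p ∷ ps) (inj₁ _) (inj₂ _) = false
samePart (p ∷ ps) (inj₂ _) (inj₁ _) = false
samePart (p ∷ ps) (inj₂ v) (inj₂ w) = samePart ps v w

iso-∷ : ∀ p {ps qs} → Iso (samePart ps) (samePart qs) → Iso (samePart (p ∷ ps)) (samePart (p ∷ qs))
iso-∷ p f = record
  { to = Sum.map₂ to ; from = Sum.map₂ from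
  ; to-from = λ { (inj₁ _) → refl ; (inj₂ v) → cong inj₂ (to-from v) }
  ; from-to = λ { (inj₁ _) → refl ; (inj₂ v) → cong inj₂ (from-to v) }
  ; preserves = λ { (inj₁ _) (inj₁ _) → refl ; (inj₁ _) (inj₂ _) → refl ; (inj₂ _) (inj₁ _) → refl ; (inj₂ v) (inj₂ w) → preserves v w } }
  where open Iso f

exchange₂ : ∀ {A B C : Set} → A ⊎ (B ⊎ C) → B ⊎ (A ⊎ C)
exchange₂ (inj₁ a)        = inj₂ (inj₁ a)
exchange₂ (inj₂ (inj₁ b)) = inj₁ b
exchange₂ (inj₂ (inj₂ c)) = inj₂ (inj₂ c)

exchange₂-involutive : ∀ {A B C : Set} (x : A ⊎ (B ⊎ C)) → exchange₂ (exchange₂ x) ≡ x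
exchange₂-involutive (inj₁ a)        = refl
exchange₂-involutive (inj₂ (inj₁ b)) = refl
exchange₂-involutive (inj₂ (inj₂ c)) = refl

iso-swap : ∀ p q ps → Iso (samePart (p ∷ q ∷ ps)) (samePart (q ∷ p ∷ ps))
iso-swap p q ps = record
  { to = exchange₂ ; from = exchange₂ ; to-from = exchange₂-involutive ; from-to = exchange₂-involutive ; preserves = same }
  where
  same : ∀ v w → samePart (p ∷ q ∷ ps) v w ≡ samePart (q ∷ p ∷ ps) (exchange₂ v) (exchange₂ w)
  same (inj₁ _)        (inj₁ _)        = refl
  same (inj₁ _)        (inj₂ (inj₁ _)) = refl
  same (inj₁ _)        (inj₂ (inj₂ _)) = refl
  same (inj₂ (inj₁ _)) (inj₁ _)        = refl
  same (inj₂ (inj₁ _)) (inj₂ (inj₁ _)) = refl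
  same (inj₂ (inj₁ _)) (inj₂ (inj₂ _)) = refl
  same (inj₂ (inj₂ _)) (inj₁ _)        = refl
  same (inj₂ (inj₂ _)) (inj₂ (inj₁ _)) = refl
  same (inj₂ (inj₂ _)) (inj₂ (inj₂ _)) = refl

iso-↭ : ∀ {ps qs} → ps ↭ qs → Iso (samePart ps) (samePart qs)
iso-↭ _↭_.refl           = iso-refl
iso-↭ (prep p perm)      = iso-∷ p (iso-↭ perm)
iso-↭ (swap {xs} p q perm) = iso-trans (iso-swap p q xs) (iso-∷ q (iso-∷ p (iso-↭ perm)))
iso-↭ (_↭_.trans perm perm′) = iso-trans (iso-↭ perm) (iso-↭ perm′)

samePartFin : ∀ ps → Fin (sum ps) → Fin (sum ps) → Bool
samePartFin ps i j = ⌊ partOf ps i ℕ.≟ partOf ps j ⌋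

iso-Fin : ∀ ps → Iso (samePartFin ps) (samePart ps)
iso-Fin []       = record { to = λ () ; from = λ () ; to-from = λ () ; from-to = λ () ; preserves = λ () }
iso-Fin (p ∷ ps) = record
  { to        = λ i → Sum.map₂ to (splitAt p i)
  ; from      = λ v → join p (sum ps) (Sum.map₂ from v)
  ; to-from   = λ v → trans (cong (Sum.map₂ to) (splitAt-join p (sum ps) (Sum.map₂ from v))) (map-inverse v)
  ; from-to   = λ i → trans (cong (join p (sum ps)) (map-inverse′ (splitAt p i))) (join-splitAt p (sum ps) i)
  ; preserves = same }
  where
  open Iso (iso-Fin ps)
  map-inverse : ∀ v → Sum.map₂ to (Sum.map₂ from v) ≡ v
  map-inverse (inj₁ _) = refl
  map-inverse (inj₂ v) = cong inj₂ (to-from v)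
  map-inverse′ : ∀ v → Sum.map₂ from (Sum.map₂ to v) ≡ v
  map-inverse′ (inj₁ _) = refl
  map-inverse′ (inj₂ v) = cong inj₂ (from-to v)
  same : ∀ i j → samePartFin (p ∷ ps) i j ≡ samePart (p ∷ ps) (Sum.map₂ to (splitAt p i)) (Sum.map₂ to (splitAt p j))
  same i j with splitAt p i | splitAt p j
  ... | inj₁ _ | inj₁ _ = refl
  ... | inj₁ _ | inj₂ _ = refl
  ... | inj₂ _ | inj₁ _ = refl
  ... | inj₂ v | inj₂ w = trans (⌊suc≟suc⌋ (partOf ps v) (partOf ps w)) (preserves v w)

-- The part of v is brought to the front so that a new vertex can join it by enlarging the first
-- part.
record Front (ps : List ℕ) (v : Vertex ps) : Set where
  field
    part     : ℕ
    rest     : List ℕ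
    iso      : Iso (samePart ps) (samePart (part ∷ rest))
    index    : Fin part
    at-front : Iso.to iso v ≡ inj₁ index
    rest-pos : Positive ps → Positive rest

front : ∀ ps v → Front ps v
front (p ∷ ps) (inj₁ w) = record { part = p ; rest = ps ; iso = iso-refl ; index = w ; at-front = refl ; rest-pos = λ { (_ ∷ ps-pos) → ps-pos } }
front (p ∷ ps) (inj₂ v) = record
  { part = part ; rest = p ∷ rest ; iso = iso-trans (iso-∷ p iso) (iso-swap p part rest) ; index = index
  ; at-front = cong (exchange₂ ∘ inj₂) at-front ; rest-pos = λ { (p-pos ∷ ps-pos) → p-pos ∷ rest-pos ps-pos } }
  where open Front (front ps v)

record Partition {n} (R : Fin n → Fin n → Bool) : Set where
  field
    parts    : List ℕ
    positive : Positive parts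
    iso      : Iso R (samePart parts)

-- Transitivity is assumed in the form that related vertices have equal rows. Vertex 0 is added
-- after the others are partitioned: it forms a part of its own or joins that of a related vertex.
partition : ∀ n (R : Fin n → Fin n → Bool) → (∀ i → R i i ≡ true) → (∀ i j → R i j ≡ R j i) →
            (∀ i j → R i j ≡ true → ∀ k → R i k ≡ R j k) → Partition R
partition zero    R R-refl R-sym R-class = record
  { parts = [] ; positive = [] ; iso = record { to = λ () ; from = λ () ; to-from = λ () ; from-to = λ () ; preserves = λ () } }
partition (suc n) R R-refl R-sym R-class with any? (λ j → R zero (suc j) Bool.≟ true)
... | no none = record
  { parts    = 1 ∷ parts
  ; positive = ℕ.s≤s ℕ.z≤n ∷ positive
  ; iso      = record
    { to        = λ { zero → inj₁ zero ; (suc i) → inj₂ (to i) }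
    ; from      = λ { (inj₁ _) → zero ; (inj₂ v) → suc (from v) }
    ; to-from   = λ { (inj₁ zero) → refl ; (inj₂ v) → cong inj₂ (to-from v) }
    ; from-to   = λ { zero → refl ; (suc i) → cong suc (from-to i) }
    ; preserves = λ { zero zero → R-refl zero ; zero (suc j) → alone j ; (suc i) zero → trans (R-sym (suc i) zero) (alone i) ; (suc i) (suc j) → preserves i j } } }
  where
  open Partition (partition n (λ i j → R (suc i) (suc j)) (R-refl ∘ suc) (λ i j → R-sym (suc i) (suc j)) (λ i j eq k → R-class (suc i) (suc j) eq (suc k)))
  open Iso iso
  false-of : ∀ {b} → b ≢ true → b ≡ false
  false-of {true}  ≢t = contradiction refl ≢t
  false-of {false} _  = refl
  alone : ∀ j → R zero (suc j) ≡ false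
  alone j = false-of (λ eq → none (j , eq))
... | yes (j , R₀j) = record
  { parts    = suc part ∷ rest
  ; positive = ℕ.s≤s ℕ.z≤n ∷ rest-pos positive
  ; iso      = record
    { to        = λ { zero → inj₁ zero ; (suc i) → lift (to i) }
    ; from      = back
    ; to-from   = λ { (inj₁ zero) → refl ; (inj₁ (suc w)) → cong lift (to-from (inj₁ w)) ; (inj₂ v) → cong lift (to-from (inj₂ v)) }
    ; from-to   = λ { zero → refl ; (suc i) → lifted i }
    ; preserves = λ { zero zero → R-refl zero ; zero (suc i) → joined i ; (suc i) zero → trans (R-sym (suc i) zero) (trans (joined i) (lift-sym (to i)))
                    ; (suc i) (suc k) → trans (preserves i k) (lift-same (to i) (to k)) } } }
  where
  module Rest = Partition (partition n (λ i j → R (suc i) (suc j)) (R-refl ∘ suc) (λ i j → R-sym (suc i) (suc j)) (λ i j eq k → R-class (suc i) (suc j) eq (suc k)))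
  open Rest using (positive)
  open Front (front Rest.parts (Iso.to Rest.iso j)) using (part; rest; index; at-front; rest-pos) renaming (iso to to-front)
  open Iso (iso-trans Rest.iso to-front)

  lift : Vertex (part ∷ rest) → Vertex (suc part ∷ rest)
  lift (inj₁ w) = inj₁ (suc w)
  lift (inj₂ v) = inj₂ v

  back : Vertex (suc part ∷ rest) → Fin (suc n)
  back (inj₁ zero)    = zero
  back (inj₁ (suc w)) = suc (from (inj₁ w))
  back (inj₂ v)       = suc (from (inj₂ v))

  lift-same : ∀ v w → samePart (part ∷ rest) v w ≡ samePart (suc part ∷ rest) (lift v) (lift w)
  lift-same (inj₁ _) (inj₁ _) = refl
  lift-same (inj₁ _) (inj₂ _) = refl
  lift-same (inj₂ _) (inj₁ _) = refl
  lift-same (inj₂ _) (inj₂ _) = refl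

  lift-front : ∀ v → samePart (part ∷ rest) (inj₁ index) v ≡ samePart (suc part ∷ rest) (inj₁ zero) (lift v)
  lift-front (inj₁ _) = refl
  lift-front (inj₂ _) = refl

  lift-sym : ∀ v → samePart (suc part ∷ rest) (inj₁ zero) (lift v) ≡ samePart (suc part ∷ rest) (lift v) (inj₁ zero)
  lift-sym (inj₁ _) = refl
  lift-sym (inj₂ _) = refl

  joined : ∀ i → R zero (suc i) ≡ samePart (suc part ∷ rest) (inj₁ zero) (lift (to i))
  joined i = trans (R-class zero (suc j) R₀j (suc i)) (trans (preserves j i)
    (trans (cong (λ v → samePart (part ∷ rest) v (to i)) at-front) (lift-front (to i))))

  back-lift : ∀ v → back (lift v) ≡ suc (from v)
  back-lift (inj₁ _) = refl
  back-lift (inj₂ _) = refl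

  lifted : ∀ i → back (lift (to i)) ≡ suc i
  lifted i = trans (back-lift (to i)) (cong suc (from-to i))

-- Seidel matrices

fromℤ-- : ∀ a b → fromℤ (a ℤ.- b) ≡ fromℤ a - fromℤ b
fromℤ-- a b = trans (fromℤ-+ a (ℤ.- b)) (cong (fromℤ a +_) (fromℤ-neg b))

fromℤ-sumFin : ∀ {n} (f : Fin n → ℤ) → fromℤ (D.sumFin f) ≡ ∑ (fromℤ ∘ f)
fromℤ-sumFin {zero}  f = refl
fromℤ-sumFin {suc n} f = trans (fromℤ-+ (f zero) _) (cong (fromℤ (f zero) +_) (fromℤ-sumFin (f ∘ suc)))

sign-suc : ∀ k → D.sign (suc k) ≡ ℤ.- D.sign k
sign-suc zero          = refl
sign-suc (suc zero)    = refl
sign-suc (suc (suc k)) = sign-suc k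

fromℤ-sign : ∀ {n} (j : Fin n) → fromℤ (D.sign (toℕ j)) ≡ sgn j
fromℤ-sign zero    = refl
fromℤ-sign (suc j) = trans (cong fromℤ (sign-suc (toℕ j))) (trans (fromℤ-neg (D.sign (toℕ j))) (cong -_ (fromℤ-sign j)))

fromℤ-det : ∀ {n} (A : D.Matrix n) → fromℤ (D.det A) ≡ det (λ i j → fromℤ (A i j))
fromℤ-det {zero}  A = refl
fromℤ-det {suc n} A = trans (fromℤ-sumFin (λ j → D.sign (toℕ j) ℤ.* A zero j ℤ.* D.det (λ a b → A (suc a) (punchIn j b)))) (∑-cong term)
  where
  term : ∀ j → fromℤ (D.sign (toℕ j) ℤ.* A zero j ℤ.* D.det (λ a b → A (suc a) (punchIn j b))) ≡
               sgn j * (fromℤ (A zero j) * det (minor (λ i j → fromℤ (A i j)) j))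
  term j = begin
    fromℤ (s ℤ.* A zero j ℤ.* d) ≡⟨ fromℤ-* (s ℤ.* A zero j) d ⟩
    fromℤ (s ℤ.* A zero j) * fromℤ d ≡⟨ cong (_* fromℤ d) (fromℤ-* s (A zero j)) ⟩
    fromℤ s * fromℤ (A zero j) * fromℤ d ≡⟨ *-assoc _ _ _ ⟩
    fromℤ s * (fromℤ (A zero j) * fromℤ d) ≡⟨ cong₂ (λ x y → x * (fromℤ (A zero j) * y)) (fromℤ-sign j) (fromℤ-det (λ a b → A (suc a) (punchIn j b))) ⟩
    sgn j * (fromℤ (A zero j) * det (λ a b → fromℤ (A (suc a) (punchIn j b)))) ∎
    where
    s = D.sign (toℕ j)
    d = D.det (λ a b → A (suc a) (punchIn j b))

det-neg : ∀ {n} (A : Matrix n) → det (λ i j → - A i j) ≡ (- 1q) ^ n * det A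
det-neg {zero}  A = sym (*-identityˡ 1q)
det-neg {suc n} A = trans (∑-cong (λ j → trans (cong (λ d → sgn j * (- A zero j * d)) (det-neg (minor A j))) (regroup (sgn j) (A zero j) ((- 1q) ^ n) (det (minor A j)))))
  (∑-*ˡ ((- 1q) ^ suc n) (λ j → sgn j * (A zero j * det (minor A j))))
  where
  regroup = solve 4 (λ s a p d → s :* (:- a :* (p :* d)) := :- κ 1 :* p :* (s :* (a :* d))) refl

power≢0 : ∀ n → (- 1q) ^ n ≢ 0q
power≢0 zero    eq = 1≢0 eq
power≢0 (suc n) eq = power≢0 n (trans (negate ((- 1q) ^ n)) (trans (cong -_ eq) (solve 0 (:- κ 0 := κ 0) refl)))
  where
  negate = solve 1 (λ a → a := :- (:- κ 1 :* a)) refl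

fromℤ-δ : ∀ {n} (i j : Fin n) → fromℤ (D.δ i j) ≡ δ i j
fromℤ-δ i j with i ≟ j
... | yes refl = sym (δ-refl i)
... | no i≢j   = sym (δ-≢ i≢j)

-- t I − S at t = − (x + 1) is − (M + x I), since M = S + I.
charPoly-shift : ∀ {n} (H : Graph n) x → fromℤ (charPolyAt (seidel H) -[1+ x ]) ≡ (- 1q) ^ n * det (shift (TwoGraph.M H) (ι x))
charPoly-shift {n} H x = trans (fromℤ-det (λ i j → -[1+ x ] ℤ.* D.δ i j ℤ.- seidel H i j)) (trans (det-cong entry) (det-neg (shift (TwoGraph.M H) (ι x))))
  where
  edge : ∀ b → 1q - ι 2 * fromℤ (b2z b) ≡ signed b
  edge true  = one
    where
    one : 1q - ι 2 * 1q ≡ - 1q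
    one = solve 0 (κ 1 :- κ 2 :* κ 1 := :- κ 1) refl
  edge false = zero′
    where
    zero′ : 1q - ι 2 * 0q ≡ 1q
    zero′ = solve 0 (κ 1 :- κ 2 :* κ 0 := κ 1) refl

  combine = solve 3 (λ x d m → :- (κ 1 :+ x) :* d :- (κ 1 :- d :- m) := :- (κ 1 :- m :+ x :* d)) refl

  entry : ∀ i j → fromℤ (-[1+ x ] ℤ.* D.δ i j ℤ.- seidel H i j) ≡ - shift (TwoGraph.M H) (ι x) i j
  entry i j = begin
    fromℤ (-[1+ x ] ℤ.* D.δ i j ℤ.- seidel H i j)
      ≡⟨ fromℤ-- (-[1+ x ] ℤ.* D.δ i j) (seidel H i j) ⟩
    fromℤ (-[1+ x ] ℤ.* D.δ i j) - fromℤ (seidel H i j)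
      ≡⟨ cong₂ _-_ (trans (fromℤ-* -[1+ x ] (D.δ i j)) (cong₂ _*_ (trans (fromℤ-neg (pos (suc x))) (cong -_ (ι-suc x))) (fromℤ-δ i j)))
                   (trans (fromℤ-- (pos 1 ℤ.- D.δ i j) (pos 2 ℤ.* b2z (adj H i j)))
                     (cong₂ _-_ (trans (fromℤ-- (pos 1) (D.δ i j)) (cong (λ d → 1q - d) (fromℤ-δ i j))) (fromℤ-* (pos 2) (b2z (adj H i j))))) ⟩
    - (1q + ι x) * δ i j - (1q - δ i j - ι 2 * fromℤ (b2z (adj H i j)))
      ≡⟨ combine (ι x) (δ i j) (ι 2 * fromℤ (b2z (adj H i j))) ⟩
    - ((1q - ι 2 * fromℤ (b2z (adj H i j))) + ι x * δ i j)
      ≡⟨ cong (λ m → - (m + ι x * δ i j)) (edge (adj H i j)) ⟩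
    - shift (TwoGraph.M H) (ι x) i j ∎

-- The spectra are compared at integers only; the values at t = - 1, - 2, ... already fix the
-- polynomial, and with it the determinant at rational points such as 1/2.
cospectral⇒same-det : ∀ {n} (G H : Graph n) → SeidelCospectral G H → ∀ x → det (shift (TwoGraph.M G) x) ≡ det (shift (TwoGraph.M H) x)
cospectral⇒same-det {n} G H cosp = agree-everywhere (det-shift-polynomial (TwoGraph.M G)) (det-shift-polynomial (TwoGraph.M H)) ι ι-injective
  (λ i → *-cancelˡ (power≢0 n) (trans (sym (charPoly-shift G i)) (trans (cong fromℤ (cosp -[1+ i ])) (charPoly-shift H i))))

signed-not : ∀ b → signed (not b) ≡ ι 2 * (if b then 1q else 0q) + - 1q
signed-not true  = solve 0 (κ 1 := κ 2 :* κ 1 :- κ 1) refl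
signed-not false = solve 0 (:- κ 1 := κ 2 :* κ 0 :- κ 1) refl

det-multipartite : ∀ ps x → det (shift (TwoGraph.M (completeMultipartite ps)) x) ≡ g ps x
det-multipartite ps x = trans (det-cong (λ i j → cong (_+ x * δ i j) (signed-not (samePartFin ps i j)))) (shifted-1 ps x)

-- Switching conjugates M by a diagonal matrix of signs and relabelling permutes it, so
-- `det-congruent` covers both.
det-switched : ∀ {n} (H : Graph n) U {R : Fin n → Fin n → Bool} → (∀ i j → switchAdj H U i j ≡ not (R i j)) →
  ∀ qs (f : Iso R (samePartFin qs)) → n ≡ sum qs → ∀ x → det (shift (TwoGraph.M H) x) ≡ g qs x
det-switched {n} H U {R} switched qs f n≡ x = trans (det-cong entry)
  (trans (det-congruent (mk↔ₛ′ to from to-from from-to) u (λ i → signed² (U i)) (shift (multipartite qs (- 1q)) x) n≡) (shifted-1 qs x))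
  where
  open Iso f
  u : Fin n → Q
  u i = signed (U i)

  unswitch : ∀ x y z w → (x xor y) xor z ≡ w → z ≡ (x xor y) xor w
  unswitch x y z w refl = solve₂ 3 (λ x y z → z ⊜ (x ⊕ y) ⊕ (x ⊕ y ⊕ z)) refl x y z

  δ-to : ∀ i j → δ i j ≡ u i * u j * δ (to i) (to j)
  δ-to i j with i ≟ j
  ... | yes refl = trans (δ-refl i) (sym (trans (cong₂ _*_ (signed² (U i)) (δ-refl (to i))) (*-identityˡ 1q)))
  ... | no i≢j   = trans (δ-≢ i≢j) (sym (trans (cong (u i * u j *_) (δ-≢ λ eq → i≢j (trans (sym (from-to i)) (trans (cong from eq) (from-to j)))))
                     (trans (*-comm _ 0q) (*-zeroˡ _))))

  M-to : ∀ i j → signed (adj H i j) ≡ u i * u j * multipartite qs (- 1q) (to i) (to j)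
  M-to i j = trans (cong signed (unswitch (U i) (U j) (adj H i j) (not (R i j)) (switched i j)))
    (trans (signed-xor (U i xor U j) (not (R i j))) (cong₂ _*_ (signed-xor (U i) (U j)) (trans (cong (signed ∘ not) (preserves i j)) (signed-not (samePartFin qs (to i) (to j))))))

  distribute = solve 4 (λ u m x d → u :* m :+ x :* (u :* d) := u :* (m :+ x :* d)) refl

  entry : ∀ i j → shift (TwoGraph.M H) x i j ≡ u i * u j * shift (multipartite qs (- 1q)) x (to i) (to j)
  entry i j = trans (cong₂ (λ m d → m + x * d) (M-to i j) (δ-to i j)) (distribute (u i * u j) _ x _)

module _ (p : ℕ) (ps : List ℕ) (pos-ps : Positive (suc p ∷ ps)) (3≤k : 3 ≤ length (suc p ∷ ps))
  (m : ℕ) (roots : ∀ {z} → RootOf (suc m) z → Root₃ (suc p ∷ ps) z)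
  (H : Graph (sum (suc p ∷ ps))) (cosp : SeidelCospectral (completeMultipartite (suc p ∷ ps)) H) where

  private
    rs = suc p ∷ ps
    n = sum rs
    open TwoGraph H using (M; M-sym)

    det≡ : ∀ x → g rs x ≡ det (shift M x)
    det≡ x = trans (sym (det-multipartite rs x)) (cospectral⇒same-det (completeMultipartite rs) H cosp x)

  no-plane : ∀ {h} → ι 2 * h ≡ 1q → 0q ≺ h → (w₁ w₂ : Vector n) → NegativeOn (shift M h) w₁ w₂ → ⊥
  -- H enters only through its determinant, which is that of the given graph; the sign at 1/2, the
  -- speed and the sign at n are therefore read off `g rs`.
  no-plane {h} 2h≡1 0≺h = no-negative-plane M-sym (λ i j → ∣signed∣≼1 (adj H i j)) {g₀ rs} {h} {speed-at p ps h}
    (≺⇒≼ 0≺h) (speed-at-pos p ps 0≺h) h≼n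
    (λ h≼x → g₀-pos rs (≺-≼-trans 0≺h h≼x)) (λ h≼x → g₀-mono rs (≺-≼-trans 0≺h h≼x))
    (λ {x} {y} h≼x x≼y _ → subst (speed-at p ps h * (y - x) ≼_) (cong₂ (λ a b → a * g₀ rs x - b * g₀ rs y) (det≡ y) (det≡ x)) (spread-≽ p ps 0≺h h≼x x≼y))
    (subst (_≺ 0q) (det≡ h) (g-half-neg rs pos-ps 3≤k 2h≡1 0≺h))
    (subst (0q ≼_) (det≡ (ι n)) (g-sum-≽0 rs (p ℕ.+ sum ps) refl))
    where
    h≼n : h ≼ ι n
    h≼n = ≼-by (0≼+ (≺⇒≼ 0≺h) (0≼ι (p ℕ.+ sum ps))) (trans (cong (_- h) (trans (ι-suc (p ℕ.+ sum ps)) (cong (_+ ι (p ℕ.+ sum ps)) (sym 2h≡1)))) (half h (ι (p ℕ.+ sum ps))))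
      where
      half = solve 2 (λ h k → κ 2 :* h :+ k :- h := h :+ k) refl

  switching-iso : SwitchingIso H (completeMultipartite rs)
  switching-iso = with-half (inverse-pos (0≺ι-suc 1))
    where
    with-half : (Σ Q λ h → 0q ≺ h × ι 2 * h ≡ 1q) → SwitchingIso H (completeMultipartite rs)
    -- Vertex 0 serves as the base of the switching; it exists because the first part is nonempty.
    with-half (h , 0≺h , 2h≡1) = side zero , mk↔ₛ′ to from to-from from-to , λ i j → trans (cong not (sym (preserves i j))) (sym (switched zero i j))
      where
      open Classification H 2h≡1 0≺h (no-plane 2h≡1 0≺h)
      open Partition (partition n same same-refl same-sym same-class) renaming (iso to iso-parts)

      to-parts : Iso same (samePartFin parts)
      to-parts = iso-trans iso-parts (iso-sym (iso-Fin parts))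

      n≡ : n ≡ sum parts
      n≡ = ↔⇒≡ (mk↔ₛ′ (Iso.to to-parts) (Iso.from to-parts) (Iso.to-from to-parts) (Iso.from-to to-parts))

      same-g : ∀ x → g rs x ≡ g parts x
      same-g x = trans (det≡ x) (det-switched H (side zero) (switched zero) parts to-parts n≡ x)

      determined : ∀ qs → Positive qs → n ≡ sum qs → (∀ x → g rs x ≡ g qs x) → ∀ z → P rs z ≡ P qs z
      determined (suc q ∷ qs) _ sums same-g = P-determined rs q qs m roots sums same-g
      determined (zero ∷ qs)  (() ∷ _) _ _

      perm : rs ↭ parts
      perm = P-injective rs parts pos-ps positive (determined parts positive n≡ same-g)

      open Iso (iso-trans iso-parts (iso-trans (iso-↭ (↭-sym perm)) (iso-sym (iso-Fin rs))))

partSizes-positive : ∀ rn → All (λ p → 1 ≤ proj₁ p × 1 ≤ proj₂ p) rn → Positive (partSizes rn)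
partSizes-positive []             []               = []
partSizes-positive ((r , m) ∷ rn) ((_ , 1≤m) ∷ all) = Allₚ.++⁺ (Allₚ.replicate⁺ r 1≤m) (partSizes-positive rn all)

length-partSizes : ∀ rn → Any (λ p → 3 ≤ proj₁ p) rn → 3 ≤ length (partSizes rn)
length-partSizes ((r , m) ∷ rn) any rewrite Listₚ.length-++ (List.replicate r m) {partSizes rn} | Listₚ.length-replicate r {m} = go any
  where
  go : Any (λ p → 3 ≤ proj₁ p) ((r , m) ∷ rn) → 3 ≤ r ℕ.+ length (partSizes rn)
  go (here 3≤r)    = ℕₚ.≤-trans 3≤r (ℕₚ.m≤m+n r _)
  go (there any) = ℕₚ.≤-trans (length-partSizes rn any) (ℕₚ.m≤n+m _ r)

multipartite-determined : ∀ ps → Positive ps → 3 ≤ length ps → (Σ ℕ λ m → ∀ {z} → RootOf (suc m) z → Root₃ ps z) → SDetermined (completeMultipartite ps)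
multipartite-determined (suc p ∷ ps) pos-ps         3≤k (m , roots) H cosp = switching-iso p ps pos-ps 3≤k m roots H cosp
multipartite-determined (zero ∷ ps)  (() ∷ _)

theorem3p4 : (rn : List (ℕ × ℕ))
    → All (λ p → 1 ≤ proj₁ p × 1 ≤ proj₂ p) rn
    → Unique (map proj₂ rn)
    → Any (λ p → 3 ≤ proj₁ p) rn
    → SDetermined (K rn)
theorem3p4 rn all _ any = multipartite-determined (partSizes rn) (partSizes-positive rn all) (length-partSizes rn any) (triple-root rn all any)
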